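{- For any positive integers $k>n\ge1$, $$\sum_{\substack{\mathrm{wt}(\mathbf k)=k,\ \mathrm{dep}(\mathbf k)=n\\ \mathbf k\text{ admissible}}} \zeta^{t}_{q}(\mathbf k) = \frac{1}{k-1} \sum_{0 \le l \le j \le n-1} \binom{k-1}{j}\binom{j}{l} (k-1-l)\, t^j (1-t)^{n-1-j} (1-q)^{l} \zeta_{q}(k-l).$$
   Context: $q$ is a formal parameter, $[n]=(1-q^n)/(1-q)$. For an index $\mathbf k=(k_1,\dots,k_l)$ of positive integers: weight $\mathrm{wt}(\mathbf k)=k_1+\dots+k_l$, depth $\mathrm{dep}(\mathbf k)=l$; admissible means $k_1\ge2$. $\zeta_q(\mathbf k)=\sum_{m_1>\cdots>m_l\ge1}\prod_j q^{(k_j-1)m_j}/[m_j]^{k_j}$ (so $\zeta_q(k)=\sum_{m\ge1}q^{(k-1)m}/[m]^k$), and $\zeta^t_q(\mathbf k)=\sum_{\mathbf p}(1-q)^{\mathrm{wt}(\mathbf k)-\mathrm{wt}(\mathbf p)}\zeta_q(\mathbf p)t^{l-\mathrm{dep}(\mathbf p)}$, where $\mathbf p$ runs over indices $(k_1\,\square\cdots\square\,k_l)$ with each $\square$ filled by ``$,$'', ``$+$'' or ``$-1+$'' (neighbouring $a,b$ replaced by $a+b-1$). -}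

module Defs where

open import Data.Nat as ℕ using (ℕ; zero; suc; _∸_; _<ᵇ_; _≤ᵇ_)
open import Data.Nat.Combinatorics using (_C_)
open import Data.Integer using (+_)
open import Data.Rational as ℚ using (ℚ; 0ℚ; 1ℚ; _+_; _*_; -_)
open import Data.Bool using (Bool; true; false; if_then_else_)
open import Data.List using (List; []; _∷_; map; _++_; concatMap; length; zipWith; foldr)
open import Data.Nat.ListAction using (sum)

ℕ→ℚ : ℕ → ℚ
ℕ→ℚ n = (+ n) ℚ./ 1

-- 1/d for d ≥ 1 (only ever used with d ≥ 1; the value at 0 is irrelevant)
recip : ℕ → ℚ
recip zero    = 0ℚ
recip (suc d) = (+ 1) ℚ./ suc d

sumTo : ℕ → (ℕ → ℚ) → ℚ
sumTo zero    f = 0ℚ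
sumTo (suc n) f = sumTo n f + f n

sumℚ : List ℚ → ℚ
sumℚ = foldr _+_ 0ℚ

-- Formal power series in q over ℚ : coefficient sequences

Series : Set
Series = ℕ → ℚ

one₁ : Series
one₁ zero    = 1ℚ
one₁ (suc _) = 0ℚ

_⊛_ : Series → Series → Series
(f ⊛ g) N = sumTo (suc N) (λ i → f i * g (N ∸ i))

pow₁ : Series → ℕ → Series
pow₁ f zero    = one₁
pow₁ f (suc n) = f ⊛ pow₁ f n

shiftQ : ℕ → Series → Series
shiftQ e f N = if e ≤ᵇ N then f (N ∸ e) else 0ℚ

-- [m] = (1 - q^m)/(1 - q) = 1 + q + ... + q^(m-1)
qInt : ℕ → Series
qInt m N = if N <ᵇ m then 1ℚ else 0ℚ

-- Multiplicative inverse of a series f with constant term f 0 = 1: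
-- g 0 = 1,  g n = - Σ_{i=1}^{n} f i · g (n - i).
-- invList f n = [g n , g (n-1) , ... , g 0]
invList : Series → ℕ → List ℚ
invList f zero    = 1ℚ ∷ []
invList f (suc n) =
  let gs = invList f n in
  (- sumℚ (zipWith _*_ (map (λ i → f (suc i)) (Data.List.upTo (suc n))) gs)) ∷ gs

head0 : List ℚ → ℚ
head0 []      = 0ℚ
head0 (x ∷ _) = x

invUnit : Series → Series
invUnit f N = head0 (invList f N)

zTerm : ℕ → ℕ → Series
zTerm p m = shiftQ ((p ∸ 1) ℕ.* m) (pow₁ (invUnit (qInt m)) p)

zsum : List ℕ → ℕ → Series
zsum []       B = one₁
zsum (p ∷ ps) B N = sumTo B summand
  where
  summand : ℕ → ℚ
  summand zero    = 0ℚ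
  summand (suc m) = (zTerm p (suc m) ⊛ zsum ps (suc m)) N

-- ζ_q(p) as a power series in q.  For admissible p (p₁ ≥ 2) the summand
-- with top variable m₁ has q-adic order ≥ m₁, so only m₁ ≤ N contributes
-- to the coefficient of q^N; hence this coefficient is exact.
zetaQ : List ℕ → Series
zetaQ p N = zsum p (suc N) N

-- Formal power series in q and t over ℚ (contains ℚ[t][[q]]):
-- F i j = coefficient of q^i t^j

Series₂ : Set
Series₂ = ℕ → ℕ → ℚ

infixl 6 _⊕_
infixl 7 _⊗_

_⊕_ : Series₂ → Series₂ → Series₂
(f ⊕ g) i j = f i j + g i j

zero₂ : Series₂
zero₂ _ _ = 0ℚ

one₂ : Series₂
one₂ zero zero = 1ℚ
one₂ _    _    = 0ℚ

_⊗_ : Series₂ → Series₂ → Series₂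
(f ⊗ g) i j = sumTo (suc i) (λ a → sumTo (suc j) (λ b → f a b * g (i ∸ a) (j ∸ b)))

scale : ℚ → Series₂ → Series₂
scale c f i j = c * f i j

pow₂ : Series₂ → ℕ → Series₂
pow₂ f zero    = one₂
pow₂ f (suc n) = f ⊗ pow₂ f n

liftQ : Series → Series₂
liftQ f i zero    = f i
liftQ f i (suc _) = 0ℚ

qVar : Series₂
qVar (suc zero) zero = 1ℚ
qVar _          _    = 0ℚ

tVar : Series₂
tVar zero (suc zero) = 1ℚ
tVar _    _          = 0ℚ

neg₂ : Series₂ → Series₂
neg₂ f i j = - f i j

oneMinusQ : Series₂
oneMinusQ = one₂ ⊕ neg₂ qVar

oneMinusT : Series₂
oneMinusT = one₂ ⊕ neg₂ tVar

sum₂ : List Series₂ → Series₂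
sum₂ = foldr _⊕_ zero₂

sumTo₂ : ℕ → (ℕ → Series₂) → Series₂
sumTo₂ zero    F = zero₂
sumTo₂ (suc n) F = sumTo₂ n F ⊕ F n

wt : List ℕ → ℕ
wt = sum

dep : List ℕ → ℕ
dep = length

-- all indices (k₁ □ ⋯ □ k_l), one entry per filling of the boxes by
-- "," , "+" , "-1+"
-- fillFrom a ks : fillings of (a , ks) where a is the current (already
-- merged) leading entry
fillFrom : ℕ → List ℕ → List (List ℕ)
fillFrom a []       = (a ∷ []) ∷ []
fillFrom a (b ∷ ks) =
  map (a ∷_) (fillFrom b ks)
  ++ fillFrom (a ℕ.+ b) ks
  ++ fillFrom (a ℕ.+ b ∸ 1) ks

fillings : List ℕ → List (List ℕ)
fillings []       = [] ∷ []
fillings (a ∷ ks) = fillFrom a ks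

zetaTQ : List ℕ → Series₂
zetaTQ k = sum₂ (map (λ p → pow₂ oneMinusQ (wt k ∸ wt p)
                             ⊗ liftQ (zetaQ p)
                             ⊗ pow₂ tVar (dep k ∸ dep p))
                     (fillings k))

indices : ℕ → ℕ → List (List ℕ)
indices zero    zero    = [] ∷ []
indices (suc _) zero    = []
indices w       (suc n) =
  concatMap (λ a → map (suc a ∷_) (indices (w ∸ suc a) n))
            (Data.List.upTo w)

isAdmissible : List ℕ → Bool
isAdmissible []      = false
isAdmissible (k ∷ _) = 2 ≤ᵇ k

filterᵇ : (List ℕ → Bool) → List (List ℕ) → List (List ℕ)
filterᵇ P []       = []
filterᵇ P (x ∷ xs) = if P x then x ∷ filterᵇ P xs else filterᵇ P xs

admissibleIndices : ℕ → ℕ → List (List ℕ)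
admissibleIndices w n = filterᵇ isAdmissible (indices w n)

{-# OPTIONS --safe #-}
-- Merging neighbouring entries costs t, and because q^m + (1 - q)[m] = 1 the fillings of an
-- index collapse to a sum over m₁ ≥ m₂ ≥ ⋯ with a factor t for every equality.  Summed over
-- all indices, with x marking the weight and y the depth, this is x²y times
--   ∑_m q^m/[m] ∏_{j<m} β_j / ∏_{j≤m} D_j,   D_j = [j] - x q^j - txy,  β_j = D_j + xy.
-- Put c = q^(N+1) and replace q^m ∏ 1/D_j by c^m ∏ 1/D_{N+j}.  The difference of the terms for
-- N and N + 1 telescopes in m, by the two identities
--   D_{N+1+m} = q^m D_{N+1} + [m](1 - (1-q)txy),   D_{N+1+m} = c β_m + b_{N+1},
-- where b_m = [m] - txy - (1-t)xy q^m, so the sum equals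
--   (1 - (1-q)txy) ∑_m q^m / (D_m b_m).
-- The coefficients of the last series satisfy a Pascal-type recursion, which the right-hand side
-- satisfies as well.  Everything is carried out modulo q^L, where the remainders vanish.
module Submission where

open import Defs
open import Algebra using (CommutativeRing)
import Algebra.Properties.Semiring.Exp
import Algebra.Solver.Ring.NaturalCoefficients.Default as SemiringSolver
open import Data.Bool using (true; false; if_then_else_)
open import Data.Integer as ℤ using (+_)
import Data.Integer.Properties as ℤₚ
open import Data.List using (List; []; _∷_; _++_; map; concatMap; applyUpTo; upTo; zipWith)
open import Data.List.Relation.Unary.All as All using (All; []; _∷_)
import Data.List.Relation.Unary.All.Properties as Allₚ
open import Data.Nat as ℕ using (ℕ; zero; suc; _≤_; _<_; _∸_; z≤n; s≤s; _!)
open import Data.Nat.Combinatorics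
  using (_C_; nCk+nC[k+1]≡[n+1]C[k+1]; k>n⇒nCk≡0; nCk≡n!/k![n-k]!; k![n∸k]!∣n!)
open import Data.Nat.DivMod using (m/n*n≡m)
import Data.Nat.Properties as ℕₚ
import Data.Nat.Solver
open import Data.Product using (_,_; _×_; ∃₂)
open import Data.Rational as ℚ using (ℚ; 0ℚ; 1ℚ)
import Data.Rational.Properties as ℚₚ
open import Data.Rational.Unnormalised as ℚᵘ using (mkℚᵘ; *≡*)
import Data.Rational.Unnormalised.Properties as ℚᵘₚ
open import Level using (_⊔_)
open import Relation.Binary using (IsEquivalence)
open import Relation.Binary.PropositionalEquality as ≡ using (_≡_)

-- The only quantities inverted from scratch are the [m], whose constant term in q is 1. Every other
-- denominator is a unit minus a multiple of x or y, hence invertible by a geometric series. For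
-- this the rings are nested, t inside q inside x inside y, and equality in each compares
-- coefficients only below a bound. Of q the manipulation of sums needs no more than the axioms in
-- `QIntegers`, so it takes place over an arbitrary commutative ring, with q^L = 0 in place of
-- convergence. The parameter N joins the wanted sum, at N = 0, to a sum that vanishes, at N = L.
-- The obstacle at the end: the coefficients for weight i + 2 and depth j + 1 fill the triangle j ≤
-- i, but their recursion reaches one entry outside it. The outside entries form a geometric
-- sequence whose series `E` is W q^m/b_m, so the division by D_m b_m is done in two steps. The
-- division by k - 1 is harmless, because every coefficient on the right-hand side turns out to be a
-- natural number.

module FiniteSums {c ℓ} (R : CommutativeRing c ℓ) where
  open CommutativeRing R hiding (zero)
  open import Algebra.Properties.CommutativeSemigroup +-commutativeSemigroup using (interchange)
  open import Relation.Binary.Reasoning.Setoid setoid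

  ∑ : ℕ → (ℕ → Carrier) → Carrier
  ∑ zero    f = 0#
  ∑ (suc n) f = ∑ n f + f n

  ∑-cong< : ∀ n {f g} → (∀ i → i < n → f i ≈ g i) → ∑ n f ≈ ∑ n g
  ∑-cong< zero    f≈g = refl
  ∑-cong< (suc n) f≈g =
    +-cong (∑-cong< n (λ i i<n → f≈g i (ℕₚ.m<n⇒m<1+n i<n))) (f≈g n ℕₚ.≤-refl)

  ∑-cong : ∀ n {f g} → (∀ i → f i ≈ g i) → ∑ n f ≈ ∑ n g
  ∑-cong n f≈g = ∑-cong< n (λ i _ → f≈g i)

  ∑-0 : ∀ n {f} → (∀ i → i < n → f i ≈ 0#) → ∑ n f ≈ 0#
  ∑-0 zero    f≈0 = refl
  ∑-0 (suc n) f≈0 = trans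
    (+-cong (∑-0 n (λ i i<n → f≈0 i (ℕₚ.m<n⇒m<1+n i<n))) (f≈0 n ℕₚ.≤-refl))
    (+-identityˡ 0#)

  ∑-+ : ∀ n f g → ∑ n (λ i → f i + g i) ≈ ∑ n f + ∑ n g
  ∑-+ zero    f g = sym (+-identityˡ 0#)
  ∑-+ (suc n) f g = trans (+-congʳ (∑-+ n f g)) (interchange _ _ _ _)

  *-∑ : ∀ n a f → a * ∑ n f ≈ ∑ n (λ i → a * f i)
  *-∑ zero    a f = zeroʳ a
  *-∑ (suc n) a f = trans (distribˡ a _ _) (+-congʳ (*-∑ n a f))

  ∑-* : ∀ n f a → ∑ n f * a ≈ ∑ n (λ i → f i * a)
  ∑-* zero    f a = zeroˡ a
  ∑-* (suc n) f a = trans (distribʳ a _ _) (+-congʳ (∑-* n f a))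

  ∑-head : ∀ n f → ∑ (suc n) f ≈ f 0 + ∑ n (λ i → f (suc i))
  ∑-head zero    f = +-comm 0# (f 0)
  ∑-head (suc n) f = trans (+-congʳ (∑-head n f)) (+-assoc _ _ _)

  ∑-swap : ∀ m n (f : ℕ → ℕ → Carrier) →
           ∑ m (λ i → ∑ n (λ j → f i j)) ≈ ∑ n (λ j → ∑ m (λ i → f i j))
  ∑-swap zero    n f = sym (∑-0 n (λ _ _ → refl))
  ∑-swap (suc m) n f = trans (+-congʳ (∑-swap m n f)) (sym (∑-+ n _ _))

  ∑-extend : ∀ {m n} f → m ≤ n → (∀ i → m ≤ i → f i ≈ 0#) → ∑ m f ≈ ∑ n f
  ∑-extend {n = n} f z≤n f≈0 = sym (∑-0 n (λ i _ → f≈0 i z≤n))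
  ∑-extend {suc m} {suc n} f (s≤s m≤n) f≈0 = begin
    ∑ (suc m) f                      ≈⟨ ∑-head m f ⟩
    f 0 + ∑ m (λ i → f (suc i))      ≈⟨ +-congˡ (∑-extend _ m≤n (λ i m≤i → f≈0 (suc i) (s≤s m≤i))) ⟩
    f 0 + ∑ n (λ i → f (suc i))      ≈⟨ ∑-head n f ⟨
    ∑ (suc n) f                      ∎

-- Power series truncated at a bound

module TruncatedSeries {c ℓ} (R : CommutativeRing c ℓ) (L : ℕ) where
  open CommutativeRing R hiding (zero)
  open FiniteSums R
  open import Algebra.Properties.AbelianGroup +-abelianGroup using (ε⁻¹≈ε)
  open import Relation.Binary.Reasoning.Setoid setoid

  PS : Set c
  PS = ℕ → Carrier

  infix  4 _≋_
  infixl 7 _⋆_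
  infixl 6 _∔_

  -- Working modulo X^L makes the tails of q-adically convergent sums vanish.
  _≋_ : PS → PS → Set ℓ
  f ≋ g = ∀ n → n < L → f n ≈ g n

  _∔_ _⋆_ : PS → PS → PS
  (f ∔ g) n = f n + g n
  (f ⋆ g) n = ∑ (suc n) (λ i → f i * g (n ∸ i))

  constant : Carrier → PS
  constant a zero    = a
  constant a (suc _) = 0#

  shift : PS → PS
  shift f zero    = 0#
  shift f (suc n) = f n

  tail : PS → PS
  tail f n = f (suc n)

  ⋆-cong≤ : ∀ n {f f′ g g′} → (∀ i → i ≤ n → f i ≈ f′ i) → (∀ i → i ≤ n → g i ≈ g′ i) →
            (f ⋆ g) n ≈ (f′ ⋆ g′) n
  ⋆-cong≤ n f≈ g≈ = ∑-cong< (suc n) λ { i (s≤s i≤n) → *-cong (f≈ i i≤n) (g≈ (n ∸ i) (ℕₚ.m∸n≤m n i)) }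

  ⋆-congʳ : ∀ {f f′} g → (∀ n → f n ≈ f′ n) → ∀ n → (f ⋆ g) n ≈ (f′ ⋆ g) n
  ⋆-congʳ g f≈ n = ⋆-cong≤ n {g = g} (λ i _ → f≈ i) (λ _ _ → refl)

  ⋆-zero : ∀ f g → (f ⋆ g) 0 ≈ f 0 * g 0
  ⋆-zero f g = +-identityˡ (f 0 * g 0)

  ⋆-suc : ∀ f g n → (f ⋆ g) (suc n) ≈ f 0 * g (suc n) + (tail f ⋆ g) n
  ⋆-suc f g n = ∑-head (suc n) _

  -- The mirror image of `⋆-suc`. With both, commutativity is an induction on the degree, since
  -- peeling one factor from the left is peeling the other from the right.
  ⋆-sucʳ : ∀ f g n → (f ⋆ g) (suc n) ≈ (f ⋆ tail g) n + f (suc n) * g 0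
  ⋆-sucʳ f g zero    = trans (⋆-suc f g 0) (+-cong (sym (⋆-zero f (tail g))) (⋆-zero (tail f) g))
  ⋆-sucʳ f g (suc n) = begin
    (f ⋆ g) (suc (suc n))                                              ≈⟨ ⋆-suc f g (suc n) ⟩
    f 0 * g (suc (suc n)) + (tail f ⋆ g) (suc n)                       ≈⟨ +-congˡ (⋆-sucʳ (tail f) g n) ⟩
    f 0 * g (suc (suc n)) + ((tail f ⋆ tail g) n + f (suc (suc n)) * g 0) ≈⟨ +-assoc _ _ _ ⟨
    f 0 * g (suc (suc n)) + (tail f ⋆ tail g) n + f (suc (suc n)) * g 0 ≈⟨ +-congʳ (⋆-suc f (tail g) n) ⟨
    (f ⋆ tail g) (suc n) + f (suc (suc n)) * g 0                       ∎

  ⋆-comm : ∀ n f g → (f ⋆ g) n ≈ (g ⋆ f) n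
  ⋆-comm zero    f g = +-congˡ (*-comm (f 0) (g 0))
  ⋆-comm (suc n) f g = begin
    (f ⋆ g) (suc n)                    ≈⟨ ⋆-suc f g n ⟩
    f 0 * g (suc n) + (tail f ⋆ g) n   ≈⟨ +-cong (*-comm _ _) (⋆-comm n (tail f) g) ⟩
    g (suc n) * f 0 + (g ⋆ tail f) n   ≈⟨ +-comm _ _ ⟩
    (g ⋆ tail f) n + g (suc n) * f 0   ≈⟨ ⋆-sucʳ g f n ⟨
    (g ⋆ f) (suc n)                    ∎

  ⋆-distribʳ : ∀ f g k n → ((f ∔ g) ⋆ k) n ≈ (f ⋆ k) n + (g ⋆ k) n
  ⋆-distribʳ f g k n = trans (∑-cong (suc n) (λ i → distribʳ (k (n ∸ i)) (f i) (g i))) (∑-+ (suc n) _ _)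

  scalar-⋆ : ∀ a f g n → ((λ i → a * f i) ⋆ g) n ≈ a * (f ⋆ g) n
  scalar-⋆ a f g n = trans (∑-cong (suc n) (λ i → *-assoc a (f i) _)) (sym (*-∑ (suc n) a _))

  ⋆-assoc : ∀ n f g k → ((f ⋆ g) ⋆ k) n ≈ (f ⋆ (g ⋆ k)) n
  ⋆-assoc zero f g k = begin
    ((f ⋆ g) ⋆ k) 0      ≈⟨ ⋆-zero (f ⋆ g) k ⟩
    (f ⋆ g) 0 * k 0      ≈⟨ *-congʳ (⋆-zero f g) ⟩
    f 0 * g 0 * k 0      ≈⟨ *-assoc _ _ _ ⟩
    f 0 * (g 0 * k 0)    ≈⟨ *-congˡ (⋆-zero g k) ⟨
    f 0 * (g ⋆ k) 0      ≈⟨ ⋆-zero f (g ⋆ k) ⟨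
    (f ⋆ (g ⋆ k)) 0      ∎
  ⋆-assoc (suc n) f g k = begin
    ((f ⋆ g) ⋆ k) (suc n)
      ≈⟨ ⋆-suc (f ⋆ g) k n ⟩
    (f ⋆ g) 0 * k (suc n) + (tail (f ⋆ g) ⋆ k) n
      ≈⟨ +-cong (*-congʳ (⋆-zero f g)) (⋆-congʳ k (⋆-suc f g) n) ⟩
    f 0 * g 0 * k (suc n) + (((λ i → f 0 * tail g i) ∔ (tail f ⋆ g)) ⋆ k) n
      ≈⟨ +-cong (*-assoc _ _ _) (⋆-distribʳ _ (tail f ⋆ g) k n) ⟩
    f 0 * (g 0 * k (suc n)) + (((λ i → f 0 * tail g i) ⋆ k) n + ((tail f ⋆ g) ⋆ k) n)
      ≈⟨ +-congˡ (+-cong (scalar-⋆ (f 0) (tail g) k n) (⋆-assoc n (tail f) g k)) ⟩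
    f 0 * (g 0 * k (suc n)) + (f 0 * (tail g ⋆ k) n + (tail f ⋆ (g ⋆ k)) n)
      ≈⟨ +-assoc _ _ _ ⟨
    f 0 * (g 0 * k (suc n)) + f 0 * (tail g ⋆ k) n + (tail f ⋆ (g ⋆ k)) n
      ≈⟨ +-congʳ (distribˡ _ _ _) ⟨
    f 0 * (g 0 * k (suc n) + (tail g ⋆ k) n) + (tail f ⋆ (g ⋆ k)) n
      ≈⟨ +-congʳ (*-congˡ (⋆-suc g k n)) ⟨
    f 0 * (g ⋆ k) (suc n) + (tail f ⋆ (g ⋆ k)) n
      ≈⟨ ⋆-suc f (g ⋆ k) n ⟨
    (f ⋆ (g ⋆ k)) (suc n) ∎

  constant-⋆ : ∀ a f n → (constant a ⋆ f) n ≈ a * f n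
  constant-⋆ a f zero    = ⋆-zero (constant a) f
  constant-⋆ a f (suc n) = begin
    (constant a ⋆ f) (suc n)                    ≈⟨ ⋆-suc (constant a) f n ⟩
    a * f (suc n) + (tail (constant a) ⋆ f) n   ≈⟨ +-congˡ (∑-0 (suc n) (λ i _ → zeroˡ _)) ⟩
    a * f (suc n) + 0#                       ≈⟨ +-identityʳ _ ⟩
    a * f (suc n)                            ∎

  shift-⋆ : ∀ f g n → (shift f ⋆ g) n ≈ shift (f ⋆ g) n
  shift-⋆ f g zero    = trans (⋆-zero (shift f) g) (zeroˡ _)
  shift-⋆ f g (suc n) = trans (⋆-suc (shift f) g n) (trans (+-congʳ (zeroˡ _)) (+-identityˡ _))

  shift-constant-⋆ : ∀ f n → (shift (constant 1#) ⋆ f) n ≈ shift f n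
  shift-constant-⋆ f zero    = shift-⋆ (constant 1#) f zero
  shift-constant-⋆ f (suc n) = trans (shift-⋆ (constant 1#) f (suc n)) (trans (constant-⋆ 1# f n) (*-identityˡ _))

  opaque
    seriesRing : CommutativeRing c ℓ
    seriesRing = record
      { Carrier = PS
      ; _≈_ = _≋_
      ; _+_ = _∔_
      ; _*_ = _⋆_
      ; -_  = λ f n → - f n
      ; 0#  = λ _ → 0#
      ; 1#  = constant 1#
      ; isCommutativeRing = record
        { isRing = record
          { +-isAbelianGroup = record
            { isGroup = record
              { isMonoid = record
                { isSemigroup = record
                  { isMagma = record
                    { isEquivalence = ≋-isEquivalence
                    ; ∙-cong = λ f≈ g≈ n n<L → +-cong (f≈ n n<L) (g≈ n n<L)
                    }
                  ; assoc = λ f g k n _ → +-assoc (f n) (g n) (k n)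
                  }
                ; identity = (λ f n _ → +-identityˡ (f n)) , (λ f n _ → +-identityʳ (f n))
                }
              ; inverse = (λ f n _ → -‿inverseˡ (f n)) , (λ f n _ → -‿inverseʳ (f n))
              ; ⁻¹-cong = λ f≈ n n<L → -‿cong (f≈ n n<L)
              }
            ; comm = λ f g n _ → +-comm (f n) (g n)
            }
          ; *-cong = λ f≈ g≈ n n<L →
              ⋆-cong≤ n (λ i i≤n → f≈ i (ℕₚ.≤-<-trans i≤n n<L)) (λ i i≤n → g≈ i (ℕₚ.≤-<-trans i≤n n<L))
          ; *-assoc = λ f g k n _ → ⋆-assoc n f g k
          ; *-identity = (λ f n _ → ⋆-identityˡ f n)
                       , (λ f n _ → trans (⋆-comm n f (constant 1#)) (⋆-identityˡ f n))
          ; distrib = (λ f g k n _ → trans (⋆-comm n f (g ∔ k))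
                         (trans (⋆-distribʳ g k f n) (+-cong (⋆-comm n g f) (⋆-comm n k f))))
                    , (λ f g k n _ → ⋆-distribʳ g k f n)
          }
        ; *-comm = λ f g n _ → ⋆-comm n f g
        }
      }
      where
      ≋-isEquivalence : IsEquivalence _≋_
      ≋-isEquivalence = record
        { refl = λ _ _ → refl
        ; sym = λ f≈ n n<L → sym (f≈ n n<L)
        ; trans = λ f≈ g≈ n n<L → trans (f≈ n n<L) (g≈ n n<L)
        }
      ⋆-identityˡ : ∀ f n → (constant 1# ⋆ f) n ≈ f n
      ⋆-identityˡ f n = trans (constant-⋆ 1# f n) (*-identityˡ (f n))

  private module S = CommutativeRing seriesRing

  opaque
    unfolding seriesRing

    series : (ℕ → Carrier) → S.Carrier
    series f = f

    coeff : S.Carrier → ℕ → Carrier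
    coeff f = f

    coeff-series : ∀ f n → coeff (series f) n ≡ f n
    coeff-series f n = ≡.refl

    ≈-from-coeff : ∀ {f g} → (∀ n → n < L → coeff f n ≈ coeff g n) → f S.≈ g
    ≈-from-coeff f≈g = f≈g

    coeff-cong : ∀ {f g n} → n < L → f S.≈ g → coeff f n ≈ coeff g n
    coeff-cong n<L f≈g = f≈g _ n<L

    coeff-+ : ∀ f g n → coeff (f S.+ g) n ≡ coeff f n + coeff g n
    coeff-+ f g n = ≡.refl

    coeff-0 : ∀ n → coeff S.0# n ≡ 0#
    coeff-0 n = ≡.refl

    coeff-1 : ∀ n → coeff S.1# n ≡ constant 1# n
    coeff-1 n = ≡.refl

    coeff-neg : ∀ f n → coeff (S.- f) n ≡ - coeff f n
    coeff-neg f n = ≡.refl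

    coeff-* : ∀ f g n → coeff (f S.* g) n ≡ (coeff f ⋆ coeff g) n
    coeff-* f g n = ≡.refl

  const : Carrier → S.Carrier
  const a = series (constant a)

  X : S.Carrier
  X = series (shift (constant 1#))

  coeff-∑ : ∀ m F n → coeff (FiniteSums.∑ seriesRing m F) n ≈ ∑ m (λ i → coeff (F i) n)
  coeff-∑ zero    F n = reflexive (coeff-0 n)
  coeff-∑ (suc m) F n = trans (reflexive (coeff-+ _ (F m) n)) (+-congʳ (coeff-∑ m F n))

  opaque
    unfolding series

    coeff-const-* : ∀ a f n → coeff (const a S.* f) n ≈ a * coeff f n
    coeff-const-* = constant-⋆

    coeff-X-* : ∀ f n → coeff (X S.* f) n ≈ shift (coeff f) n
    coeff-X-* = shift-constant-⋆

    const-+-homo : ∀ a b → const (a + b) S.≈ const a S.+ const b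
    const-+-homo a b zero    _ = refl
    const-+-homo a b (suc n) _ = sym (+-identityˡ 0#)

    const-*-homo : ∀ a b → const (a * b) S.≈ const a S.* const b
    const-*-homo a b zero    _ = sym (constant-⋆ a (constant b) 0)
    const-*-homo a b (suc n) _ = sym (trans (constant-⋆ a (constant b) (suc n)) (zeroʳ a))

    const-0-homo : const 0# S.≈ S.0#
    const-0-homo zero    _ = refl
    const-0-homo (suc n) _ = refl

    const-1-homo : const 1# S.≈ S.1#
    const-1-homo n _ = refl

    const-neg-homo : ∀ a → const (- a) S.≈ S.- const a
    const-neg-homo a zero    _ = refl
    const-neg-homo a (suc n) _ = sym ε⁻¹≈ε

    const-cong : ∀ {a b} → a ≈ b → const a S.≈ const b
    const-cong a≈b zero    _ = a≈b
    const-cong a≈b (suc n) _ = refl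

  module _ where
    open import Algebra.Properties.Semiring.Exp semiring using (_^_)
    open SemiringSolver commutativeSemiring using (solve; _:=_; _:*_)

    -- The expansion of 1/(u - dX) in powers of X.
    geometric : Carrier → Carrier → S.Carrier
    geometric d u⁻¹ = series (λ n → d ^ n * u⁻¹ ^ suc n)

    -- Stated without subtraction, so that both sides can be compared coefficient by coefficient in
    -- the semiring language.
    geometric-equation : ∀ {u u⁻¹} d → u * u⁻¹ ≈ 1# →
      const u S.* geometric d u⁻¹ S.≈ S.1# S.+ X S.* (const d S.* geometric d u⁻¹)
    geometric-equation {u} {u⁻¹} d uu⁻¹ = ≈-from-coeff λ n _ → trans (lhs n) (trans (eq n) (sym (rhs n)))
      where
      f : ℕ → Carrier
      f n = d ^ n * u⁻¹ ^ suc n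
      g = geometric d u⁻¹
      lhs : ∀ n → coeff (const u S.* g) n ≈ u * f n
      lhs n = trans (coeff-const-* u g n) (*-congˡ (reflexive (coeff-series f n)))
      shifted : ∀ n → shift (coeff (const d S.* g)) n ≈ shift (λ n → d * f n) n
      shifted zero    = refl
      shifted (suc n) = trans (coeff-const-* d g n) (*-congˡ (reflexive (coeff-series f n)))
      rhs : ∀ n → coeff (S.1# S.+ X S.* (const d S.* g)) n ≈ constant 1# n + shift (λ n → d * f n) n
      rhs n = trans (reflexive (coeff-+ S.1# _ n))
        (+-cong (reflexive (coeff-1 n)) (trans (coeff-X-* (const d S.* g) n) (shifted n)))
      eq : ∀ n → u * f n ≈ constant 1# n + shift (λ n → d * f n) n
      eq zero    = begin
        u * (1# * (u⁻¹ * 1#))             ≈⟨ *-congˡ (trans (*-identityˡ _) (*-identityʳ _)) ⟩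
        u * u⁻¹                           ≈⟨ uu⁻¹ ⟩
        1#                                ≈⟨ +-identityʳ 1# ⟨
        1# + 0#                           ∎
      eq (suc n) = begin
        u * (d * d ^ n * (u⁻¹ * u⁻¹ ^ suc n)) ≈⟨ solve 5 (λ u d x u⁻¹ y →
                                               u :* (d :* x :* (u⁻¹ :* y)) := u :* u⁻¹ :* (d :* (x :* y))) refl _ _ _ _ _ ⟩
        u * u⁻¹ * (d * f n)               ≈⟨ trans (*-congʳ uu⁻¹) (*-identityˡ _) ⟩
        d * f n                           ≈⟨ +-identityˡ _ ⟨
        0# + d * f n                      ∎

-- The telescoping argument over abstract q-integers

module _ {c ℓ} (R : CommutativeRing c ℓ) where
  open CommutativeRing R hiding (zero)

  -- Here p m, u m and v m stand for q^m, [m] and 1/[m+1], and h for 1 − q.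
  record QIntegers (L : ℕ) : Set (c ⊔ ℓ) where
    field
      p u v : ℕ → Carrier
      h : Carrier
      p-0 : p 0 ≈ 1#
      p-+ : ∀ m n → p (m ℕ.+ n) ≈ p m * p n
      u-+ : ∀ m n → u (m ℕ.+ n) ≈ u m + p m * u n
      p+hu : ∀ m → p m + h * u m ≈ 1#
      uv : ∀ m → u (suc m) * v m ≈ 1#
      p-L : p L ≈ 0#

module Telescoping {c ℓ} (R : CommutativeRing c ℓ) (L : ℕ) (Q : QIntegers R L)
  (x̄ s s̄ r r̄ : CommutativeRing.Carrier R) where

  open CommutativeRing R hiding (zero)
  open QIntegers Q
  open FiniteSums R
  open import Algebra.Properties.Semiring.Exp semiring using (_^_)
  open import Relation.Binary.Reasoning.Setoid setoid
  open SemiringSolver commutativeSemiring using (solve; _:=_; _:+_; _:*_; con)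

  -- In the application x̄ = -x, s = txy and r = (1 - t)xy. Barred letters are independent
  -- variables, tied to the unbarred ones by `ss̄` and `rr̄`, so that the identities below are
  -- identities of commutative semirings.
  D β b : ℕ → Carrier
  D m = u m + x̄ * p m + s̄
  β m = u m + x̄ * p m + r
  b m = u m + s̄ + r̄ * p m

  W : Carrier
  W = 1# + h * s̄

  module _ (ss̄ : s + s̄ ≈ 0#) (rr̄ : r + r̄ ≈ 0#)
           (D⁻¹ : ℕ → Carrier) (DD⁻¹ : ∀ m → D (suc m) * D⁻¹ m ≈ 1#)
           (b⁻¹ : ℕ → Carrier) (bb⁻¹ : ∀ m → b (suc m) * b⁻¹ m ≈ 1#) where

    -- The constant s̄ is multiplied by q^m + (1 - q)[m] = 1. Its q^m part completes `D n`, and the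
    -- rest is the origin of the factor `W`.
    D-+ˡ : ∀ m n → D (m ℕ.+ n) ≈ p m * D n + u m * W
    D-+ˡ m n = begin
      u (m ℕ.+ n) + x̄ * p (m ℕ.+ n) + s̄
        ≈⟨ +-cong (+-cong (u-+ m n) (*-congˡ (p-+ m n))) (trans (sym (*-identityˡ s̄)) (*-congʳ (sym (p+hu m)))) ⟩
      u m + p m * u n + x̄ * (p m * p n) + (p m + h * u m) * s̄
        ≈⟨ solve 7 (λ um pm un x pn h s →
             um :+ pm :* un :+ x :* (pm :* pn) :+ (pm :+ h :* um) :* s
             := pm :* (un :+ x :* pn :+ s) :+ um :* (con 1 :+ h :* s)) refl
             (u m) (p m) (u n) x̄ (p n) h s̄ ⟩
      p m * D n + u m * W ∎

    -- Adding (r + r̄) q^m = 0 splits the same quantity differently: `β n` takes the r, and what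
    -- remains no longer depends on n.
    D-+ʳ : ∀ m n → D (m ℕ.+ n) ≈ p m * β n + b m
    D-+ʳ m n = begin
      u (m ℕ.+ n) + x̄ * p (m ℕ.+ n) + s̄
        ≈⟨ +-congʳ (+-cong (u-+ m n) (*-congˡ (p-+ m n))) ⟩
      u m + p m * u n + x̄ * (p m * p n) + s̄
        ≈⟨ +-identityʳ _ ⟨
      u m + p m * u n + x̄ * (p m * p n) + s̄ + 0#
        ≈⟨ +-congˡ (trans (sym (zeroˡ (p m))) (*-congʳ (sym rr̄))) ⟩
      u m + p m * u n + x̄ * (p m * p n) + s̄ + (r + r̄) * p m
        ≈⟨ solve 8 (λ um pm un x pn s r r̄ →
             um :+ pm :* un :+ x :* (pm :* pn) :+ s :+ (r :+ r̄) :* pm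
             := pm :* (un :+ x :* pn :+ r) :+ (um :+ s :+ r̄ :* pm)) refl
             (u m) (p m) (u n) x̄ (p n) s̄ r r̄ ⟩
      p m * β n + b m ∎

    ∏β : ℕ → Carrier
    ∏β zero    = 1#
    ∏β (suc m) = ∏β m * β (suc m)

    -- Since `D⁻¹ m` inverts `D (suc m)`, this is 1/(D_(N+1) ⋯ D_(N+m)).
    ∏D⁻¹ : ℕ → ℕ → Carrier
    ∏D⁻¹ N zero    = 1#
    ∏D⁻¹ N (suc m) = ∏D⁻¹ N m * D⁻¹ (N ℕ.+ m)

    ∏D⁻¹-head : ∀ N m → ∏D⁻¹ N (suc m) ≈ D⁻¹ N * ∏D⁻¹ (suc N) m
    ∏D⁻¹-head N zero    = trans (*-comm _ _) (*-congʳ (reflexive (≡.cong D⁻¹ (ℕₚ.+-identityʳ N))))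
    ∏D⁻¹-head N (suc m) = begin
      ∏D⁻¹ N (suc m) * D⁻¹ (N ℕ.+ suc m)
        ≈⟨ *-cong (∏D⁻¹-head N m) (reflexive (≡.cong D⁻¹ (ℕₚ.+-suc N m))) ⟩
      D⁻¹ N * ∏D⁻¹ (suc N) m * D⁻¹ (suc N ℕ.+ m)
        ≈⟨ *-assoc _ _ _ ⟩
      D⁻¹ N * ∏D⁻¹ (suc N) (suc m) ∎

    -- `φ 0` is the summand to be evaluated. Without the factor 1/[m+1] it becomes `γ`, the quantity
    -- whose differences in m are taken.
    φ γ : ℕ → ℕ → Carrier
    φ N m = p (suc N) ^ suc m * v m * ∏β m * ∏D⁻¹ N (suc m)
    γ N m = p (suc N) ^ suc m * ∏β m * ∏D⁻¹ N (suc m)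

    p-power : ∀ N m → p (suc N) ^ m ≈ p (m ℕ.* suc N)
    p-power N zero    = sym p-0
    p-power N (suc m) = trans (*-congˡ (p-power N m)) (sym (p-+ (suc N) (m ℕ.* suc N)))

    p-vanishes : ∀ n → L ≤ n → p n ≈ 0#
    p-vanishes n L≤n = begin
      p n                  ≡⟨ ≡.cong p (ℕₚ.m+[n∸m]≡n L≤n) ⟨
      p (L ℕ.+ (n ∸ L))    ≈⟨ p-+ L (n ∸ L) ⟩
      p L * p (n ∸ L)      ≈⟨ *-congʳ p-L ⟩
      0# * p (n ∸ L)       ≈⟨ zeroˡ _ ⟩
      0#                   ∎

    p-power-vanishes : ∀ N m → L ≤ m ℕ.* suc N → p (suc N) ^ m ≈ 0#
    p-power-vanishes N m L≤ = trans (p-power N m) (p-vanishes _ L≤)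

    p-power-suc : ∀ N m → p (suc (suc N)) ^ m ≈ p m * p (suc N) ^ m
    p-power-suc N m = begin
      p (suc (suc N)) ^ m       ≈⟨ p-power (suc N) m ⟩
      p (m ℕ.* suc (suc N))     ≡⟨ ≡.cong p (ℕₚ.*-suc m (suc N)) ⟩
      p (m ℕ.+ m ℕ.* suc N)     ≈⟨ p-+ m (m ℕ.* suc N) ⟩
      p m * p (m ℕ.* suc N)     ≈⟨ *-congˡ (p-power N m) ⟨
      p m * p (suc N) ^ m       ∎

    -- The link between the two directions: up to the factor `W` it is the difference of `φ` in N,
    -- and up to `b (suc N)` the difference of `γ` in m.
    δ : ℕ → ℕ → Carrier
    δ N m = p (suc N) ^ suc m * ∏β m * ∏D⁻¹ N (suc (suc m))

    ∏D⁻¹-dropʳ : ∀ N m → ∏D⁻¹ N (suc m) * D (suc N ℕ.+ m) ≈ ∏D⁻¹ N m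
    ∏D⁻¹-dropʳ N m = begin
      ∏D⁻¹ N m * D⁻¹ (N ℕ.+ m) * D (suc N ℕ.+ m)    ≈⟨ *-assoc _ _ _ ⟩
      ∏D⁻¹ N m * (D⁻¹ (N ℕ.+ m) * D (suc N ℕ.+ m))  ≈⟨ *-congˡ (trans (*-comm _ _) (DD⁻¹ (N ℕ.+ m))) ⟩
      ∏D⁻¹ N m * 1#                                 ≈⟨ *-identityʳ _ ⟩
      ∏D⁻¹ N m                                      ∎

    ∏D⁻¹-dropˡ : ∀ N m → D (suc N) * ∏D⁻¹ N (suc m) ≈ ∏D⁻¹ (suc N) m
    ∏D⁻¹-dropˡ N m = begin
      D (suc N) * ∏D⁻¹ N (suc m)             ≈⟨ *-congˡ (∏D⁻¹-head N m) ⟩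
      D (suc N) * (D⁻¹ N * ∏D⁻¹ (suc N) m)   ≈⟨ *-assoc _ _ _ ⟨
      D (suc N) * D⁻¹ N * ∏D⁻¹ (suc N) m     ≈⟨ *-congʳ (DD⁻¹ N) ⟩
      1# * ∏D⁻¹ (suc N) m                    ≈⟨ *-identityˡ _ ⟩
      ∏D⁻¹ (suc N) m                         ∎

    -- Numerator and denominator are extended by D_(N+m+2), which `D-+ˡ` splits. In one part q^(m+1)
    -- raises c^(m+1) to the power for N + 1 and D_(N+1) cancels the first denominator; in the other
    -- [m+1] cancels `v m`.
    φ-step : ∀ N m → φ N m ≈ φ (suc N) m + W * δ N m
    φ-step N m = begin
      y * v m * ∏β m * ∏D⁻¹ N (suc m)
        ≈⟨ *-congˡ (sym (∏D⁻¹-dropʳ N (suc m))) ⟩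
      y * v m * ∏β m * (Π * D (suc N ℕ.+ suc m))
        ≈⟨ *-congˡ (*-congˡ (trans (reflexive (≡.cong D (ℕₚ.+-comm (suc N) (suc m)))) (D-+ˡ (suc m) (suc N)))) ⟩
      y * v m * ∏β m * (Π * (p (suc m) * D (suc N) + u (suc m) * W))
        ≈⟨ solve 8 (λ y v B Π p D u W →
             y :* v :* B :* (Π :* (p :* D :+ u :* W))
             := p :* y :* v :* B :* (D :* Π) :+ u :* v :* (W :* (y :* B :* Π))) refl
             y (v m) (∏β m) Π (p (suc m)) (D (suc N)) (u (suc m)) W ⟩
      p (suc m) * y * v m * ∏β m * (D (suc N) * Π) + u (suc m) * v m * (W * δ N m)
        ≈⟨ +-cong (*-cong (*-congʳ (*-congʳ (sym (p-power-suc N (suc m))))) (∏D⁻¹-dropˡ N (suc m)))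
                  (trans (*-congʳ (uv m)) (*-identityˡ _)) ⟩
      φ (suc N) m + W * δ N m ∎
      where
      y = p (suc N) ^ suc m
      Π = ∏D⁻¹ N (suc (suc m))

    -- The same extension by D_(N+m+2), split by `D-+ʳ`: c β_(m+1) prolongs the products, and the
    -- other part carries a factor independent of m.
    γ-step : ∀ N m → γ N m ≈ γ N (suc m) + b (suc N) * δ N m
    γ-step N m = begin
      y * ∏β m * ∏D⁻¹ N (suc m)
        ≈⟨ *-congˡ (trans (sym (∏D⁻¹-dropʳ N (suc m))) (*-congˡ (D-+ʳ (suc N) (suc m)))) ⟩
      y * ∏β m * (Π * (p (suc N) * β (suc m) + b (suc N)))
        ≈⟨ solve 6 (λ y B Π p β b →
             y :* B :* (Π :* (p :* β :+ b))
             := p :* y :* (B :* β) :* Π :+ b :* (y :* B :* Π)) refl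
             y (∏β m) Π (p (suc N)) (β (suc m)) (b (suc N)) ⟩
      γ N (suc m) + b (suc N) * δ N m ∎
      where
      y = p (suc N) ^ suc m
      Π = ∏D⁻¹ N (suc (suc m))

    γ-telescope : ∀ N m → γ N 0 ≈ γ N m + b (suc N) * ∑ m (δ N)
    γ-telescope N zero    = sym (trans (+-congˡ (zeroʳ _)) (+-identityʳ _))
    γ-telescope N (suc m) = begin
      γ N 0                                                        ≈⟨ γ-telescope N m ⟩
      γ N m + b (suc N) * ∑ m (δ N)                                ≈⟨ +-congʳ (γ-step N m) ⟩
      γ N (suc m) + b (suc N) * δ N m + b (suc N) * ∑ m (δ N)      ≈⟨ +-assoc _ _ _ ⟩
      γ N (suc m) + (b (suc N) * δ N m + b (suc N) * ∑ m (δ N))    ≈⟨ +-congˡ (trans (+-comm _ _) (sym (distribˡ _ _ _))) ⟩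
      γ N (suc m) + b (suc N) * ∑ (suc m) (δ N)                    ∎

    -- Of the telescoped `γ` only the first term survives: the last one contains q^((N+1)(L+1)),
    -- which is zero.
    ∑δ : ∀ N → ∑ L (δ N) ≈ p (suc N) * D⁻¹ N * b⁻¹ N
    ∑δ N = begin
      S                                    ≈⟨ *-identityˡ _ ⟨
      1# * S                               ≈⟨ *-congʳ (bb⁻¹ N) ⟨
      b (suc N) * b⁻¹ N * S                ≈⟨ solve 3 (λ b b⁻¹ S → b :* b⁻¹ :* S := b :* S :* b⁻¹) refl _ _ _ ⟩
      b (suc N) * S * b⁻¹ N                ≈⟨ *-congʳ (trans (sym (+-identityˡ _)) (+-congʳ (sym γNL≈0))) ⟩
      (γ N L + b (suc N) * S) * b⁻¹ N      ≈⟨ *-congʳ (γ-telescope N L) ⟨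
      γ N 0 * b⁻¹ N                        ≈⟨ *-congʳ γN0 ⟩
      p (suc N) * D⁻¹ N * b⁻¹ N            ∎
      where
      S = ∑ L (δ N)
      γNL≈0 : γ N L ≈ 0#
      γNL≈0 = trans (*-assoc _ _ _) (trans (*-congʳ (p-power-vanishes N (suc L)
                (ℕₚ.≤-trans (ℕₚ.n≤1+n L) (ℕₚ.m≤m*n (suc L) (suc N))))) (zeroˡ _))
      γN0 : γ N 0 ≈ p (suc N) * D⁻¹ N
      γN0 = *-cong (trans (*-identityʳ _) (*-identityʳ _))
                   (trans (*-identityˡ _) (reflexive (≡.cong D⁻¹ (ℕₚ.+-identityʳ N))))

    ∑φ-telescope : ∀ N → ∑ L (φ 0) ≈ ∑ L (φ N) + ∑ N (λ i → W * (p (suc i) * D⁻¹ i * b⁻¹ i))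
    ∑φ-telescope zero    = sym (+-identityʳ _)
    ∑φ-telescope (suc N) = begin
      ∑ L (φ 0)                                         ≈⟨ ∑φ-telescope N ⟩
      ∑ L (φ N) + S                                     ≈⟨ +-congʳ (∑-cong L (φ-step N)) ⟩
      ∑ L (λ m → φ (suc N) m + W * δ N m) + S           ≈⟨ +-congʳ (∑-+ L _ _) ⟩
      ∑ L (φ (suc N)) + ∑ L (λ m → W * δ N m) + S       ≈⟨ +-congʳ (+-congˡ (sym (*-∑ L W (δ N)))) ⟩
      ∑ L (φ (suc N)) + W * ∑ L (δ N) + S               ≈⟨ +-congʳ (+-congˡ (*-congˡ (∑δ N))) ⟩
      ∑ L (φ (suc N)) + W * (p (suc N) * D⁻¹ N * b⁻¹ N) + S ≈⟨ trans (+-assoc _ _ _) (+-congˡ (+-comm _ _)) ⟩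
      ∑ L (φ (suc N)) + ∑ (suc N) (λ i → W * (p (suc i) * D⁻¹ i * b⁻¹ i)) ∎
      where
      S = ∑ N (λ i → W * (p (suc i) * D⁻¹ i * b⁻¹ i))

    -- After L steps every summand contains a positive power of q^(L+1), so only the accumulated
    -- differences remain.
    ∑φ≈ : ∑ L (φ 0) ≈ ∑ L (λ i → W * (p (suc i) * D⁻¹ i * b⁻¹ i))
    ∑φ≈ = trans (∑φ-telescope L) (trans (+-congʳ (∑-0 L (λ m _ → φLm≈0 m))) (+-identityˡ _))
      where
      φLm≈0 : ∀ m → φ L m ≈ 0#
      φLm≈0 m = begin
        p (suc L) ^ suc m * v m * ∏β m * ∏D⁻¹ L (suc m)   ≈⟨ *-congʳ (*-congʳ (*-congʳ (p-power-vanishes L (suc m)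
                                                              (ℕₚ.≤-trans (ℕₚ.n≤1+n L) (ℕₚ.m≤n*m (suc L) (suc m)))))) ⟩
        0# * v m * ∏β m * ∏D⁻¹ L (suc m)                  ≈⟨ *-congʳ (*-congʳ (zeroˡ _)) ⟩
        0# * ∏β m * ∏D⁻¹ L (suc m)                        ≈⟨ *-congʳ (zeroˡ _) ⟩
        0# * ∏D⁻¹ L (suc m)                               ≈⟨ zeroˡ _ ⟩
        0#                                                ∎

    -- Solves the recursion for a sum over chains 1 ≤ ⋯ ≤ m₂ ≤ m₁ = m + 1 with weights
    -- z/(u + x̄p) at every variable and τ at every equality.
    module _ {z τ : Carrier} (s≈ : s ≈ z * τ) (r≈ : s̄ + z ≈ r) {T S : ℕ → Carrier}
             (T≈ : ∀ m → (u (suc m) + x̄ * p (suc m)) * T m ≈ z * S m)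
             (S≈ : ∀ m → S m ≈ 1# + (∑ m T + τ * T m)) where

      -- The term for equal variables, zτ = s times `T m`, moves to the left and turns u + x̄p into
      -- `D`. What stays on the right involves only smaller variables.
      D*T : ∀ m → D (suc m) * T m ≈ z * (1# + ∑ m T)
      D*T m = begin
        (a + s̄) * T m                                  ≈⟨ distribʳ _ _ _ ⟩
        a * T m + s̄ * T m                              ≈⟨ +-congʳ (trans (T≈ m) (*-congˡ (S≈ m))) ⟩
        z * (1# + (∑ m T + τ * T m)) + s̄ * T m         ≈⟨ solve 6 (λ z one S τ T s̄ →
                                                             z :* (one :+ (S :+ τ :* T)) :+ s̄ :* T
                                                             := z :* (one :+ S) :+ (z :* τ :+ s̄) :* T) refl _ _ _ _ _ _ ⟩
        z * (1# + ∑ m T) + (z * τ + s̄) * T m           ≈⟨ +-congˡ (*-congʳ (trans (+-congʳ (sym s≈)) ss̄)) ⟩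
        z * (1# + ∑ m T) + 0# * T m                    ≈⟨ trans (+-congˡ (zeroˡ _)) (+-identityʳ _) ⟩
        z * (1# + ∑ m T)                               ∎
        where a = u (suc m) + x̄ * p (suc m)

      T≈D⁻¹ : ∀ m → T m ≈ z * (1# + ∑ m T) * D⁻¹ m
      T≈D⁻¹ m = begin
        T m                              ≈⟨ trans (*-congʳ (DD⁻¹ m)) (*-identityˡ _) ⟨
        D (suc m) * D⁻¹ m * T m          ≈⟨ solve 3 (λ D D⁻¹ T → D :* D⁻¹ :* T := D :* T :* D⁻¹) refl _ _ _ ⟩
        D (suc m) * T m * D⁻¹ m          ≈⟨ *-congʳ (D*T m) ⟩
        z * (1# + ∑ m T) * D⁻¹ m         ∎

      -- Each new term multiplies the partial sum by 1 + z/D, and D + z = β because s̄ + z = r.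
      1+∑T : ∀ m → 1# + ∑ m T ≈ ∏β m * ∏D⁻¹ 0 m
      1+∑T zero    = trans (+-identityʳ 1#) (sym (*-identityˡ 1#))
      1+∑T (suc m) = begin
        1# + (∑ m T + T m)                                     ≈⟨ +-assoc _ _ _ ⟨
        P + T m                                                ≈⟨ +-cong (trans (sym (*-identityˡ _)) (*-congʳ (sym (DD⁻¹ m)))) (T≈D⁻¹ m) ⟩
        D (suc m) * D⁻¹ m * P + z * P * D⁻¹ m                  ≈⟨ solve 5 (λ a s̄ D⁻¹ P z →
                                                                     (a :+ s̄) :* D⁻¹ :* P :+ z :* P :* D⁻¹
                                                                     := (a :+ (s̄ :+ z)) :* (P :* D⁻¹)) refl _ _ _ _ _ ⟩
        (u (suc m) + x̄ * p (suc m) + (s̄ + z)) * (P * D⁻¹ m)    ≈⟨ *-cong (+-congˡ r≈) (*-congʳ (1+∑T m)) ⟩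
        β (suc m) * (∏β m * ∏D⁻¹ 0 m * D⁻¹ m)                  ≈⟨ solve 4 (λ β B Π D⁻¹ →
                                                                     β :* (B :* Π :* D⁻¹) := B :* β :* (Π :* D⁻¹)) refl _ _ _ _ ⟩
        ∏β (suc m) * ∏D⁻¹ 0 (suc m)                            ∎
        where P = 1# + ∑ m T

      φ-chains : ∀ m → p (suc m) * v m * T m ≈ z * φ 0 m
      φ-chains m = begin
        p (suc m) * v m * T m
          ≈⟨ *-cong (*-congʳ (sym p₁)) (trans (T≈D⁻¹ m) (*-congʳ (*-congˡ (1+∑T m)))) ⟩
        p 1 ^ suc m * v m * (z * (∏β m * ∏D⁻¹ 0 m) * D⁻¹ m)
          ≈⟨ solve 6 (λ p v z B Π D⁻¹ → p :* v :* (z :* (B :* Π) :* D⁻¹) := z :* (p :* v :* B :* (Π :* D⁻¹))) refl _ _ _ _ _ _ ⟩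
        z * φ 0 m ∎
        where
        p₁ : p 1 ^ suc m ≈ p (suc m)
        p₁ = trans (p-power 0 (suc m)) (reflexive (≡.cong p (ℕₚ.*-identityʳ (suc m))))

      ∑-chains : ∑ L (λ m → p (suc m) * v m * T m) ≈ z * ∑ L (λ m → W * (p (suc m) * D⁻¹ m * b⁻¹ m))
      ∑-chains = begin
        ∑ L (λ m → p (suc m) * v m * T m)                          ≈⟨ ∑-cong L φ-chains ⟩
        ∑ L (λ m → z * φ 0 m)                                      ≈⟨ *-∑ L z (φ 0) ⟨
        z * ∑ L (φ 0)                                              ≈⟨ *-congˡ ∑φ≈ ⟩
        z * ∑ L (λ m → W * (p (suc m) * D⁻¹ m * b⁻¹ m))            ∎

-- Sums over lists, indices and fillings

module ListSums {c ℓ} (R : CommutativeRing c ℓ) where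
  open CommutativeRing R hiding (zero)
  open FiniteSums R
  open import Algebra.Properties.CommutativeSemigroup +-commutativeSemigroup using (interchange)
  open import Relation.Binary.Reasoning.Setoid setoid

  module _ {b} {B : Set b} where

    ∑ₗ : List B → (B → Carrier) → Carrier
    ∑ₗ []       f = 0#
    ∑ₗ (x ∷ xs) f = f x + ∑ₗ xs f

    ∑ₗ-cong : ∀ xs {f g} → (∀ x → f x ≈ g x) → ∑ₗ xs f ≈ ∑ₗ xs g
    ∑ₗ-cong []       f≈g = refl
    ∑ₗ-cong (x ∷ xs) f≈g = +-cong (f≈g x) (∑ₗ-cong xs f≈g)

    ∑ₗ-congAll : ∀ {p} {P : B → Set p} {xs f g} → All P xs → (∀ {x} → P x → f x ≈ g x) → ∑ₗ xs f ≈ ∑ₗ xs g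
    ∑ₗ-congAll []         f≈g = refl
    ∑ₗ-congAll (px ∷ pxs) f≈g = +-cong (f≈g px) (∑ₗ-congAll pxs f≈g)

    ∑ₗ-0 : ∀ xs → ∑ₗ xs (λ _ → 0#) ≈ 0#
    ∑ₗ-0 []       = refl
    ∑ₗ-0 (x ∷ xs) = trans (+-identityˡ _) (∑ₗ-0 xs)

    ∑ₗ-+ : ∀ xs f g → ∑ₗ xs (λ x → f x + g x) ≈ ∑ₗ xs f + ∑ₗ xs g
    ∑ₗ-+ []       f g = sym (+-identityˡ 0#)
    ∑ₗ-+ (x ∷ xs) f g = trans (+-congˡ (∑ₗ-+ xs f g)) (interchange _ _ _ _)

    *-∑ₗ : ∀ xs a f → a * ∑ₗ xs f ≈ ∑ₗ xs (λ x → a * f x)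
    *-∑ₗ []       a f = zeroʳ a
    *-∑ₗ (x ∷ xs) a f = trans (distribˡ a _ _) (+-congˡ (*-∑ₗ xs a f))

    ∑ₗ-++ : ∀ xs ys f → ∑ₗ (xs ++ ys) f ≈ ∑ₗ xs f + ∑ₗ ys f
    ∑ₗ-++ []       ys f = sym (+-identityˡ _)
    ∑ₗ-++ (x ∷ xs) ys f = trans (+-congˡ (∑ₗ-++ xs ys f)) (sym (+-assoc _ _ _))

    ∑ₗ-∑ : ∀ xs n (f : B → ℕ → Carrier) → ∑ₗ xs (λ x → ∑ n (f x)) ≈ ∑ n (λ i → ∑ₗ xs (λ x → f x i))
    ∑ₗ-∑ []       n f = sym (∑-0 n (λ _ _ → refl))
    ∑ₗ-∑ (x ∷ xs) n f = trans (+-congˡ (∑ₗ-∑ xs n f)) (sym (∑-+ n _ _))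

    ∑ₗ-applyUpTo : ∀ (g : ℕ → B) n f → ∑ₗ (applyUpTo g n) f ≈ ∑ n (λ i → f (g i))
    ∑ₗ-applyUpTo g zero    f = refl
    ∑ₗ-applyUpTo g (suc n) f = trans (+-congˡ (∑ₗ-applyUpTo (λ i → g (suc i)) n f)) (sym (∑-head n _))

  module _ {a b} {A : Set a} {B : Set b} where

    ∑ₗ-map : ∀ (g : A → B) xs f → ∑ₗ (map g xs) f ≈ ∑ₗ xs (λ x → f (g x))
    ∑ₗ-map g []       f = refl
    ∑ₗ-map g (x ∷ xs) f = +-congˡ (∑ₗ-map g xs f)

    ∑ₗ-concatMap : ∀ (g : A → List B) xs f → ∑ₗ (concatMap g xs) f ≈ ∑ₗ xs (λ x → ∑ₗ (g x) f)
    ∑ₗ-concatMap g []       f = refl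
    ∑ₗ-concatMap g (x ∷ xs) f = trans (∑ₗ-++ (g x) _ f) (+-congˡ (∑ₗ-concatMap g xs f))

  ∑ₗ-filterᵇ : ∀ P xs f → ∑ₗ (filterᵇ P xs) f ≈ ∑ₗ xs (λ x → if P x then f x else 0#)
  ∑ₗ-filterᵇ P []       f = refl
  ∑ₗ-filterᵇ P (x ∷ xs) f with P x
  ... | true  = +-congˡ (∑ₗ-filterᵇ P xs f)
  ... | false = trans (∑ₗ-filterᵇ P xs f) (sym (+-identityˡ _))

  ∑ₗ-indices : ∀ w n f → ∑ₗ (indices w (suc n)) f ≈ ∑ w (λ a → ∑ₗ (indices (w ∸ suc a) n) (λ ks → f (suc a ∷ ks)))
  ∑ₗ-indices zero    n f = refl
  ∑ₗ-indices (suc w) n f = begin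
    ∑ₗ (indices (suc w) (suc n)) f
      ≈⟨ ∑ₗ-concatMap g (upTo (suc w)) f ⟩
    ∑ₗ (upTo (suc w)) (λ a → ∑ₗ (g a) f)
      ≈⟨ ∑ₗ-applyUpTo (λ a → a) (suc w) _ ⟩
    ∑ (suc w) (λ a → ∑ₗ (g a) f)
      ≈⟨ ∑-cong (suc w) (λ a → ∑ₗ-map (suc a ∷_) (indices (w ∸ a) n) f) ⟩
    ∑ (suc w) (λ a → ∑ₗ (indices (w ∸ a) n) (λ ks → f (suc a ∷ ks))) ∎
    where
    g : ℕ → List (List ℕ)
    g a = map (suc a ∷_) (indices (w ∸ a) n)

  ∑ₗ-admissibleIndices : ∀ w n f → ∑ₗ (admissibleIndices (suc w) (suc n)) f ≈
    ∑ w (λ a → ∑ₗ (indices (w ∸ suc a) n) (λ ks → f (suc (suc a) ∷ ks)))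
  ∑ₗ-admissibleIndices w n f = begin
    ∑ₗ (admissibleIndices (suc w) (suc n)) f
      ≈⟨ ∑ₗ-filterᵇ isAdmissible (indices (suc w) (suc n)) f ⟩
    ∑ₗ (indices (suc w) (suc n)) (λ ks → if isAdmissible ks then f ks else 0#)
      ≈⟨ ∑ₗ-indices (suc w) n _ ⟩
    ∑ (suc w) (λ a → ∑ₗ (indices (w ∸ a) n) (λ ks → if isAdmissible (suc a ∷ ks) then f (suc a ∷ ks) else 0#))
      -- The summand a = 0 has first entry 1, so the filter replaces it by zero.
      ≈⟨ ∑-head w _ ⟩
    ∑ₗ (indices w n) (λ _ → 0#) + ∑ w (λ a → ∑ₗ (indices (w ∸ suc a) n) (λ ks → f (suc (suc a) ∷ ks)))
      ≈⟨ trans (+-congʳ (∑ₗ-0 (indices w n))) (+-identityˡ _) ⟩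
    ∑ w (λ a → ∑ₗ (indices (w ∸ suc a) n) (λ ks → f (suc (suc a) ∷ ks))) ∎

indices-positive : ∀ w n → All (All (1 ≤_)) (indices w n)
indices-positive zero    zero    = [] ∷ []
indices-positive (suc w) zero    = []
indices-positive zero    (suc n) = []
indices-positive (suc w) (suc n) = Allₚ.concat⁺ (Allₚ.map⁺ (All.universal
  (λ a → Allₚ.map⁺ (All.map (λ pos → s≤s z≤n ∷ pos) (indices-positive (w ∸ a) n))) (upTo (suc w))))

-- The bounds on weight and depth make the truncated subtractions in the exponents genuine
-- differences. The bound on the first entry says that merging preserves admissibility.
Filling : ℕ → List ℕ → List ℕ → Set
Filling a ks p = ∃₂ λ b ps → p ≡ b ∷ ps × a ≤ b × wt p ≤ a ℕ.+ wt ks × dep p ≤ suc (dep ks)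

fillFrom-Filling : ∀ a {ks} → All (1 ≤_) ks → All (Filling a ks) (fillFrom a ks)
fillFrom-Filling a {[]} [] = (a , [] , ≡.refl , ℕₚ.≤-refl , ℕₚ.≤-refl , ℕₚ.≤-refl) ∷ []
fillFrom-Filling a {suc b ∷ ks} (s≤s z≤n ∷ pos) =
  Allₚ.++⁺ (Allₚ.map⁺ (All.map comma (fillFrom-Filling (suc b) pos)))
    (Allₚ.++⁺ (All.map plus (fillFrom-Filling (a ℕ.+ suc b) pos))
              (All.map minus (fillFrom-Filling (a ℕ.+ suc b ∸ 1) pos)))
  where
  -- Positivity of the merged entry is essential here: filling with -1+ must not lower the leading
  -- entry.
  a≤a+b : a ≤ a ℕ.+ suc b ∸ 1
  a≤a+b = ≡.subst (λ x → a ≤ x ∸ 1) (≡.sym (ℕₚ.+-suc a b)) (ℕₚ.m≤m+n a b)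
  comma : ∀ {p} → Filling (suc b) ks p → Filling a (suc b ∷ ks) (a ∷ p)
  comma (_ , _ , ≡.refl , _ , wt≤ , dep≤) = a , _ , ≡.refl , ℕₚ.≤-refl , ℕₚ.+-monoʳ-≤ a wt≤ , s≤s dep≤
  plus : ∀ {p} → Filling (a ℕ.+ suc b) ks p → Filling a (suc b ∷ ks) p
  plus (_ , _ , eq , a≤ , wt≤ , dep≤) = _ , _ , eq , ℕₚ.≤-trans (ℕₚ.m≤m+n a (suc b)) a≤
    , ℕₚ.≤-trans wt≤ (ℕₚ.≤-reflexive (ℕₚ.+-assoc a (suc b) (wt ks))) , ℕₚ.≤-trans dep≤ (ℕₚ.n≤1+n _)
  minus : ∀ {p} → Filling (a ℕ.+ suc b ∸ 1) ks p → Filling a (suc b ∷ ks) p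
  minus (_ , _ , eq , a≤ , wt≤ , dep≤) = _ , _ , eq , ℕₚ.≤-trans a≤a+b a≤
    , ℕₚ.≤-trans wt≤ (ℕₚ.≤-trans (ℕₚ.+-monoˡ-≤ (wt ks) (ℕₚ.m∸n≤m (a ℕ.+ suc b) 1))
                                 (ℕₚ.≤-reflexive (ℕₚ.+-assoc a (suc b) (wt ks))))
    , ℕₚ.≤-trans dep≤ (ℕₚ.n≤1+n _)

-- Interpolated values as sums over weakly decreasing variables

module Interpolation {c ℓ} (A : CommutativeRing c ℓ) (L : ℕ) (Q : QIntegers A L)
                     (t : CommutativeRing.Carrier A) where
  open CommutativeRing A hiding (zero)
  open QIntegers Q
  open FiniteSums A
  open ListSums A
  open import Algebra.Properties.Semiring.Exp semiring using (_^_; ^-congʳ; ^-homo-*)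
  open import Relation.Binary.Reasoning.Setoid setoid
  open SemiringSolver commutativeSemiring using (solve; _:=_; _:+_; _:*_)

  -- Summation variables are shifted down by one: m stands for the paper's m + 1.
  zt : ℕ → ℕ → Carrier
  zt k m = p (suc m) ^ (k ∸ 1) * v m ^ k

  ζ : List ℕ → ℕ → Carrier
  ζ []       B = 1#
  ζ (k ∷ ks) B = ∑ B (λ m → zt k m * ζ ks m)

  -- Fixing the largest variable lets fillings with different leading entries be compared at one and
  -- the same m. The value at `[]` is a dummy, since fillings of a nonempty index are nonempty.
  ζtop : List ℕ → ℕ → Carrier
  ζtop []       m = 0#
  ζtop (k ∷ ks) m = zt k m * ζ ks m

  -- The interpolated sum over m₁ ≥ m₂ ≥ ⋯ in which every equality of neighbours
  -- contributes a factor t, restricted to m₁ = m.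
  star : List ℕ → ℕ → Carrier
  rest : List ℕ → ℕ → Carrier
  star []       m = 0#
  star (k ∷ ks) m = zt k m * rest ks m
  rest []       m = 1#
  rest (k ∷ ks) m = ∑ m (λ i → zt k i * rest ks i) + t * (zt k m * rest ks m)

  -- Because q^m + (1 - q)[m] = 1, the two ways of merging neighbours add up to a product.
  zt-merge : ∀ a b m → 1 ≤ a → 1 ≤ b → zt (a ℕ.+ b) m + h * zt (a ℕ.+ b ∸ 1) m ≈ zt a m * zt b m
  zt-merge (suc a) (suc b) m _ _ = begin
    zt (suc (a ℕ.+ suc b)) m + h * zt (a ℕ.+ suc b) m
      ≡⟨ ≡.cong (λ k → zt (suc k) m + h * zt k m) (ℕₚ.+-suc a b) ⟩
    P * P ^ (a ℕ.+ b) * (V * (V * V ^ (a ℕ.+ b))) + h * (P ^ (a ℕ.+ b) * (V * V ^ (a ℕ.+ b)))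
      ≈⟨ +-cong (*-cong (*-congˡ P+) (*-congˡ (*-congˡ V+)))
                (trans (*-congˡ (*-cong P+ (*-congˡ V+))) (trans (sym (*-identityʳ _)) (*-congˡ (sym (uv m))))) ⟩
    P * (P ^ a * P ^ b) * (V * (V * (V ^ a * V ^ b))) + h * (P ^ a * P ^ b * (V * (V ^ a * V ^ b))) * (u (suc m) * V)
      ≈⟨ solve 8 (λ P Pa Pb V Va Vb h u →
           P :* (Pa :* Pb) :* (V :* (V :* (Va :* Vb))) :+ h :* (Pa :* Pb :* (V :* (Va :* Vb))) :* (u :* V)
           := (P :+ h :* u) :* (Pa :* (V :* Va) :* (Pb :* (V :* Vb)))) refl
           P (P ^ a) (P ^ b) V (V ^ a) (V ^ b) h (u (suc m)) ⟩
    (P + h * u (suc m)) * (zt (suc a) m * zt (suc b) m)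
      ≈⟨ trans (*-congʳ (p+hu (suc m))) (*-identityˡ _) ⟩
    zt (suc a) m * zt (suc b) m ∎
    where
    P = p (suc m)
    V = v m
    P+ : P ^ (a ℕ.+ b) ≈ P ^ a * P ^ b
    P+ = ^-homo-* P a b
    V+ : V ^ (a ℕ.+ b) ≈ V ^ a * V ^ b
    V+ = ^-homo-* V a b

  term : ℕ → ℕ → List ℕ → Carrier → Carrier
  term w d p x = h ^ (w ∸ wt p) * x * t ^ (d ∸ dep p)

  term-∷ : ∀ w d a m p → term (a ℕ.+ w) (suc d) (a ∷ p) (zt a m * ζ p m) ≈ zt a m * term w d p (ζ p m)
  term-∷ w d a m p = begin
    h ^ (a ℕ.+ w ∸ (a ℕ.+ wt p)) * (zt a m * ζ p m) * t ^ (d ∸ dep p)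
      ≡⟨ ≡.cong (λ k → h ^ k * (zt a m * ζ p m) * t ^ (d ∸ dep p)) (ℕₚ.[m+n]∸[m+o]≡n∸o a w (wt p)) ⟩
    h ^ (w ∸ wt p) * (zt a m * ζ p m) * t ^ (d ∸ dep p)
      ≈⟨ solve 4 (λ x z y t → x :* (z :* y) :* t := z :* (x :* y :* t)) refl _ _ _ _ ⟩
    zt a m * term w d p (ζ p m) ∎

  term-cong : ∀ w d p {x y} → x ≈ y → term w d p x ≈ term w d p y
  term-cong w d p x≈y = *-congʳ (*-congˡ x≈y)

  term-∑ : ∀ w d p n f → term w d p (∑ n f) ≈ ∑ n (λ i → term w d p (f i))
  term-∑ w d p n f = trans (*-congʳ (*-∑ n _ _)) (∑-* n _ _)

  term-suc-dep : ∀ w d p x → dep p ≤ d → term w (suc d) p x ≈ t * term w d p x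
  term-suc-dep w d p x dep≤ = trans
    (*-congˡ (^-congʳ t (ℕₚ.+-∸-assoc 1 dep≤)))
    (solve 3 (λ x t y → x :* (t :* y) := t :* (x :* y)) refl _ _ _)

  term-suc-wt : ∀ w d p x → wt p ≤ w → term (suc w) d p x ≈ h * term w d p x
  term-suc-wt w d p x wt≤ = trans
    (*-congʳ (*-congʳ (^-congʳ h (ℕₚ.+-∸-assoc 1 wt≤))))
    (solve 4 (λ h x y z → h :* x :* y :* z := h :* (x :* y :* z)) refl _ _ _ _)

  ζ-Filling : ∀ {a ks p} B → Filling a ks p → ζ p B ≈ ∑ B (ζtop p)
  ζ-Filling B (_ , _ , ≡.refl , _) = refl

  -- Induction on the tail, for all leading entries at once. A comma leaves a strict inequality,
  -- hence a sum over i < m. The two merged families differ only in the leading entry and in one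
  -- factor h, which makes up for the lost unit of weight; `zt-merge` joins them into the term m₁ =
  -- m₂.
  ∑-fillFrom : ∀ a ks m → 1 ≤ a → All (1 ≤_) ks →
    ∑ₗ (fillFrom a ks) (λ p → term (a ℕ.+ wt ks) (suc (dep ks)) p (ζtop p m)) ≈ star (a ∷ ks) m
  ∑-fillFrom a [] m 1≤a [] = begin
    h ^ (a ℕ.+ 0 ∸ (a ℕ.+ 0)) * (zt a m * 1#) * 1# + 0#
      ≈⟨ trans (+-identityʳ _) (*-identityʳ _) ⟩
    h ^ (a ℕ.+ 0 ∸ (a ℕ.+ 0)) * (zt a m * 1#)
      ≈⟨ *-congʳ (^-congʳ h (ℕₚ.n∸n≡0 (a ℕ.+ 0))) ⟩
    1# * (zt a m * 1#)
      ≈⟨ *-identityˡ _ ⟩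
    zt a m * 1# ∎
  ∑-fillFrom a (b ∷ ks) m 1≤a (1≤b ∷ pos) = begin
    ∑ₗ (map (a ∷_) (fillFrom b ks) ++ fillFrom (a ℕ.+ b) ks ++ fillFrom (a ℕ.+ b ∸ 1) ks) f
      ≈⟨ trans (∑ₗ-++ (map (a ∷_) (fillFrom b ks)) _ f) (+-congˡ (∑ₗ-++ (fillFrom (a ℕ.+ b) ks) _ f)) ⟩
    ∑ₗ (map (a ∷_) (fillFrom b ks)) f + (∑ₗ (fillFrom (a ℕ.+ b) ks) f + ∑ₗ (fillFrom (a ℕ.+ b ∸ 1) ks) f)
      ≈⟨ +-cong comma (+-cong plus minus) ⟩
    zt a m * ∑ m (star (b ∷ ks)) + (t * (zt (a ℕ.+ b) m * ρ) + h * (t * (zt (a ℕ.+ b ∸ 1) m * ρ)))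
      ≈⟨ +-congˡ (solve 5 (λ t x ρ h y →
           t :* (x :* ρ) :+ h :* (t :* (y :* ρ)) := (x :+ h :* y) :* (t :* ρ)) refl _ _ _ _ _) ⟩
    zt a m * ∑ m (star (b ∷ ks)) + (zt (a ℕ.+ b) m + h * zt (a ℕ.+ b ∸ 1) m) * (t * ρ)
      ≈⟨ +-congˡ (*-congʳ (zt-merge a b m 1≤a 1≤b)) ⟩
    zt a m * ∑ m (star (b ∷ ks)) + zt a m * zt b m * (t * ρ)
      ≈⟨ solve 5 (λ x s y t ρ → x :* s :+ x :* y :* (t :* ρ) := x :* (s :+ t :* (y :* ρ))) refl _ _ _ _ _ ⟩
    star (a ∷ b ∷ ks) m ∎
    where
    w = b ℕ.+ wt ks
    d = suc (dep ks)
    ρ = rest ks m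
    f : List ℕ → Carrier
    f p = term (a ℕ.+ w) (suc d) p (ζtop p m)

    comma : ∑ₗ (map (a ∷_) (fillFrom b ks)) f ≈ zt a m * ∑ m (star (b ∷ ks))
    comma = begin
      ∑ₗ (map (a ∷_) (fillFrom b ks)) f
        ≈⟨ ∑ₗ-map (a ∷_) (fillFrom b ks) f ⟩
      ∑ₗ (fillFrom b ks) (λ p → f (a ∷ p))
        ≈⟨ ∑ₗ-cong (fillFrom b ks) (term-∷ w d a m) ⟩
      ∑ₗ (fillFrom b ks) (λ p → zt a m * term w d p (ζ p m))
        ≈⟨ *-∑ₗ (fillFrom b ks) (zt a m) _ ⟨
      zt a m * ∑ₗ (fillFrom b ks) (λ p → term w d p (ζ p m))
        ≈⟨ *-congˡ (∑ₗ-congAll (fillFrom-Filling b pos) λ {p} fill →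
             trans (term-cong w d p (ζ-Filling {ks = ks} m fill)) (term-∑ w d p m (ζtop p))) ⟩
      zt a m * ∑ₗ (fillFrom b ks) (λ p → ∑ m (λ i → term w d p (ζtop p i)))
        ≈⟨ *-congˡ (∑ₗ-∑ (fillFrom b ks) m _) ⟩
      zt a m * ∑ m (λ i → ∑ₗ (fillFrom b ks) (λ p → term w d p (ζtop p i)))
        ≈⟨ *-congˡ (∑-cong m (λ i → ∑-fillFrom b ks i 1≤b pos)) ⟩
      zt a m * ∑ m (star (b ∷ ks)) ∎

    merged : ∀ {e} → 1 ≤ e →
      ∑ₗ (fillFrom e ks) (λ p → term (e ℕ.+ wt ks) (suc d) p (ζtop p m)) ≈ t * (zt e m * ρ)
    merged {e} 1≤e = begin
      ∑ₗ (fillFrom e ks) (λ p → term (e ℕ.+ wt ks) (suc d) p (ζtop p m))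
        ≈⟨ ∑ₗ-congAll (fillFrom-Filling e pos) (λ { {p} (_ , _ , _ , _ , _ , dep≤) → term-suc-dep (e ℕ.+ wt ks) d p _ dep≤ }) ⟩
      ∑ₗ (fillFrom e ks) (λ p → t * term (e ℕ.+ wt ks) d p (ζtop p m))
        ≈⟨ *-∑ₗ (fillFrom e ks) t _ ⟨
      t * ∑ₗ (fillFrom e ks) (λ p → term (e ℕ.+ wt ks) d p (ζtop p m))
        ≈⟨ *-congˡ (∑-fillFrom e ks m 1≤e pos) ⟩
      t * (zt e m * ρ) ∎

    plus : ∑ₗ (fillFrom (a ℕ.+ b) ks) f ≈ t * (zt (a ℕ.+ b) m * ρ)
    plus = trans
      (reflexive (≡.cong (λ k → ∑ₗ (fillFrom (a ℕ.+ b) ks) (λ p → term k (suc d) p (ζtop p m)))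
                         (≡.sym (ℕₚ.+-assoc a b (wt ks)))))
      (merged (ℕₚ.≤-trans 1≤a (ℕₚ.m≤m+n a b)))

    minus : ∑ₗ (fillFrom (a ℕ.+ b ∸ 1) ks) f ≈ h * (t * (zt (a ℕ.+ b ∸ 1) m * ρ))
    minus = begin
      ∑ₗ (fillFrom e ks) f
        ≡⟨ ≡.cong (λ k → ∑ₗ (fillFrom e ks) (λ p → term k (suc d) p (ζtop p m))) weight ⟩
      ∑ₗ (fillFrom e ks) (λ p → term (suc (e ℕ.+ wt ks)) (suc d) p (ζtop p m))
        ≈⟨ ∑ₗ-congAll (fillFrom-Filling e pos) (λ { {p} (_ , _ , _ , _ , wt≤ , _) → term-suc-wt (e ℕ.+ wt ks) (suc d) p _ wt≤ }) ⟩
      ∑ₗ (fillFrom e ks) (λ p → h * term (e ℕ.+ wt ks) (suc d) p (ζtop p m))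
        ≈⟨ *-∑ₗ (fillFrom e ks) h _ ⟨
      h * ∑ₗ (fillFrom e ks) (λ p → term (e ℕ.+ wt ks) (suc d) p (ζtop p m))
        ≈⟨ *-congˡ (merged 1≤e) ⟩
      h * (t * (zt e m * ρ)) ∎
      where
      e = a ℕ.+ b ∸ 1
      2≤a+b : 2 ≤ a ℕ.+ b
      2≤a+b = ℕₚ.+-mono-≤ 1≤a 1≤b
      1≤e : 1 ≤ e
      1≤e = ℕₚ.∸-monoˡ-≤ 1 2≤a+b
      weight : a ℕ.+ w ≡ suc (e ℕ.+ wt ks)
      weight = ≡.trans (≡.sym (ℕₚ.+-assoc a b (wt ks)))
        (≡.cong (ℕ._+ wt ks) (≡.sym (ℕₚ.m+[n∸m]≡n (ℕₚ.≤-trans (s≤s z≤n) 2≤a+b))))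

-- Generating functions in weight and depth

const-QIntegers : ∀ {c ℓ} (R : CommutativeRing c ℓ) N {L} → QIntegers R L →
                  QIntegers (TruncatedSeries.seriesRing R N) L
const-QIntegers R N Q = record
  { p = λ m → const (p m)
  ; u = λ m → const (u m)
  ; v = λ m → const (v m)
  ; h = const h
  ; p-0 = trans (const-cong p-0) const-1-homo
  ; p-+ = λ m n → trans (const-cong (p-+ m n)) (const-*-homo _ _)
  ; u-+ = λ m n → trans (const-cong (u-+ m n)) (trans (const-+-homo _ _) (+-congˡ (const-*-homo _ _)))
  ; p+hu = λ m → trans (trans (+-congˡ (sym (const-*-homo _ _))) (sym (const-+-homo _ _))) (trans (const-cong (p+hu m)) const-1-homo)
  ; uv = λ m → trans (sym (const-*-homo _ _)) (trans (const-cong (uv m)) const-1-homo)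
  ; p-L = trans (const-cong p-L) const-0-homo
  }
  where
  open TruncatedSeries R N
  open QIntegers Q
  open CommutativeRing seriesRing using (trans; sym; +-congˡ)

module _ {c ℓ} (R : CommutativeRing c ℓ) where
  open CommutativeRing R hiding (zero)

  -- Turns the subtraction-free equation of a geometric series into an inverse of w - d. The
  -- negative is a variable because it occurs below as a sum of several negatives.
  cancelling-inverse : ∀ {w d d̄ g} → w * g ≈ 1# + d * g → d + d̄ ≈ 0# → (w + d̄) * g ≈ 1#
  cancelling-inverse {w} {d} {d̄} {g} wg dd̄ = begin
    (w + d̄) * g                ≈⟨ distribʳ _ _ _ ⟩
    w * g + d̄ * g              ≈⟨ +-congʳ wg ⟩
    1# + d * g + d̄ * g         ≈⟨ trans (+-assoc _ _ _) (+-congˡ (sym (distribʳ _ _ _))) ⟩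
    1# + (d + d̄) * g           ≈⟨ +-congˡ (trans (*-congʳ dd̄) (zeroˡ g)) ⟩
    1# + 0#                    ≈⟨ +-identityʳ 1# ⟩
    1#                         ∎
    where open import Relation.Binary.Reasoning.Setoid setoid

module Substitution {c ℓ} (R : CommutativeRing c ℓ) (L : ℕ) (Q : QIntegers R L)
                    (x y τ τ′ : CommutativeRing.Carrier R) where
  open CommutativeRing R hiding (zero)
  open QIntegers Q
  open SemiringSolver commutativeSemiring using (solve; _:=_; _:+_; _:*_)
  open import Relation.Binary.Reasoning.Setoid setoid

  z s r : Carrier
  z = x * y
  s = z * τ
  r = z * τ′

  open Telescoping R L Q (- x) s (- s) r (- r) public using (D; b; W)

  -s+z≈r : τ + τ′ ≈ 1# → - s + z ≈ r
  -s+z≈r τ+τ′ = begin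
    - s + z                  ≈⟨ +-congˡ (trans (sym (*-identityʳ z)) (*-congˡ (sym τ+τ′))) ⟩
    - s + z * (τ + τ′)       ≈⟨ +-congˡ (distribˡ _ _ _) ⟩
    - s + (s + r)            ≈⟨ +-assoc _ _ _ ⟨
    - s + s + r              ≈⟨ +-congʳ (-‿inverseˡ s) ⟩
    0# + r                   ≈⟨ +-identityˡ r ⟩
    r                        ∎

  a-inverse : ∀ m {g} → u m * g ≈ 1# + x * (p m * g) → (u m + - x * p m) * g ≈ 1#
  a-inverse m eq = cancelling-inverse R {d = x * p m}
    (trans eq (+-congˡ (sym (*-assoc _ _ _))))
    (trans (sym (distribʳ _ _ _)) (trans (*-congʳ (-‿inverseʳ x)) (zeroˡ _)))

  D-inverse : ∀ m {g} → (u m + - x * p m) * g ≈ 1# + y * ((x * τ) * g) → D m * g ≈ 1#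
  D-inverse m {g} eq = cancelling-inverse R {d = s}
    (trans eq (+-congˡ (solve 4 (λ y x t g → y :* (x :* t :* g) := x :* y :* t :* g) refl y x τ g)))
    (-‿inverseʳ s)

  b-inverse : ∀ m {g} → u m * g ≈ 1# + y * ((x * (τ + τ′ * p m)) * g) → b m * g ≈ 1#
  b-inverse m {g} eq = trans (*-congʳ (+-assoc _ _ _)) (cancelling-inverse R {d = s + r * p m}
    (trans eq (+-congˡ (solve 6 (λ y x t t′ p g →
       y :* (x :* (t :+ t′ :* p) :* g) := (x :* y :* t :+ x :* y :* t′ :* p) :* g) refl y x τ τ′ (p m) g)))
    (begin
      s + r * p m + (- s + - r * p m)   ≈⟨ solve 5 (λ s r p s̄ r̄ →
                                              s :+ r :* p :+ (s̄ :+ r̄ :* p) := s :+ s̄ :+ (r :+ r̄) :* p) refl s r (p m) (- s) (- r) ⟩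
      s + - s + (r + - r) * p m         ≈⟨ +-cong (-‿inverseʳ s) (trans (*-congʳ (-‿inverseʳ r)) (zeroˡ _)) ⟩
      0# + 0#                           ≈⟨ +-identityˡ 0# ⟩
      0#                                ∎))

  star-equation : ∀ m {g S T} → (u m + - x * p m) * g ≈ 1# → T ≈ y * (x * (g * S)) →
                  (u m + - x * p m) * T ≈ z * S
  star-equation m {g} {S} {T} ag T≈ = begin
    a * T                      ≈⟨ *-congˡ T≈ ⟩
    a * (y * (x * (g * S)))    ≈⟨ solve 5 (λ a y x g S → a :* (y :* (x :* (g :* S))) := a :* g :* (x :* y :* S)) refl a y x g S ⟩
    a * g * (z * S)            ≈⟨ trans (*-congʳ ag) (*-identityˡ _) ⟩
    z * S                      ∎
    where a = u m + - x * p m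

  -- With the negative terms moved across, the last two hypotheses say D G = E and b E = W q^m.
  -- Hence G = W q^m/(D b), by two successive divisions.
  solution : ∀ m {D⁻¹ b⁻¹ G E c} → D m * D⁻¹ ≈ 1# → b m * b⁻¹ ≈ 1# →
    c ≈ h * τ * p m →
    u m * G ≈ x * (p m * G) + y * (x * (τ * G)) + E →
    u m * E + y * (x * c) ≈ y * (x * ((τ + τ′ * p m) * E)) + p m →
    W * (p m * D⁻¹ * b⁻¹) ≈ G
  solution m {D⁻¹} {b⁻¹} {G} {E} {c} DD⁻¹ bb⁻¹ c≈ G-eq E-eq = begin
    W * (p m * D⁻¹ * b⁻¹)   ≈⟨ solve 4 (λ W p D⁻¹ b⁻¹ → W :* (p :* D⁻¹ :* b⁻¹) := W :* p :* b⁻¹ :* D⁻¹) refl W (p m) D⁻¹ b⁻¹ ⟩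
    W * p m * b⁻¹ * D⁻¹     ≈⟨ *-congʳ (divide bb⁻¹ bE) ⟨
    E * D⁻¹                 ≈⟨ divide DD⁻¹ DG ⟨
    G                       ∎
    where
    divide : ∀ {w w⁻¹ f g} → w * w⁻¹ ≈ 1# → w * f ≈ g → f ≈ g * w⁻¹
    divide {w} {w⁻¹} {f} {g} ww⁻¹ wf = begin
      f              ≈⟨ *-identityˡ f ⟨
      1# * f         ≈⟨ *-congʳ ww⁻¹ ⟨
      w * w⁻¹ * f    ≈⟨ solve 3 (λ w w⁻¹ f → w :* w⁻¹ :* f := w :* f :* w⁻¹) refl w w⁻¹ f ⟩
      w * f * w⁻¹    ≈⟨ *-congʳ wf ⟩
      g * w⁻¹        ∎
    DG : D m * G ≈ E
    DG = begin
      (u m + - x * p m + - s) * G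
        ≈⟨ solve 5 (λ u x̄ p s̄ G → (u :+ x̄ :* p :+ s̄) :* G := u :* G :+ (x̄ :* (p :* G) :+ s̄ :* G)) refl (u m) (- x) (p m) (- s) G ⟩
      u m * G + (- x * (p m * G) + - s * G)
        ≈⟨ +-congʳ G-eq ⟩
      x * (p m * G) + y * (x * (τ * G)) + E + (- x * (p m * G) + - s * G)
        ≈⟨ solve 8 (λ x pG y τ G E x̄ s̄ → x :* pG :+ y :* (x :* (τ :* G)) :+ E :+ (x̄ :* pG :+ s̄ :* G)
             := (x :+ x̄) :* pG :+ (x :* y :* τ :+ s̄) :* G :+ E) refl x (p m * G) y τ G E (- x) (- s) ⟩
      (x + - x) * (p m * G) + (s + - s) * G + E
        ≈⟨ +-congʳ (trans (+-cong (trans (*-congʳ (-‿inverseʳ x)) (zeroˡ _)) (trans (*-congʳ (-‿inverseʳ s)) (zeroˡ _))) (+-identityˡ 0#)) ⟩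
      0# + E
        ≈⟨ +-identityˡ E ⟩
      E ∎
    bE : b m * E ≈ W * p m
    bE = begin
      (u m + - s + - r * p m) * E
        -- The added zero h(s - s)q^m provides two terms: hs q^m, which the equation for E consumes,
        -- and -hs q^m, which completes `W * p m`.
        ≈⟨ trans (sym (+-identityʳ _)) (+-congˡ (sym (trans (*-congʳ (trans (*-congˡ (-‿inverseʳ s)) (zeroʳ h))) (zeroˡ _)))) ⟩
      (u m + - s + - r * p m) * E + h * (s + - s) * p m
        ≈⟨ solve 9 (λ u s̄ r̄ p E h x y τ → (u :+ s̄ :+ r̄ :* p) :* E :+ h :* (x :* y :* τ :+ s̄) :* p
             := u :* E :+ y :* (x :* (h :* τ :* p)) :+ (s̄ :* E :+ r̄ :* p :* E :+ h :* s̄ :* p)) refl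
             (u m) (- s) (- r) (p m) E h x y τ ⟩
      u m * E + y * (x * (h * τ * p m)) + (- s * E + - r * p m * E + h * - s * p m)
        ≈⟨ +-congʳ (trans (+-congˡ (*-congˡ (*-congˡ (sym c≈)))) E-eq) ⟩
      y * (x * ((τ + τ′ * p m) * E)) + p m + (- s * E + - r * p m * E + h * - s * p m)
        ≈⟨ solve 9 (λ x y τ τ′ p E s̄ r̄ h →
             y :* (x :* ((τ :+ τ′ :* p) :* E)) :+ p :+ (s̄ :* E :+ r̄ :* p :* E :+ h :* s̄ :* p)
             := (x :* y :* τ :+ s̄) :* E :+ (x :* y :* τ′ :+ r̄) :* (p :* E) :+ (p :+ h :* s̄ :* p)) refl
             x y τ τ′ (p m) E (- s) (- r) h ⟩
      (s + - s) * E + (r + - r) * (p m * E) + (p m + h * - s * p m)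
        ≈⟨ +-cong (trans (+-cong (trans (*-congʳ (-‿inverseʳ s)) (zeroˡ _)) (trans (*-congʳ (-‿inverseʳ r)) (zeroˡ _))) (+-identityˡ 0#))
                  (trans (+-congʳ (sym (*-identityˡ _))) (sym (distribʳ _ _ _))) ⟩
      0# + W * p m
        ≈⟨ +-identityˡ _ ⟩
      W * p m ∎

module NestedSeries {c ℓ} (A : CommutativeRing c ℓ) (M N : ℕ) where
  module X = TruncatedSeries A M
  module Y = TruncatedSeries X.seriesRing N
  private module A = CommutativeRing A
  open CommutativeRing Y.seriesRing hiding (zero)
  open FiniteSums Y.seriesRing

  coeff₂ : Carrier → ℕ → ℕ → A.Carrier
  coeff₂ f n w = X.coeff (Y.coeff f n) w

  series₂ : (ℕ → ℕ → A.Carrier) → Carrier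
  series₂ F = Y.series (λ n → X.series (F n))

  coeff₂-series₂ : ∀ F n w → coeff₂ (series₂ F) n w ≡ F n w
  coeff₂-series₂ F n w = ≡.trans (≡.cong (λ f → X.coeff f w) (Y.coeff-series _ n)) (X.coeff-series (F n) w)

  ≈-from-coeff₂ : ∀ {f g} → (∀ n w → n < N → w < M → coeff₂ f n w A.≈ coeff₂ g n w) → f ≈ g
  ≈-from-coeff₂ f≈g = Y.≈-from-coeff (λ n n<N → X.≈-from-coeff (λ w → f≈g n w n<N))

  coeff₂-+ : ∀ f g n w → coeff₂ (f + g) n w ≡ coeff₂ f n w A.+ coeff₂ g n w
  coeff₂-+ f g n w = ≡.trans (≡.cong (λ f → X.coeff f w) (Y.coeff-+ f g n)) (X.coeff-+ _ _ w)

  coeff₂-∑ : ∀ m F n w → w < M → coeff₂ (∑ m F) n w A.≈ FiniteSums.∑ A m (λ i → coeff₂ (F i) n w)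
  coeff₂-∑ m F n w w<M = A.trans (X.coeff-cong w<M (Y.coeff-∑ m F n)) (X.coeff-∑ m (λ i → Y.coeff (F i) n) w)

  coeff₂-cong : ∀ {f g n w} → n < N → w < M → f ≈ g → coeff₂ f n w A.≈ coeff₂ g n w
  coeff₂-cong n<N w<M f≈g = X.coeff-cong w<M (Y.coeff-cong n<N f≈g)

  coeff₂-1 : coeff₂ 1# 0 0 ≡ A.1#
  coeff₂-1 = ≡.trans (≡.cong (λ f → X.coeff f 0) (Y.coeff-1 0)) (X.coeff-1 0)

  coeff₂-1-x : ∀ w → coeff₂ 1# 0 (suc w) ≡ A.0#
  coeff₂-1-x w = ≡.trans (≡.cong (λ f → X.coeff f (suc w)) (Y.coeff-1 0)) (X.coeff-1 (suc w))

  coeff₂-1-y : ∀ n w → coeff₂ 1# (suc n) w ≡ A.0#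
  coeff₂-1-y n w = ≡.trans (≡.cong (λ f → X.coeff f w) (Y.coeff-1 (suc n))) (X.coeff-0 w)

  coeff₂-y-zero : ∀ f {w} → w < M → coeff₂ (Y.X * f) 0 w A.≈ A.0#
  coeff₂-y-zero f w<M = A.trans (X.coeff-cong w<M (Y.coeff-X-* f 0)) (A.reflexive (X.coeff-0 _))

  coeff₂-y-suc : ∀ f n {w} → w < M → coeff₂ (Y.X * f) (suc n) w A.≈ coeff₂ f n w
  coeff₂-y-suc f n w<M = X.coeff-cong w<M (Y.coeff-X-* f (suc n))

  coeff₂-neg : ∀ f n w → coeff₂ (- f) n w ≡ A.- coeff₂ f n w
  coeff₂-neg f n w = ≡.trans (≡.cong (λ f → X.coeff f w) (Y.coeff-neg f n)) (X.coeff-neg _ w)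

  coeff₂-0 : ∀ n w → coeff₂ 0# n w ≡ A.0#
  coeff₂-0 n w = ≡.trans (≡.cong (λ f → X.coeff f w) (Y.coeff-0 n)) (X.coeff-0 w)

  coeff₂-* : ∀ f g n w → coeff₂ (f * g) n w A.≈
    FiniteSums.∑ A (suc n) (λ a → FiniteSums.∑ A (suc w) (λ b → coeff₂ f a b A.* coeff₂ g (n ∸ a) (w ∸ b)))
  coeff₂-* f g n w = A.trans (A.reflexive (≡.cong (λ f → X.coeff f w) (Y.coeff-* f g n)))
    (A.trans (X.coeff-∑ (suc n) _ w) (FiniteSums.∑-cong A (suc n) (λ a → A.reflexive (X.coeff-* _ _ w))))

-- Coefficients of y^n x^w, with n the depth and w the weight.
module Bivariate {c ℓ} (A : CommutativeRing c ℓ) (L : ℕ) (Q : QIntegers A L)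
                 (t t′ : CommutativeRing.Carrier A)
                 (t+t′ : CommutativeRing._≈_ A (CommutativeRing._+_ A t t′) (CommutativeRing.1# A))
                 (M N : ℕ) where

  open NestedSeries A M N public
  private
    module A = CommutativeRing A
    module Aq = QIntegers Q
    module S = CommutativeRing X.seriesRing
    module Sq = QIntegers (const-QIntegers A M Q)

  QR : QIntegers Y.seriesRing L
  QR = const-QIntegers X.seriesRing N (const-QIntegers A M Q)

  open CommutativeRing Y.seriesRing hiding (zero)
  open QIntegers QR
  open FiniteSums Y.seriesRing
  open Interpolation A L Q t using (zt; star; rest)

  ι : A.Carrier → Carrier
  ι a = Y.const (X.const a)

  x : Carrier
  x = Y.const X.X

  open Substitution Y.seriesRing L QR x Y.X (ι t) (ι t′) public

  ιt+ιt′ : ι t + ι t′ ≈ 1#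
  ιt+ιt′ = trans (sym (Y.const-+-homo (X.const t) (X.const t′)))
    (trans (Y.const-cong (S.trans (S.sym (X.const-+-homo t t′)) (S.trans (X.const-cong t+t′) X.const-1-homo))) Y.const-1-homo)

  -- This is 1/([m+1] - x q^(m+1)). By definition its coefficient of x^a is `zt (suc a) m`, so
  -- summing over one entry of an index gives a rational function.
  a⁻¹ : ℕ → S.Carrier
  a⁻¹ m = X.geometric (Aq.p (suc m)) (Aq.v m)

  aa⁻¹ : ∀ m → (Sq.u (suc m) S.+ (S.- X.X) S.* Sq.p (suc m)) S.* a⁻¹ m S.≈ S.1#
  aa⁻¹ m = Substitution.a-inverse X.seriesRing L (const-QIntegers A M Q) X.X S.0# S.0# S.0# (suc m)
    (X.geometric-equation (Aq.p (suc m)) (Aq.uv m))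

  ιa : ∀ m → u (suc m) + - x * p (suc m) ≈ Y.const (Sq.u (suc m) S.+ (S.- X.X) S.* Sq.p (suc m))
  ιa m = trans (+-congˡ (trans (*-congʳ (sym (Y.const-neg-homo X.X))) (sym (Y.const-*-homo (S.- X.X) (Sq.p (suc m))))))
    (sym (Y.const-+-homo (Sq.u (suc m)) ((S.- X.X) S.* Sq.p (suc m))))

  ιaa⁻¹ : ∀ m → (u (suc m) + - x * p (suc m)) * Y.const (a⁻¹ m) ≈ 1#
  ιaa⁻¹ m = trans (*-congʳ (ιa m))
    (trans (sym (Y.const-*-homo (Sq.u (suc m) S.+ (S.- X.X) S.* Sq.p (suc m)) (a⁻¹ m))) (trans (Y.const-cong (aa⁻¹ m)) Y.const-1-homo))

  -- Both are geometric series in y. For D the unit is [m+1] - x q^(m+1), already inverted in the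
  -- ring of series in x; b has no pure x term, so its unit is [m+1].
  D⁻¹ b⁻¹ : ℕ → Carrier
  D⁻¹ m = Y.geometric (X.X S.* X.const t) (a⁻¹ m)
  b⁻¹ m = Y.geometric (X.X S.* (X.const t S.+ X.const t′ S.* Sq.p (suc m))) (Sq.v m)

  DD⁻¹ : ∀ m → D (suc m) * D⁻¹ m ≈ 1#
  DD⁻¹ m = D-inverse (suc m) {D⁻¹ m} (trans (*-congʳ (ιa m))
    (trans (Y.geometric-equation (X.X S.* X.const t) (aa⁻¹ m))
           (+-congˡ (*-congˡ (*-congʳ (Y.const-*-homo X.X (X.const t)))))))

  bb⁻¹ : ∀ m → b (suc m) * b⁻¹ m ≈ 1#
  bb⁻¹ m = b-inverse (suc m) {b⁻¹ m} (trans (Y.geometric-equation _ (Sq.uv m))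
    (+-congˡ (*-congˡ (*-congʳ (trans (Y.const-*-homo X.X _)
      (*-congˡ (trans (Y.const-+-homo (X.const t) _) (+-congˡ (Y.const-*-homo (X.const t′) (Sq.p (suc m)))))))))))

  coeff₂-const : ∀ g f n {w} → w < M → coeff₂ (Y.const g * f) n w A.≈ X.coeff (g S.* Y.coeff f n) w
  coeff₂-const g f n w<M = X.coeff-cong w<M (Y.coeff-const-* g f n)

  coeff₂-ι : ∀ a f n {w} → w < M → coeff₂ (ι a * f) n w A.≈ a A.* coeff₂ f n w
  coeff₂-ι a f n w<M = A.trans (coeff₂-const (X.const a) f n w<M) (X.coeff-const-* a _ _)

  coeff₂-x : ∀ f n {w} → w < M → coeff₂ (x * f) n w A.≈ X.shift (coeff₂ f n) w
  coeff₂-x f n w<M = A.trans (coeff₂-const X.X f n w<M) (X.coeff-X-* (Y.coeff f n) _)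

  starSum restSum admissibleSum : ℕ → ℕ → ℕ → A.Carrier
  starSum       m n w = ListSums.∑ₗ A (indices w n) (λ ks → star ks m)
  restSum       m n w = ListSums.∑ₗ A (indices w n) (λ ks → rest ks m)
  admissibleSum m n w = ListSums.∑ₗ A (admissibleIndices w n) (λ ks → star ks m)

  starSum-zero : ∀ m w → starSum m 0 w A.≈ A.0#
  starSum-zero m zero    = A.+-identityˡ A.0#
  starSum-zero m (suc w) = A.refl

  starSum-suc : ∀ m n w → starSum m (suc n) w A.≈ X.shift ((λ a → zt (suc a) m) X.⋆ restSum m n) w
  starSum-suc m n zero    = A.refl
  starSum-suc m n (suc w) = A.trans (ListSums.∑ₗ-indices A (suc w) n _)
    (FiniteSums.∑-cong A (suc w) (λ a → A.sym (ListSums.*-∑ₗ A (indices (w ∸ a) n) (zt (suc a) m) _)))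

  restSum-recursion : ∀ m n w → restSum m n w A.≈
    coeff₂ 1# n w A.+ (FiniteSums.∑ A m (λ i → starSum i n w) A.+ t A.* starSum m n w)
  restSum-recursion m zero w = A.sym (A.trans
    (A.+-congˡ (A.trans (A.+-cong (FiniteSums.∑-0 A m (λ i _ → starSum-zero i w))
      (A.trans (A.*-congˡ (starSum-zero m w)) (A.zeroʳ t))) (A.+-identityˡ A.0#)))
    (A.trans (A.+-identityʳ _) (unit w)))
    where
    unit : ∀ w → coeff₂ 1# 0 w A.≈ restSum m 0 w
    unit zero    = A.trans (A.reflexive coeff₂-1) (A.sym (A.+-identityʳ A.1#))
    unit (suc w) = A.reflexive (coeff₂-1-x w)
  restSum-recursion m (suc n) w = begin
    ∑ₗ (indices w (suc n)) (λ ks → rest ks m)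
      ≈⟨ ∑ₗ-indices w n _ ⟩
    ∑A w (λ a → ∑ₗ (indices (w ∸ suc a) n) (λ ks → rest (suc a ∷ ks) m))
      ≈⟨ ∑ₗ-indices w n _ ⟨
    ∑ₗ (indices w (suc n)) (λ ks → ∑A m (star ks) A.+ t A.* star ks m)
      ≈⟨ ∑ₗ-+ (indices w (suc n)) _ _ ⟩
    ∑ₗ (indices w (suc n)) (λ ks → ∑A m (star ks)) A.+ ∑ₗ (indices w (suc n)) (λ ks → t A.* star ks m)
      ≈⟨ A.+-cong (∑ₗ-∑ (indices w (suc n)) m star) (A.sym (*-∑ₗ (indices w (suc n)) t _)) ⟩
    ∑A m (λ i → starSum i (suc n) w) A.+ t A.* starSum m (suc n) w
      ≈⟨ A.trans (A.+-congʳ (A.reflexive (coeff₂-1-y n w))) (A.+-identityˡ _) ⟨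
    coeff₂ 1# (suc n) w A.+ (∑A m (λ i → starSum i (suc n) w) A.+ t A.* starSum m (suc n) w) ∎
    where
    open import Relation.Binary.Reasoning.Setoid A.setoid
    open ListSums A
    open FiniteSums A using () renaming (∑ to ∑A)

  -- Admissible indices are exactly the nonempty indices with the first entry raised by one, and
  -- raising it multiplies the summand by q^(m+1)/[m+1].
  admissibleSum-shift : ∀ m n w → admissibleSum m n w A.≈
    X.shift (λ w → (Aq.p (suc m) A.* Aq.v m) A.* starSum m n w) w
  admissibleSum-shift m zero    zero    = A.refl
  admissibleSum-shift m (suc n) zero    = A.refl
  admissibleSum-shift m zero    (suc w) = A.sym (A.trans (A.*-congˡ (starSum-zero m w)) (A.zeroʳ _))
  admissibleSum-shift m (suc n) (suc w) = begin
    ∑ₗ (admissibleIndices (suc w) (suc n)) (λ ks → star ks m)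
      ≈⟨ ∑ₗ-admissibleIndices w n _ ⟩
    ∑A w (λ a → ∑ₗ (indices (w ∸ suc a) n) (λ ks → zt (suc (suc a)) m A.* rest ks m))
      ≈⟨ ∑A-cong w (λ a → ∑ₗ-cong (indices (w ∸ suc a) n) (λ ks →
           solve 5 (λ P Pa V Va r → P :* Pa :* (V :* Va) :* r := P :* V :* (Pa :* Va :* r)) A.refl
             (Aq.p (suc m)) _ (Aq.v m) _ (rest ks m))) ⟩
    ∑A w (λ a → ∑ₗ (indices (w ∸ suc a) n) (λ ks → pv A.* star (suc a ∷ ks) m))
      ≈⟨ ∑ₗ-indices w n _ ⟨
    ∑ₗ (indices w (suc n)) (λ ks → pv A.* star ks m)
      ≈⟨ *-∑ₗ (indices w (suc n)) pv _ ⟨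
    pv A.* starSum m (suc n) w ∎
    where
    open import Relation.Binary.Reasoning.Setoid A.setoid
    open ListSums A
    open FiniteSums A using () renaming (∑ to ∑A; ∑-cong to ∑A-cong)
    open SemiringSolver A.commutativeSemiring using (solve; _:=_; _:*_)
    pv = Aq.p (suc m) A.* Aq.v m

  starSeries restSeries admissibleSeries : ℕ → Carrier
  starSeries       m = series₂ (starSum m)
  restSeries       m = series₂ (restSum m)
  admissibleSeries m = series₂ (admissibleSum m)

  -- Choosing the first entry is a convolution in the weight, hence a product of series. The factor
  -- x appears because entries start at 1, the factor y because the depth grows by one.
  starSeries≈ : ∀ m → starSeries m ≈ Y.X * (x * (Y.const (a⁻¹ m) * restSeries m))
  starSeries≈ m = ≈-from-coeff₂ λ n w _ w<M →
    A.trans (A.reflexive (coeff₂-series₂ (starSum m) n w)) (A.sym (rhs n w w<M))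
    where
    f = Y.const (a⁻¹ m) * restSeries m
    coeff-f : ∀ n {w} → w < M → coeff₂ f n w A.≈ ((λ a → zt (suc a) m) X.⋆ restSum m n) w
    coeff-f n {w} w<M = A.trans (coeff₂-const (a⁻¹ m) (restSeries m) n w<M)
      (A.trans (A.reflexive (X.coeff-* _ _ w)) (X.⋆-cong≤ w
        (λ a _ → A.reflexive (X.coeff-series _ a)) (λ i _ → A.reflexive (coeff₂-series₂ (restSum m) n i))))
    coeff-xf : ∀ n w → w < M → coeff₂ (x * f) n w A.≈ starSum m (suc n) w
    coeff-xf n zero    w<M = A.trans (coeff₂-x f n w<M) (A.sym (starSum-suc m n 0))
    coeff-xf n (suc w) w<M = A.trans (coeff₂-x f n w<M)
      (A.trans (coeff-f n (ℕₚ.<-trans ℕₚ.≤-refl w<M)) (A.sym (starSum-suc m n (suc w))))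
    rhs : ∀ n w → w < M → coeff₂ (Y.X * (x * f)) n w A.≈ starSum m n w
    rhs zero    w w<M = A.trans (coeff₂-y-zero (x * f) w<M) (A.sym (starSum-zero m w))
    rhs (suc n) w w<M = A.trans (coeff₂-y-suc (x * f) n w<M) (coeff-xf n w w<M)

  restSeries≈ : ∀ m → restSeries m ≈ 1# + (∑ m starSeries + ι t * starSeries m)
  restSeries≈ m = ≈-from-coeff₂ λ n w _ w<M →
    A.trans (A.reflexive (coeff₂-series₂ (restSum m) n w)) (A.trans (restSum-recursion m n w) (A.sym (rhs n w w<M)))
    where
    rhs : ∀ n w → w < M → coeff₂ (1# + (∑ m starSeries + ι t * starSeries m)) n w A.≈
      coeff₂ 1# n w A.+ (FiniteSums.∑ A m (λ i → starSum i n w) A.+ t A.* starSum m n w)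
    rhs n w w<M = A.trans (A.reflexive (coeff₂-+ 1# _ n w)) (A.+-congˡ
      (A.trans (A.reflexive (coeff₂-+ _ _ n w)) (A.+-cong
        (A.trans (coeff₂-∑ m starSeries n w w<M)
                 (FiniteSums.∑-cong A m (λ i → A.reflexive (coeff₂-series₂ (starSum i) n w))))
        (A.trans (coeff₂-ι t (starSeries m) n w<M) (A.*-congˡ (A.reflexive (coeff₂-series₂ (starSum m) n w)))))))

  ι-* : ∀ a a′ → ι (a A.* a′) ≈ ι a * ι a′
  ι-* a a′ = trans (Y.const-cong (X.const-*-homo a a′)) (Y.const-*-homo (X.const a) (X.const a′))

  admissibleSeries≈ : ∀ m → admissibleSeries m ≈ x * (p (suc m) * v m * starSeries m)
  admissibleSeries≈ m = trans
    (≈-from-coeff₂ λ n w _ w<M → A.trans (A.reflexive (coeff₂-series₂ (admissibleSum m) n w))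
      (A.trans (admissibleSum-shift m n w) (A.sym (rhs n w w<M))))
    (*-congˡ (*-congʳ (ι-* (Aq.p (suc m)) (Aq.v m))))
    where
    pv = Aq.p (suc m) A.* Aq.v m
    rhs : ∀ n w → w < M → coeff₂ (x * (ι pv * starSeries m)) n w A.≈ X.shift (λ w → pv A.* starSum m n w) w
    rhs n zero    w<M = coeff₂-x (ι pv * starSeries m) n w<M
    rhs n (suc w) w<M = A.trans (coeff₂-x (ι pv * starSeries m) n w<M)
      (A.trans (coeff₂-ι pv (starSeries m) n (ℕₚ.<-trans ℕₚ.≤-refl w<M)) (A.*-congˡ (A.reflexive (coeff₂-series₂ (starSum m) n w))))

  ∑-admissibleSeries : ∑ L admissibleSeries ≈ x * (z * ∑ L (λ m → W * (p (suc m) * D⁻¹ m * b⁻¹ m)))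
  ∑-admissibleSeries = trans (∑-cong L admissibleSeries≈) (trans (sym (*-∑ L x _)) (*-congˡ
    (Telescoping.∑-chains Y.seriesRing L QR (- x) s (- s) r (- r) (-‿inverseʳ s) (-‿inverseʳ r)
      D⁻¹ DD⁻¹ b⁻¹ bb⁻¹ refl (-s+z≈r ιt+ιt′)
      (λ m → star-equation (suc m) (ιaa⁻¹ m) (starSeries≈ m)) restSeries≈)))

-- Binomial sums and the coefficients of the right-hand side

-- n C (b − a), read as 0 when b < a.
shiftedC : ℕ → ℕ → ℕ → ℕ
shiftedC n b       zero    = n C b
shiftedC n zero    (suc a) = 0
shiftedC n (suc b) (suc a) = shiftedC n b a

shiftedC-≤ : ∀ n {b a} → a ≤ b → shiftedC n b a ≡ n C (b ∸ a)
shiftedC-≤ n z≤n       = ≡.refl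
shiftedC-≤ n (s≤s a≤b) = shiftedC-≤ n a≤b

shiftedC-> : ∀ n {b a} → b < a → shiftedC n b a ≡ 0
shiftedC-> n {zero}  (s≤s b≤a) = ≡.refl
shiftedC-> n {suc b} (s≤s b<a) = shiftedC-> n b<a

shiftedC-suc-zero : ∀ n a → shiftedC (suc n) 0 a ≡ shiftedC n 0 a
shiftedC-suc-zero n zero    = ≡.refl
shiftedC-suc-zero n (suc a) = ≡.refl

-- The convention for b < a makes Pascal's rule uniform in `a`; with `n C (b ∸ a)` the value there
-- would be 1 and the rule would fail.
shiftedC-pascal : ∀ n b a → shiftedC (suc n) (suc b) a ≡ shiftedC n (suc b) a ℕ.+ shiftedC n b a
shiftedC-pascal n b zero = ≡.trans (≡.sym (nCk+nC[k+1]≡[n+1]C[k+1] n b)) (ℕₚ.+-comm (n C b) (n C suc b))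
shiftedC-pascal n zero    (suc a) = ≡.trans (shiftedC-suc-zero n a) (≡.sym (ℕₚ.+-identityʳ _))
shiftedC-pascal n (suc b) (suc a) = shiftedC-pascal n b a

module BinomialSums {c ℓ} (R : CommutativeRing c ℓ) where
  open CommutativeRing R hiding (zero)
  open FiniteSums R
  open import Algebra.Properties.Monoid.Mult +-monoid using (×-congˡ; ×-homo-+) renaming (_×_ to _·_)
  open import Algebra.Properties.CommutativeSemigroup +-commutativeSemigroup using (interchange)
  open import Relation.Binary.Reasoning.Setoid setoid

  -- (E₁ + E₂)ⁿ α at (0 , 0), where E₁ and E₂ shift the two indices.
  binomialSum : ℕ → (ℕ → ℕ → Carrier) → Carrier
  binomialSum zero    α = α 0 0
  binomialSum (suc n) α = binomialSum n (λ a d → α a (suc d)) + binomialSum n (λ a d → α (suc a) d)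

  binomialSum-cong : ∀ n {α β} → (∀ a d → α a d ≈ β a d) → binomialSum n α ≈ binomialSum n β
  binomialSum-cong zero    α≈β = α≈β 0 0
  binomialSum-cong (suc n) α≈β =
    +-cong (binomialSum-cong n (λ a d → α≈β a (suc d))) (binomialSum-cong n (λ a d → α≈β (suc a) d))

  binomialSum-+ : ∀ n α β → binomialSum n (λ a d → α a d + β a d) ≈ binomialSum n α + binomialSum n β
  binomialSum-+ zero    α β = refl
  binomialSum-+ (suc n) α β =
    trans (+-cong (binomialSum-+ n _ _) (binomialSum-+ n _ _)) (interchange _ _ _ _)

  *-binomialSum : ∀ n x α → x * binomialSum n α ≈ binomialSum n (λ a d → x * α a d)
  *-binomialSum zero    x α = refl
  *-binomialSum (suc n) x α = trans (distribˡ x _ _) (+-cong (*-binomialSum n x _) (*-binomialSum n x _))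

  binomialSum-0 : ∀ n → binomialSum n (λ _ _ → 0#) ≈ 0#
  binomialSum-0 zero    = refl
  binomialSum-0 (suc n) = trans (+-cong (binomialSum-0 n) (binomialSum-0 n)) (+-identityˡ 0#)

  binomialSum-expand : ∀ n α → binomialSum n α ≈ ∑ (suc n) (λ a → (n C a) · α a (n ∸ a))
  binomialSum-expand zero    α = trans (sym (+-identityʳ _)) (sym (+-identityˡ _))
  binomialSum-expand (suc n) α = begin
    binomialSum n (λ a d → α a (suc d)) + binomialSum n (λ a d → α (suc a) d)
      ≈⟨ +-cong (trans (binomialSum-expand n _) (∑-head n _)) (binomialSum-expand n _) ⟩
    1 · α 0 (suc n) + ∑ n (λ a → (n C suc a) · α (suc a) (suc (n ∸ suc a))) + ∑ (suc n) (λ a → (n C a) · β a)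
      ≈⟨ +-assoc _ _ _ ⟩
    1 · α 0 (suc n) + (∑ n (λ a → (n C suc a) · α (suc a) (suc (n ∸ suc a))) + ∑ (suc n) (λ a → (n C a) · β a))
      ≈⟨ +-congˡ (+-congʳ (trans (sym (+-identityʳ _)) (+-cong
           (∑-cong< n (λ a a<n → reflexive (≡.cong (λ d → (n C suc a) · α (suc a) d) (≡.sym (ℕₚ.+-∸-assoc 1 a<n)))))
           (sym (×-congˡ (k>n⇒nCk≡0 (ℕₚ.n<1+n n))))))) ⟩
    1 · α 0 (suc n) + (∑ (suc n) (λ a → (n C suc a) · β a) + ∑ (suc n) (λ a → (n C a) · β a))
      ≈⟨ +-congˡ (trans (+-comm _ _) (sym (∑-+ (suc n) _ _))) ⟩
    1 · α 0 (suc n) + ∑ (suc n) (λ a → (n C a) · β a + (n C suc a) · β a)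
      ≈⟨ +-congˡ (∑-cong (suc n) (λ a → trans (sym (×-homo-+ (β a) (n C a) (n C suc a)))
           (×-congˡ (nCk+nC[k+1]≡[n+1]C[k+1] n a)))) ⟩
    1 · α 0 (suc n) + ∑ (suc n) (λ a → (suc n C suc a) · β a)
      ≈⟨ ∑-head (suc n) _ ⟨
    ∑ (suc (suc n)) (λ a → (suc n C a) · α a (suc n ∸ a)) ∎
    where
    β : ℕ → Carrier
    β a = α (suc a) (n ∸ a)

module Coefficients {c ℓ} (R : CommutativeRing c ℓ) (p u v h t t′ : CommutativeRing.Carrier R)
  (p+hu : CommutativeRing._≈_ R (CommutativeRing._+_ R p (CommutativeRing._*_ R h u)) (CommutativeRing.1# R))
  (uv : CommutativeRing._≈_ R (CommutativeRing._*_ R u v) (CommutativeRing.1# R))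
  (t+t′ : CommutativeRing._≈_ R (CommutativeRing._+_ R t t′) (CommutativeRing.1# R)) where

  open CommutativeRing R hiding (zero)
  open FiniteSums R
  open BinomialSums R
  open import Algebra.Properties.Semiring.Exp semiring using (_^_; ^-congʳ)
  open import Algebra.Properties.Semiring.Mult semiring
    using (×-congˡ; ×-congʳ; ×-homo-+; ×-assocˡ; ×-comm-*) renaming (_×_ to _·_)
  open import Relation.Binary.Reasoning.Setoid setoid
  open SemiringSolver commutativeSemiring using (solve; _:=_; _:+_; _:*_)

  -- The summand of ζ_q(d + 2).
  θ : ℕ → Carrier
  θ d = p ^ suc d * v ^ suc (suc d)

  θ-suc : ∀ d → θ (suc d) ≈ p * v * θ d
  θ-suc d = solve 4 (λ p v P V → p :* P :* (v :* V) := p :* v :* (P :* V)) refl p v (p ^ suc d) (v ^ suc (suc d))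

  -- The coefficient of z^b in (hz)^a (1 + z)^(d+1) `θ d`.
  α : ℕ → ℕ → ℕ → Carrier
  α b a d = shiftedC (suc d) b a · (h ^ a * θ d)

  -- ∑ κ i b zᵇ = v^(i+2) p (1 + z) (p + z)^i, by the binomial theorem for
  -- p + z = p (1 + z) + hu z.
  κ : ℕ → ℕ → Carrier
  κ i b = binomialSum i (α b)

  pv+h≈v : p * v + h ≈ v
  pv+h≈v = begin
    p * v + h                 ≈⟨ +-congˡ (trans (sym (*-identityʳ h)) (*-congˡ (sym uv))) ⟩
    p * v + h * (u * v)       ≈⟨ solve 4 (λ p v h u → p :* v :+ h :* (u :* v) := (p :+ h :* u) :* v) refl p v h u ⟩
    (p + h * u) * v           ≈⟨ trans (*-congʳ p+hu) (*-identityˡ v) ⟩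
    v                         ∎

  α-θ : ∀ a d k → k · (h ^ a * θ (suc d)) ≈ p * v * (k · (h ^ a * θ d))
  α-θ a d k = trans (×-congʳ k (trans (*-congˡ (θ-suc d))
    (solve 3 (λ x pv y → x :* (pv :* y) := pv :* (x :* y)) refl (h ^ a) (p * v) (θ d))))
    (sym (×-comm-* k (p * v) _))

  α-sucᵈ : ∀ b a d → α (suc b) a (suc d) ≈ p * v * α (suc b) a d + p * v * α b a d
  α-sucᵈ b a d = begin
    shiftedC (suc (suc d)) (suc b) a · (h ^ a * θ (suc d))
      ≈⟨ α-θ a d (shiftedC (suc (suc d)) (suc b) a) ⟩
    p * v * (shiftedC (suc (suc d)) (suc b) a · (h ^ a * θ d))
      ≈⟨ *-congˡ (trans (×-congˡ (shiftedC-pascal (suc d) b a)) (×-homo-+ _ (shiftedC (suc d) (suc b) a) (shiftedC (suc d) b a))) ⟩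
    p * v * (α (suc b) a d + α b a d)
      ≈⟨ distribˡ _ _ _ ⟩
    p * v * α (suc b) a d + p * v * α b a d ∎

  α-sucᵃ : ∀ b a d → α (suc b) (suc a) d ≈ h * α b a d
  α-sucᵃ b a d = trans (×-congʳ k (*-assoc _ _ _)) (sym (×-comm-* k h _))
    where k = shiftedC (suc d) b a

  -- The generating polynomial is multiplied by v(p + z): the shift in `d` contributes pv(1 + z),
  -- the shift in `a` contributes hz, and pv + h = v.
  κ-suc : ∀ i b → κ (suc i) (suc b) ≈ p * v * κ i (suc b) + v * κ i b
  κ-suc i b = begin
    binomialSum i (λ a d → α (suc b) a (suc d)) + binomialSum i (λ a d → α (suc b) (suc a) d)
      ≈⟨ +-cong (binomialSum-cong i (α-sucᵈ b)) (binomialSum-cong i (α-sucᵃ b)) ⟩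
    binomialSum i (λ a d → p * v * α (suc b) a d + p * v * α b a d) + binomialSum i (λ a d → h * α b a d)
      ≈⟨ +-cong (trans (binomialSum-+ i _ _) (+-cong (sym (*-binomialSum i (p * v) _)) (sym (*-binomialSum i (p * v) _))))
                (sym (*-binomialSum i h _)) ⟩
    p * v * κ i (suc b) + p * v * κ i b + h * κ i b
      ≈⟨ solve 4 (λ x pv h y → x :+ pv :* y :+ h :* y := x :+ (pv :+ h) :* y) refl _ (p * v) h (κ i b) ⟩
    p * v * κ i (suc b) + (p * v + h) * κ i b
      ≈⟨ +-congˡ (*-congʳ pv+h≈v) ⟩
    p * v * κ i (suc b) + v * κ i b ∎

  κ-zero : ∀ i → κ (suc i) 0 ≈ p * v * κ i 0
  κ-zero i = begin
    binomialSum i (λ a d → α 0 a (suc d)) + binomialSum i (λ a d → 0#)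
      ≈⟨ +-cong (binomialSum-cong i eq) (binomialSum-0 i) ⟩
    binomialSum i (λ a d → p * v * α 0 a d) + 0#
      ≈⟨ trans (+-identityʳ _) (sym (*-binomialSum i (p * v) _)) ⟩
    p * v * κ i 0 ∎
    where
    eq : ∀ a d → α 0 a (suc d) ≈ p * v * α 0 a d
    eq a d = trans (α-θ a d (shiftedC (suc (suc d)) 0 a)) (*-congˡ (×-congˡ (shiftedC-suc-zero (suc d) a)))

  κ-degree : ∀ i b → suc i < b → κ i b ≈ 0#
  κ-degree zero    b             1<b             = ×-congˡ (k>n⇒nCk≡0 1<b)
  κ-degree (suc i) (suc b) (s≤s 1+i<b) = trans (κ-suc i b)
    (trans (+-cong (trans (*-congˡ (κ-degree i (suc b) (ℕₚ.m<n⇒m<1+n 1+i<b))) (zeroʳ _))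
                   (trans (*-congˡ (κ-degree i b 1+i<b)) (zeroʳ v)))
           (+-identityˡ 0#))

  -- The coefficient of z^j in f(t z)/(1 - t′ z).
  ev : ℕ → (ℕ → Carrier) → Carrier
  ev j f = ∑ (suc j) (λ b → f b * (t ^ b * t′ ^ (j ∸ b)))

  -- If g(z) = (x + yz) f(z), then g(tz) = (x + ytz) f(tz), and this factor commutes with the
  -- division by 1 - t′z.
  ev-shift : ∀ j {x y f g} → g 0 ≈ x * f 0 → (∀ b → g (suc b) ≈ x * f (suc b) + y * f b) →
             ev (suc j) g ≈ x * ev (suc j) f + y * (t * ev j f)
  ev-shift j {x} {y} {f} {g} g0 gs = begin
    ∑ (suc (suc j)) (λ b → g b * m b)
      ≈⟨ ∑-head (suc j) _ ⟩
    g 0 * m 0 + ∑ (suc j) (λ b → g (suc b) * m (suc b))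
      ≈⟨ +-cong (trans (*-congʳ g0) (*-assoc _ _ _)) (∑-cong (suc j) (λ b → trans (*-congʳ (gs b))
           (solve 7 (λ x f′ y f t P P′ → (x :* f′ :+ y :* f) :* (t :* P :* P′)
              := x :* (f′ :* (t :* P :* P′)) :+ y :* (t :* (f :* (P :* P′)))) refl
              x (f (suc b)) y (f b) t (t ^ b) (t′ ^ (j ∸ b))))) ⟩
    x * (f 0 * m 0) + ∑ (suc j) (λ b → x * (f (suc b) * m (suc b)) + y * (t * (f b * (t ^ b * t′ ^ (j ∸ b)))))
      ≈⟨ +-congˡ (trans (∑-+ (suc j) _ _) (+-cong (sym (*-∑ (suc j) x _))
           (trans (sym (*-∑ (suc j) y _)) (*-congˡ (sym (*-∑ (suc j) t _)))))) ⟩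
    x * (f 0 * m 0) + (x * ∑ (suc j) (λ b → f (suc b) * m (suc b)) + y * (t * ev j f))
      ≈⟨ trans (sym (+-assoc _ _ _)) (+-congʳ (sym (distribˡ _ _ _))) ⟩
    x * (f 0 * m 0 + ∑ (suc j) (λ b → f (suc b) * m (suc b))) + y * (t * ev j f)
      ≈⟨ +-congʳ (*-congˡ (∑-head (suc j) _)) ⟨
    x * ev (suc j) f + y * (t * ev j f) ∎
    where
    m : ℕ → Carrier
    m b = t ^ b * t′ ^ (suc j ∸ b)

  ev-last : ∀ j f → f (suc j) ≈ 0# → ev (suc j) f ≈ t′ * ev j f
  ev-last j f f≈0 = begin
    ∑ (suc j) (λ b → f b * (t ^ b * t′ ^ (suc j ∸ b))) + f (suc j) * (t ^ suc j * t′ ^ (j ∸ j))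
      ≈⟨ +-cong (∑-cong< (suc j) eq) (trans (*-congʳ f≈0) (zeroˡ _)) ⟩
    ∑ (suc j) (λ b → t′ * (f b * (t ^ b * t′ ^ (j ∸ b)))) + 0#
      ≈⟨ trans (+-identityʳ _) (sym (*-∑ (suc j) t′ _)) ⟩
    t′ * ev j f ∎
    where
    eq : ∀ b → b < suc j → f b * (t ^ b * t′ ^ (suc j ∸ b)) ≈ t′ * (f b * (t ^ b * t′ ^ (j ∸ b)))
    eq b (s≤s b≤j) = trans (*-congˡ (*-congˡ (^-congʳ t′ (ℕₚ.+-∸-assoc 1 b≤j))))
      (solve 4 (λ f P t′ P′ → f :* (P :* (t′ :* P′)) := t′ :* (f :* (P :* P′))) refl (f b) (t ^ b) t′ (t′ ^ (j ∸ b)))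

  H : ℕ → ℕ → Carrier
  H i j = ev j (κ i)

  -- The entries of `H` just outside the triangle j ≤ i. The recursion for the diagonal entries
  -- calls on them, although they belong to no admissible index.
  e : ℕ → Carrier
  e j = H j (suc j)

  ω : Carrier
  ω = t + t′ * p

  u-cancel : ∀ {x y} → x ≈ v * y → u * x ≈ y
  u-cancel {x} {y} x≈ = trans (*-congˡ x≈) (trans (sym (*-assoc _ _ _)) (trans (*-congʳ uv) (*-identityˡ y)))

  -- The factor v(p + z) of `κ-suc`, seen through `ev`; multiplication by u clears the v.
  H-suc : ∀ i j → u * H (suc i) (suc j) ≈ p * H i (suc j) + t * H i j
  H-suc i j = u-cancel (trans (ev-shift j (κ-zero i) (κ-suc i))
    (solve 5 (λ p v x t y → p :* v :* x :+ v :* (t :* y) := v :* (p :* x :+ t :* y)) refl p v (H i (suc j)) t (H i j)))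

  H-suc-zero : ∀ i → u * H (suc i) 0 ≈ p * H i 0
  H-suc-zero i = u-cancel (begin
    0# + κ (suc i) 0 * (1# * 1#)             ≈⟨ +-congˡ (*-congʳ (κ-zero i)) ⟩
    0# + p * v * κ i 0 * (1# * 1#)           ≈⟨ solve 5 (λ z p v x y → z :+ p :* v :* x :* y := z :+ v :* (p :* (x :* y))) refl 0# p v (κ i 0) (1# * 1#) ⟩
    0# + v * (p * (κ i 0 * (1# * 1#)))       ≈⟨ trans (+-identityˡ _) (*-congˡ (*-congˡ (sym (+-identityˡ _)))) ⟩
    v * (p * H i 0)                          ∎)

  κ₀₀ : κ 0 0 ≈ p * v * v
  κ₀₀ = begin
    1# * (p * 1# * (v * (v * 1#))) + 0#      ≈⟨ trans (+-identityʳ _) (*-identityˡ _) ⟩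
    p * 1# * (v * (v * 1#))                  ≈⟨ *-cong (*-identityʳ p) (*-congˡ (*-identityʳ v)) ⟩
    p * (v * v)                              ≈⟨ *-assoc p v v ⟨
    p * v * v                                ∎

  H₀₀ : u * H 0 0 ≈ p * v
  H₀₀ = u-cancel (trans (+-identityˡ _) (trans (*-congˡ (*-identityˡ 1#)) (trans (*-identityʳ _) (trans κ₀₀ (*-comm _ v)))))

  e-zero : e 0 ≈ p * v * v
  e-zero = begin
    0# + κ 0 0 * (1# * (t′ * 1#)) + κ 0 0 * (t * 1# * 1#)
      ≈⟨ +-cong (trans (+-identityˡ _) (*-congˡ (trans (*-identityˡ _) (*-identityʳ t′)))) (*-congˡ (trans (*-identityʳ _) (*-identityʳ t))) ⟩
    κ 0 0 * t′ + κ 0 0 * t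
      ≈⟨ trans (+-comm _ _) (sym (distribˡ _ _ _)) ⟩
    κ 0 0 * (t + t′)
      ≈⟨ trans (*-congˡ t+t′) (*-identityʳ _) ⟩
    κ 0 0
      ≈⟨ κ₀₀ ⟩
    p * v * v ∎

  -- The polynomial of `κ j` has degree at most j + 1, so the next entry `H j (suc (suc j))` is t′
  -- times `e j` and the recursion closes up on the boundary. The ratio ω/u is what produces the
  -- denominator b = u - ωxy.
  e-suc : ∀ j → u * e (suc j) ≈ ω * e j
  e-suc j = begin
    u * H (suc j) (suc (suc j))                ≈⟨ H-suc j (suc j) ⟩
    p * H j (suc (suc j)) + t * e j            ≈⟨ +-congʳ (*-congˡ (ev-last (suc j) (κ j) (κ-degree j (suc (suc j)) ℕₚ.≤-refl))) ⟩
    p * (t′ * e j) + t * e j                   ≈⟨ solve 4 (λ p t′ e t → p :* (t′ :* e) :+ t :* e := (t :+ t′ :* p) :* e) refl p t′ (e j) t ⟩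
    ω * e j                                    ∎

  -- The coefficient of xy in p (1 − ht xy) = (u − ω xy) (pv + p ∑ e j (xy)^(j+1)).
  e-zero-equation : u * (p * e 0) + h * t * p ≈ ω * (p * v)
  e-zero-equation = begin
    u * (p * e 0) + h * t * p
      ≈⟨ +-congʳ (*-congˡ (*-congˡ e-zero)) ⟩
    u * (p * (p * v * v)) + h * t * p
      ≈⟨ +-cong (solve 3 (λ u p v → u :* (p :* (p :* v :* v)) := u :* v :* (p :* p :* v)) refl u p v)
                (trans (sym (*-identityʳ _)) (*-congˡ (sym uv))) ⟩
    u * v * (p * p * v) + h * t * p * (u * v)
      ≈⟨ +-congʳ (trans (*-congʳ uv) (trans (*-identityˡ _) (trans (sym (*-identityˡ _)) (*-congʳ (sym t+t′))))) ⟩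
    (t + t′) * (p * p * v) + h * t * p * (u * v)
      ≈⟨ solve 6 (λ t t′ p v h u → (t :+ t′) :* (p :* p :* v) :+ h :* t :* p :* (u :* v)
           := ((p :+ h :* u) :* t :+ t′ :* p) :* (p :* v)) refl t t′ p v h u ⟩
    ((p + h * u) * t + t′ * p) * (p * v)
      ≈⟨ *-congʳ (+-congʳ (trans (*-congʳ p+hu) (*-identityˡ t))) ⟩
    ω * (p * v) ∎

  κ-expand : ∀ {i b} → b ≤ i → κ i b ≈
    ∑ (suc b) (λ a → ((i C a) ℕ.* (suc (i ∸ a) C (b ∸ a))) · (h ^ a * θ (i ∸ a)))
  κ-expand {i} {b} b≤i = begin
    κ i b
      ≈⟨ binomialSum-expand i (α b) ⟩
    ∑ (suc i) (λ a → (i C a) · α b a (i ∸ a))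
      ≈⟨ ∑-extend _ (s≤s b≤i) (λ a b<a → trans (×-congʳ (i C a) (×-congˡ (shiftedC-> (suc (i ∸ a)) b<a))) (×-zeroʳ (i C a))) ⟨
    ∑ (suc b) (λ a → (i C a) · α b a (i ∸ a))
      ≈⟨ ∑-cong< (suc b) (λ { a (s≤s a≤b) → trans (×-congʳ (i C a) (×-congˡ (shiftedC-≤ (suc (i ∸ a)) a≤b)))
           (×-assocˡ _ (i C a) (suc (i ∸ a) C (b ∸ a))) }) ⟩
    ∑ (suc b) (λ a → ((i C a) ℕ.* (suc (i ∸ a) C (b ∸ a))) · (h ^ a * θ (i ∸ a))) ∎
    where
    ×-zeroʳ : ∀ n → n · 0# ≈ 0#
    ×-zeroʳ zero    = refl
    ×-zeroʳ (suc n) = trans (+-identityˡ _) (×-zeroʳ n)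

-- Extraction of the coefficients from the generating function

module SumFormula {c ℓ} (A : CommutativeRing c ℓ) (L : ℕ) (Q : QIntegers A L)
                  (t t′ : CommutativeRing.Carrier A)
                  (t+t′ : CommutativeRing._≈_ A (CommutativeRing._+_ A t t′) (CommutativeRing.1# A))
                  (M N : ℕ) where

  open Bivariate A L Q t t′ t+t′ M N
  private
    module A = CommutativeRing A
    module Aq = QIntegers Q
    module S = CommutativeRing X.seriesRing
    module R = CommutativeRing Y.seriesRing
  open CommutativeRing Y.seriesRing using (_≈_)
  module C m = Coefficients A (Aq.p (suc m)) (Aq.u (suc m)) (Aq.v m) Aq.h t t′ (Aq.p+hu (suc m)) (Aq.uv m) t+t′
  open Algebra.Properties.Semiring.Exp S.semiring using (_^_)

  module _ (m : ℕ) where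
    open C m
    open CommutativeRing A hiding (zero; _≈_)
    open import Relation.Binary.Reasoning.Setoid S.setoid
    open SemiringSolver S.commutativeSemiring using (solve; _:=_; _:+_; _:*_)

    p u v h : Carrier
    p = Aq.p (suc m)
    u = Aq.u (suc m)
    v = Aq.v m
    h = Aq.h

    -- The first index is offset by j, so that only the entries with j ≤ i occur.
    H-diagonal : ℕ → S.Carrier
    H-diagonal j = X.series (λ r → H (r ℕ.+ j) j)

    private
      g = H-diagonal
      coeff-g : ∀ j r → X.coeff (g j) r ≡ H (r ℕ.+ j) j
      coeff-g j = X.coeff-series _

      coeff-const : ∀ a r → X.coeff (X.const a) r ≡ X.constant a r
      coeff-const a = X.coeff-series _

    H-diagonal-zero : X.const u S.* g 0 S.≈ X.X S.* (X.const p S.* g 0) S.+ X.const (p * v)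
    H-diagonal-zero = X.≈-from-coeff λ r _ → trans (X.coeff-const-* u (g 0) r)
      (trans (*-congˡ (reflexive (coeff-g 0 r))) (sym (trans (reflexive (X.coeff-+ _ _ r))
        (trans (+-cong (X.coeff-X-* _ r) (reflexive (coeff-const (p * v) r))) (eq r)))))
      where
      eq : ∀ r → X.shift (X.coeff (X.const p S.* g 0)) r + X.constant (p * v) r A.≈ u * H (r ℕ.+ 0) 0
      eq zero    = trans (+-identityˡ _) (sym H₀₀)
      eq (suc r) = trans (+-identityʳ _) (trans (X.coeff-const-* p (g 0) r)
        (trans (*-congˡ (reflexive (coeff-g 0 r))) (sym (H-suc-zero (r ℕ.+ 0)))))

    H-diagonal-suc : ∀ j → X.const u S.* g (suc j) S.≈
      X.X S.* (X.const p S.* g (suc j)) S.+ X.const t S.* g j S.+ X.const (p * e j)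
    H-diagonal-suc j = X.≈-from-coeff λ r _ → trans (X.coeff-const-* u (g (suc j)) r)
      (trans (*-congˡ (reflexive (coeff-g (suc j) r))) (sym (trans (reflexive (X.coeff-+ _ _ r))
        (trans (+-cong (trans (reflexive (X.coeff-+ _ _ r)) (+-cong (X.coeff-X-* _ r)
          (trans (X.coeff-const-* t (g j) r) (*-congˡ (reflexive (coeff-g j r))))))
          (reflexive (coeff-const (p * e j) r))) (eq r)))))
      where
      eq : ∀ r → X.shift (X.coeff (X.const p S.* g (suc j))) r + t * H (r ℕ.+ j) j + X.constant (p * e j) r A.≈
                 u * H (r ℕ.+ suc j) (suc j)
      eq zero    = trans (+-congʳ (+-identityˡ _)) (trans (+-comm _ _) (sym (H-suc j j)))
      eq (suc r) = trans (+-identityʳ _) (trans (+-cong (trans (X.coeff-const-* p (g (suc j)) r)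
        (*-congˡ (reflexive (coeff-g (suc j) r)))) (*-congˡ (reflexive (≡.cong (λ i → H i j) (≡.sym (ℕₚ.+-suc r j))))))
        (sym (H-suc (r ℕ.+ suc j) j)))

    -- The coefficients of y^j. Thus G collects `H i j` x^i y^j over j ≤ i, and E = pv + p ∑ `e j`
    -- (xy)^(j+1) collects what the recursion of `H` takes from outside the triangle.
    Gⱼ Eⱼ : ℕ → S.Carrier
    Gⱼ j = X.X ^ j S.* g j
    Eⱼ zero    = X.const (p * v)
    Eⱼ (suc j) = X.X ^ suc j S.* X.const (p * e j)

    G E : R.Carrier
    G = Y.series Gⱼ
    E = Y.series Eⱼ

    -- This is `H-suc` summed over the triangle. On the diagonal the term p `H j (suc j)` is missing
    -- from x p G, and E supplies it.
    G-equation : ι u R.* G ≈ x R.* (ι p R.* G) R.+ Y.X R.* (x R.* (ι t R.* G)) R.+ E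
    G-equation = Y.≈-from-coeff λ j _ → S.trans (coeff-ι* u j) (S.sym (S.trans (S.reflexive (Y.coeff-+ _ E j))
      (S.trans (S.+-cong (S.trans (S.reflexive (Y.coeff-+ _ _ j)) (S.+-cong (coeff-xι* p j) (Y.coeff-X-* _ j)))
        (S.reflexive (Y.coeff-series Eⱼ j))) (eq j))))
      where
      coeff-ι* : ∀ a j → Y.coeff (ι a R.* G) j S.≈ X.const a S.* Gⱼ j
      coeff-ι* a j = S.trans (Y.coeff-const-* (X.const a) G j) (S.*-congˡ (S.reflexive (Y.coeff-series Gⱼ j)))
      coeff-xι* : ∀ a j → Y.coeff (x R.* (ι a R.* G)) j S.≈ X.X S.* (X.const a S.* Gⱼ j)
      coeff-xι* a j = S.trans (Y.coeff-const-* X.X _ j) (S.*-congˡ (coeff-ι* a j))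
      eq : ∀ j → X.X S.* (X.const p S.* Gⱼ j) S.+ Y.shift (Y.coeff (x R.* (ι t R.* G))) j S.+ Eⱼ j S.≈ X.const u S.* Gⱼ j
      eq zero = begin
        X.X S.* (X.const p S.* (S.1# S.* g 0)) S.+ S.0# S.+ X.const (p * v)
          ≈⟨ S.+-congʳ (S.trans (S.+-identityʳ _) (S.*-congˡ (S.*-congˡ (S.*-identityˡ _)))) ⟩
        X.X S.* (X.const p S.* g 0) S.+ X.const (p * v)
          ≈⟨ H-diagonal-zero ⟨
        X.const u S.* g 0
          ≈⟨ S.*-congˡ (S.*-identityˡ _) ⟨
        X.const u S.* (S.1# S.* g 0) ∎
      eq (suc j) = begin
        X.X S.* (X.const p S.* (X.X S.* X.X ^ j S.* g (suc j))) S.+ Y.coeff (x R.* (ι t R.* G)) j S.+ Eⱼ (suc j)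
          ≈⟨ S.+-congʳ (S.+-congˡ (coeff-xι* t j)) ⟩
        X.X S.* (X.const p S.* (X.X S.* X.X ^ j S.* g (suc j))) S.+ X.X S.* (X.const t S.* (X.X ^ j S.* g j)) S.+ X.X S.* X.X ^ j S.* X.const (p * e j)
          ≈⟨ solve 7 (λ x p xj g′ t g c →
               x :* (p :* (x :* xj :* g′)) :+ x :* (t :* (xj :* g)) :+ x :* xj :* c
               := x :* xj :* (x :* (p :* g′) :+ t :* g :+ c)) S.refl
               X.X (X.const p) (X.X ^ j) (g (suc j)) (X.const t) (g j) (X.const (p * e j)) ⟩
        X.X ^ suc j S.* (X.X S.* (X.const p S.* g (suc j)) S.+ X.const t S.* g j S.+ X.const (p * e j))
          ≈⟨ S.*-congˡ (H-diagonal-suc j) ⟨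
        X.X ^ suc j S.* (X.const u S.* g (suc j))
          ≈⟨ solve 3 (λ xj u g → xj :* (u :* g) := u :* (xj :* g)) S.refl (X.X ^ suc j) (X.const u) (g (suc j)) ⟩
        X.const u S.* (X.X ^ suc j S.* g (suc j)) ∎

    const₃ : ∀ {a a′ b b′} → a * a′ A.≈ b * b′ → X.const a S.* X.const a′ S.≈ X.const b S.* X.const b′
    const₃ eq = S.trans (S.sym (X.const-*-homo _ _)) (S.trans (X.const-cong eq) (X.const-*-homo _ _))

    -- From y² on this is the geometric recursion `e-suc`. The start of the sequence deviates from
    -- it, and the deviation in degree y is exactly htp xy.
    E-equation : ι u R.* E R.+ Y.X R.* (x R.* ι (h * t * p)) ≈ Y.X R.* (x R.* (ι ω R.* E)) R.+ ι p
    E-equation = Y.≈-from-coeff λ j _ →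
      S.trans (S.reflexive (Y.coeff-+ _ _ j)) (S.trans (S.+-cong (coeff-ι* u j) (Y.coeff-X-* _ j))
        (S.trans (eq j) (S.sym (S.trans (S.reflexive (Y.coeff-+ _ _ j)) (S.+-cong (Y.coeff-X-* _ j) (coeff-ι p j))))))
      where
      coeff-ι : ∀ a j → Y.coeff (ι a) j S.≈ Y.constant (X.const a) j
      coeff-ι a j = S.reflexive (Y.coeff-series _ j)
      coeff-ι* : ∀ a j → Y.coeff (ι a R.* E) j S.≈ X.const a S.* Eⱼ j
      coeff-ι* a j = S.trans (Y.coeff-const-* (X.const a) E j) (S.*-congˡ (S.reflexive (Y.coeff-series Eⱼ j)))
      coeff-x* : ∀ f j → Y.coeff (x R.* f) j S.≈ X.X S.* Y.coeff f j
      coeff-x* f j = Y.coeff-const-* X.X f j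
      eq : ∀ j → X.const u S.* Eⱼ j S.+ Y.shift (Y.coeff (x R.* ι (h * t * p))) j S.≈
                 Y.shift (Y.coeff (x R.* (ι ω R.* E))) j S.+ Y.constant (X.const p) j
      eq zero = begin
        X.const u S.* X.const (p * v) S.+ S.0#   ≈⟨ S.+-comm _ _ ⟩
        S.0# S.+ X.const u S.* X.const (p * v)   ≈⟨ S.+-congˡ (S.trans (S.sym (X.const-*-homo u (p * v)))
                                                     (X.const-cong (u-cancel (*-comm p v)))) ⟩
        S.0# S.+ X.const p                       ∎
      eq (suc zero) = begin
        X.const u S.* (X.X S.* S.1# S.* X.const (p * e 0)) S.+ Y.coeff (x R.* ι (h * t * p)) 0
          ≈⟨ S.+-cong (S.*-congˡ (S.*-congʳ (S.*-identityʳ X.X))) (S.trans (coeff-x* _ 0) (S.*-congˡ (coeff-ι _ 0))) ⟩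
        X.const u S.* (X.X S.* X.const (p * e 0)) S.+ X.X S.* X.const (h * t * p)
          ≈⟨ solve 4 (λ u x c d → u :* (x :* c) :+ x :* d := x :* (u :* c :+ d)) S.refl _ X.X _ _ ⟩
        X.X S.* (X.const u S.* X.const (p * e 0) S.+ X.const (h * t * p))
          ≈⟨ S.*-congˡ (S.trans (S.+-congʳ (S.sym (X.const-*-homo _ _))) (S.trans (S.sym (X.const-+-homo _ _))
               (S.trans (X.const-cong e-zero-equation) (X.const-*-homo _ _)))) ⟩
        X.X S.* (X.const ω S.* X.const (p * v))
          ≈⟨ S.trans (S.+-identityʳ _) (S.trans (coeff-x* _ 0) (S.*-congˡ (coeff-ι* ω 0))) ⟨
        Y.coeff (x R.* (ι ω R.* E)) 0 S.+ S.0# ∎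
      eq (suc (suc j)) = begin
        X.const u S.* (X.X S.* X.X ^ suc j S.* X.const (p * e (suc j))) S.+ Y.coeff (x R.* ι (h * t * p)) (suc j)
          ≈⟨ S.+-congˡ (S.trans (coeff-x* _ (suc j)) (S.trans (S.*-congˡ (coeff-ι _ (suc j))) (S.zeroʳ X.X))) ⟩
        X.const u S.* (X.X S.* X.X ^ suc j S.* X.const (p * e (suc j))) S.+ S.0#
          ≈⟨ S.trans (S.+-identityʳ _) (solve 4 (λ u x y c → u :* (x :* y :* c) := x :* (y :* (u :* c))) S.refl _ X.X (X.X ^ suc j) _) ⟩
        X.X S.* (X.X ^ suc j S.* (X.const u S.* X.const (p * e (suc j))))
          ≈⟨ S.*-congˡ (S.*-congˡ (const₃ scalar)) ⟩
        X.X S.* (X.X ^ suc j S.* (X.const ω S.* X.const (p * e j)))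
          ≈⟨ solve 4 (λ x y w c → x :* (y :* (w :* c)) := x :* (w :* (y :* c))) S.refl X.X (X.X ^ suc j) _ _ ⟩
        X.X S.* (X.const ω S.* Eⱼ (suc j))
          ≈⟨ S.trans (S.+-identityʳ _) (S.trans (coeff-x* _ (suc j)) (S.*-congˡ (coeff-ι* ω (suc j)))) ⟨
        Y.coeff (x R.* (ι ω R.* E)) (suc j) S.+ S.0# ∎
        where
        swap : ∀ x y z → x * (y * z) A.≈ y * (x * z)
        swap x y z = trans (sym (*-assoc x y z)) (trans (*-congʳ (*-comm x y)) (*-assoc y x z))
        scalar : u * (p * e (suc j)) A.≈ ω * (p * e j)
        scalar = trans (swap u p _) (trans (*-congˡ (e-suc j)) (swap p ω _))

    coeff-X^ : ∀ j f r → r ℕ.+ j < M → X.coeff (X.X ^ j S.* f) (r ℕ.+ j) A.≈ X.coeff f r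
    coeff-X^ zero    f r r<M = trans (X.coeff-cong r<M (S.*-identityˡ f)) (reflexive (≡.cong (X.coeff f) (ℕₚ.+-identityʳ r)))
    coeff-X^ (suc j) f r r<M rewrite ℕₚ.+-suc r j =
      trans (X.coeff-cong r<M (S.*-assoc X.X (X.X ^ j) f))
        (trans (X.coeff-X-* _ (suc (r ℕ.+ j))) (coeff-X^ j f r (ℕₚ.<-trans ℕₚ.≤-refl r<M)))

    coeff-G : ∀ {i j} → j ≤ i → i < M → coeff₂ G j i A.≈ H i j
    coeff-G {i} {j} j≤i i<M = trans (reflexive (≡.cong (λ f → X.coeff f i) (Y.coeff-series Gⱼ j))) eq
      where
      d = i ∸ j
      d+j : d ℕ.+ j ≡ i
      d+j = ℕₚ.m∸n+n≡m j≤i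
      eq : X.coeff (Gⱼ j) i A.≈ H i j
      eq = ≡.subst (λ k → X.coeff (Gⱼ j) k A.≈ H k j) d+j
        (trans (coeff-X^ j (g j) d (≡.subst (_< M) (≡.sym d+j) i<M)) (reflexive (coeff-g j d)))

    G≈ : W R.* (ι p R.* D⁻¹ m R.* b⁻¹ m) ≈ G
    G≈ = solution (suc m) (DD⁻¹ m) (bb⁻¹ m)
      (R.trans (ι-* (h * t) p) (R.*-congʳ (ι-* h t))) G-equation
      (R.trans E-equation (R.+-congʳ (R.*-congˡ (R.*-congˡ (R.*-congʳ
        (R.trans (ι-+ t (t′ * p)) (R.+-congˡ (ι-* t′ p))))))))
      where
      ι-+ : ∀ a a′ → ι (a + a′) ≈ ι a R.+ ι a′
      ι-+ a a′ = R.trans (Y.const-cong (X.const-+-homo a a′)) (Y.const-+-homo (X.const a) (X.const a′))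

  -- The prefactor x z = x²y accounts for the passage from weight i + 2 and depth j + 1 to the entry
  -- `H i j`.
  ∑-admissibleSum : ∀ {i j} → j ≤ i → suc (suc i) < M → suc j < N →
    FiniteSums.∑ A L (λ m → admissibleSum m (suc j) (suc (suc i))) A.≈ FiniteSums.∑ A L (λ m → C.H m i j)
  ∑-admissibleSum {i} {j} j≤i w<M n<N = begin
    ∑A L (λ m → admissibleSum m (suc j) (suc (suc i)))
      ≈⟨ ∑A-cong L (λ m → A.reflexive (coeff₂-series₂ (admissibleSum m) (suc j) (suc (suc i)))) ⟨
    ∑A L (λ m → coeff₂ (admissibleSeries m) (suc j) (suc (suc i)))
      ≈⟨ coeff₂-∑ L admissibleSeries (suc j) (suc (suc i)) w<M ⟨
    coeff₂ (∑R L admissibleSeries) (suc j) (suc (suc i))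
      ≈⟨ coeff₂-cong n<N w<M (R.trans ∑-admissibleSeries (R.trans
           (R.*-congˡ (R.*-congˡ (FiniteSums.∑-cong Y.seriesRing L G≈))) rearrange)) ⟩
    coeff₂ (Y.X R.* (x R.* (x R.* ∑R L G))) (suc j) (suc (suc i))
      ≈⟨ coeff₂-y-suc _ j w<M ⟩
    coeff₂ (x R.* (x R.* ∑R L G)) j (suc (suc i))
      ≈⟨ coeff₂-x _ j w<M ⟩
    coeff₂ (x R.* ∑R L G) j (suc i)
      ≈⟨ coeff₂-x _ j 1+i<M ⟩
    coeff₂ (∑R L G) j i
      ≈⟨ coeff₂-∑ L G j i i<M ⟩
    ∑A L (λ m → coeff₂ (G m) j i)
      ≈⟨ ∑A-cong L (λ m → coeff-G m j≤i i<M) ⟩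
    ∑A L (λ m → C.H m i j) ∎
    where
    open import Relation.Binary.Reasoning.Setoid A.setoid
    open FiniteSums A using () renaming (∑ to ∑A; ∑-cong to ∑A-cong)
    open FiniteSums Y.seriesRing using () renaming (∑ to ∑R)
    1+i<M : suc i < M
    1+i<M = ℕₚ.<-trans ℕₚ.≤-refl w<M
    i<M : i < M
    i<M = ℕₚ.<-trans ℕₚ.≤-refl 1+i<M
    rearrange : x R.* (x R.* Y.X R.* ∑R L G) ≈ Y.X R.* (x R.* (x R.* ∑R L G))
    rearrange = solve 3 (λ x y f → x :* (x :* y :* f) := y :* (x :* (x :* f))) R.refl x Y.X (∑R L G)
      where open SemiringSolver R.commutativeSemiring using (solve; _:=_; _:*_)

-- Binomial identities and rational scalars

C-factorial : ∀ m n → ((m ℕ.+ n) C m) ℕ.* (m ! ℕ.* n !) ≡ (m ℕ.+ n) !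
C-factorial m n = begin
  ((m ℕ.+ n) C m) ℕ.* (m ! ℕ.* n !)               ≡⟨ ≡.cong (λ k → ((m ℕ.+ n) C m) ℕ.* (m ! ℕ.* k !)) (ℕₚ.m+n∸m≡n m n) ⟨
  ((m ℕ.+ n) C m) ℕ.* (m ! ℕ.* (m ℕ.+ n ∸ m) !)   ≡⟨ ≡.cong (ℕ._* (m ! ℕ.* (m ℕ.+ n ∸ m) !)) (nCk≡n!/k![n-k]! m≤m+n) ⟩
  _                                               ≡⟨ m/n*n≡m (k![n∸k]!∣n! m≤m+n) ⟩
  (m ℕ.+ n) !                                     ∎
  where
  open ≡.≡-Reasoning
  m≤m+n = ℕₚ.m≤m+n m n
  instance _ = m ℕₚ.!* (m ℕ.+ n ∸ m) !≢0

-- With i = a + e + f, both sides times `T` equal (i + 1)! (e + f + 1)!. The parametrisation by sums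
-- keeps subtraction out of the factorials.
C-identity : ∀ a e f → suc (a ℕ.+ (e ℕ.+ f)) ℕ.* (((a ℕ.+ (e ℕ.+ f)) C a) ℕ.* (suc (e ℕ.+ f) C e)) ≡
             (suc (a ℕ.+ (e ℕ.+ f)) C (a ℕ.+ e)) ℕ.* ((a ℕ.+ e) C a) ℕ.* suc (e ℕ.+ f)
C-identity a e f = ℕₚ.*-cancelʳ-≡ _ _ T (begin
  suc i ℕ.* (x ℕ.* y) ℕ.* T
    ≡⟨ solve 7 (λ n x y A B F G → n :* (x :* y) :* ((A :* B) :* (F :* G))
         := n :* (x :* (A :* G)) :* (y :* (B :* F))) ≡.refl (suc i) x y (a !) (e !) (suc f !) ((e ℕ.+ f) !) ⟩
  suc i ℕ.* (x ℕ.* (a ! ℕ.* (e ℕ.+ f) !)) ℕ.* (y ℕ.* (e ! ℕ.* suc f !))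
    ≡⟨ ≡.cong₂ (λ p q → suc i ℕ.* p ℕ.* q) (C-factorial a (e ℕ.+ f)) y≡ ⟩
  suc i ! ℕ.* suc (e ℕ.+ f) !
    ≡⟨ ≡.cong₂ (λ p q → p ℕ.* q) z≡ ≡.refl ⟨
  z ℕ.* ((w ℕ.* (a ! ℕ.* e !)) ℕ.* suc f !) ℕ.* (suc (e ℕ.+ f) ℕ.* (e ℕ.+ f) !)
    ≡⟨ solve 7 (λ z w A B F m G → z :* ((w :* (A :* B)) :* F) :* (m :* G)
         := z :* w :* m :* ((A :* B) :* (F :* G))) ≡.refl z w (a !) (e !) (suc f !) (suc (e ℕ.+ f)) ((e ℕ.+ f) !) ⟩
  z ℕ.* w ℕ.* suc (e ℕ.+ f) ℕ.* T ∎)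
  where
  open ≡.≡-Reasoning
  open Data.Nat.Solver.+-*-Solver using (solve; _:=_; _:*_)
  i = a ℕ.+ (e ℕ.+ f)
  x = i C a
  y = suc (e ℕ.+ f) C e
  z = suc i C (a ℕ.+ e)
  w = (a ℕ.+ e) C a
  T = (a ! ℕ.* e !) ℕ.* (suc f ! ℕ.* (e ℕ.+ f) !)
  instance
    T≢0 : ℕ.NonZero T
    T≢0 = ℕₚ.m*n≢0 _ _ {{a ℕₚ.!* e !≢0}} {{suc f ℕₚ.!* (e ℕ.+ f) !≢0}}
  y≡ : y ℕ.* (e ! ℕ.* suc f !) ≡ suc (e ℕ.+ f) !
  y≡ = ≡.subst (λ k → (k C e) ℕ.* (e ! ℕ.* suc f !) ≡ k !) (ℕₚ.+-suc e f) (C-factorial e (suc f))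
  z≡ : z ℕ.* ((w ℕ.* (a ! ℕ.* e !)) ℕ.* suc f !) ≡ suc i !
  z≡ = ≡.trans (≡.cong (λ k → z ℕ.* (k ℕ.* suc f !)) (C-factorial a e))
    (≡.subst (λ k → (k C (a ℕ.+ e)) ℕ.* ((a ℕ.+ e) ! ℕ.* suc f !) ≡ k !)
      (≡.trans (ℕₚ.+-suc (a ℕ.+ e) f) (≡.cong suc (ℕₚ.+-assoc a e f))) (C-factorial (a ℕ.+ e) (suc f)))

C-identity-∸ : ∀ {a b i} → a ≤ b → b ≤ i →
  suc i ℕ.* ((i C a) ℕ.* (suc (i ∸ a) C (b ∸ a))) ≡ (suc i C b) ℕ.* (b C a) ℕ.* (suc i ∸ a)
C-identity-∸ {a} {b} {i} a≤b b≤i = begin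
  suc i ℕ.* ((i C a) ℕ.* (suc (i ∸ a) C e))
    ≡⟨ ≡.cong₂ (λ i d → suc i ℕ.* ((i C a) ℕ.* (suc d C e))) i≡ i∸a≡ ⟩
  suc (a ℕ.+ (e ℕ.+ f)) ℕ.* (((a ℕ.+ (e ℕ.+ f)) C a) ℕ.* (suc (e ℕ.+ f) C e))
    ≡⟨ C-identity a e f ⟩
  (suc (a ℕ.+ (e ℕ.+ f)) C (a ℕ.+ e)) ℕ.* ((a ℕ.+ e) C a) ℕ.* suc (e ℕ.+ f)
    ≡⟨ ≡.cong₂ (λ i b → (suc i C b) ℕ.* (b C a) ℕ.* suc (e ℕ.+ f)) i≡ (≡.sym (ℕₚ.m+[n∸m]≡n a≤b)) ⟨
  (suc i C b) ℕ.* (b C a) ℕ.* suc (e ℕ.+ f)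
    ≡⟨ ≡.cong ((suc i C b) ℕ.* (b C a) ℕ.*_) (≡.trans (ℕₚ.+-∸-assoc 1 (ℕₚ.≤-trans a≤b b≤i)) (≡.cong suc i∸a≡)) ⟨
  (suc i C b) ℕ.* (b C a) ℕ.* (suc i ∸ a) ∎
  where
  open ≡.≡-Reasoning
  e = b ∸ a
  f = i ∸ b
  i≡ : i ≡ a ℕ.+ (e ℕ.+ f)
  i≡ = ≡.sym (≡.trans (≡.sym (ℕₚ.+-assoc a e f))
    (≡.trans (≡.cong (ℕ._+ f) (ℕₚ.m+[n∸m]≡n a≤b)) (ℕₚ.m+[n∸m]≡n b≤i)))
  i∸a≡ : i ∸ a ≡ e ℕ.+ f
  i∸a≡ = ≡.trans (≡.cong (_∸ a) i≡) (ℕₚ.m+n∸m≡n a (e ℕ.+ f))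

fromℚᵘ-homo-+ : ∀ p q → ℚ.fromℚᵘ (p ℚᵘ.+ q) ≡ ℚ.fromℚᵘ p ℚ.+ ℚ.fromℚᵘ q
fromℚᵘ-homo-+ p q = ℚₚ.toℚᵘ-injective (begin
  ℚ.toℚᵘ (ℚ.fromℚᵘ (p ℚᵘ.+ q))                       ≈⟨ ℚₚ.toℚᵘ-fromℚᵘ (p ℚᵘ.+ q) ⟩
  p ℚᵘ.+ q                                           ≈⟨ ℚᵘₚ.+-cong (ℚₚ.toℚᵘ-fromℚᵘ p) (ℚₚ.toℚᵘ-fromℚᵘ q) ⟨
  ℚ.toℚᵘ (ℚ.fromℚᵘ p) ℚᵘ.+ ℚ.toℚᵘ (ℚ.fromℚᵘ q)       ≈⟨ ℚₚ.toℚᵘ-homo-+ (ℚ.fromℚᵘ p) (ℚ.fromℚᵘ q) ⟨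
  ℚ.toℚᵘ (ℚ.fromℚᵘ p ℚ.+ ℚ.fromℚᵘ q)                 ∎)
  where open import Relation.Binary.Reasoning.Setoid ℚᵘₚ.≃-setoid

fromℚᵘ-homo-* : ∀ p q → ℚ.fromℚᵘ (p ℚᵘ.* q) ≡ ℚ.fromℚᵘ p ℚ.* ℚ.fromℚᵘ q
fromℚᵘ-homo-* p q = ℚₚ.toℚᵘ-injective (begin
  ℚ.toℚᵘ (ℚ.fromℚᵘ (p ℚᵘ.* q))                       ≈⟨ ℚₚ.toℚᵘ-fromℚᵘ (p ℚᵘ.* q) ⟩
  p ℚᵘ.* q                                           ≈⟨ ℚᵘₚ.*-cong (ℚₚ.toℚᵘ-fromℚᵘ p) (ℚₚ.toℚᵘ-fromℚᵘ q) ⟨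
  ℚ.toℚᵘ (ℚ.fromℚᵘ p) ℚᵘ.* ℚ.toℚᵘ (ℚ.fromℚᵘ q)       ≈⟨ ℚₚ.toℚᵘ-homo-* (ℚ.fromℚᵘ p) (ℚ.fromℚᵘ q) ⟨
  ℚ.toℚᵘ (ℚ.fromℚᵘ p ℚ.* ℚ.fromℚᵘ q)                 ∎)
  where open import Relation.Binary.Reasoning.Setoid ℚᵘₚ.≃-setoid

ℕ→ℚ-suc : ∀ n → ℕ→ℚ (suc n) ≡ 1ℚ ℚ.+ ℕ→ℚ n
ℕ→ℚ-suc n = ≡.trans (ℚₚ.fromℚᵘ-cong {mkℚᵘ (+ suc n) 0} {mkℚᵘ (+ 1) 0 ℚᵘ.+ mkℚᵘ (+ n) 0} (*≡* eq))
  (fromℚᵘ-homo-+ (mkℚᵘ (+ 1) 0) (mkℚᵘ (+ n) 0))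
  where
  eq : + suc n ℤ.* + 1 ≡ (+ 1 ℤ.* + 1 ℤ.+ + n ℤ.* + 1) ℤ.* + 1
  eq = ≡.cong (ℤ._* + 1) (≡.cong (λ k → + 1 ℤ.+ k) (≡.sym (ℤₚ.*-identityʳ (+ n))))

ℕ→ℚ-* : ∀ m n → ℕ→ℚ (m ℕ.* n) ≡ ℕ→ℚ m ℚ.* ℕ→ℚ n
ℕ→ℚ-* m n = ≡.trans
  (ℚₚ.fromℚᵘ-cong {mkℚᵘ (+ (m ℕ.* n)) 0} {mkℚᵘ (+ m) 0 ℚᵘ.* mkℚᵘ (+ n) 0} (*≡* (≡.cong (ℤ._* + 1) (ℤₚ.pos-* m n))))
   (fromℚᵘ-homo-* (mkℚᵘ (+ m) 0) (mkℚᵘ (+ n) 0))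

recip-inverse : ∀ d → recip (suc d) ℚ.* ℕ→ℚ (suc d) ≡ 1ℚ
recip-inverse d = ≡.trans (≡.sym (fromℚᵘ-homo-* (mkℚᵘ (+ 1) d) (mkℚᵘ (+ suc d) 0))) (ℚₚ.fromℚᵘ-cong {mkℚᵘ (+ 1) d ℚᵘ.* mkℚᵘ (+ suc d) 0} {mkℚᵘ (+ 1) 0} (*≡* eq))
  where
  eq : (+ 1 ℤ.* + suc d) ℤ.* + 1 ≡ + 1 ℤ.* (+ (suc d ℕ.* 1))
  eq = ≡.trans (ℤₚ.*-identityʳ (+ 1 ℤ.* + suc d)) (≡.cong (λ k → + 1 ℤ.* + k) (≡.sym (ℕₚ.*-identityʳ (suc d))))

-- For k = i + 2 the rational coefficient of the theorem is the natural number found in `κ-expand`.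
-- Natural multiples make sense over every commutative ring, which is what the abstract part works
-- with.
scalar-identity : ∀ {a b i} → a ≤ b → b ≤ i →
  recip (suc i) ℚ.* (ℕ→ℚ (suc i C b) ℚ.* ℕ→ℚ (b C a) ℚ.* ℕ→ℚ (suc i ∸ a)) ≡
  ℕ→ℚ ((i C a) ℕ.* (suc (i ∸ a) C (b ∸ a)))
scalar-identity {a} {b} {i} a≤b b≤i = begin
  recip (suc i) ℚ.* (ℕ→ℚ (suc i C b) ℚ.* ℕ→ℚ (b C a) ℚ.* ℕ→ℚ (suc i ∸ a))
    ≡⟨ ≡.cong (recip (suc i) ℚ.*_) (≡.trans (≡.cong (ℚ._* ℕ→ℚ (suc i ∸ a)) (≡.sym (ℕ→ℚ-* (suc i C b) (b C a))))
         (≡.sym (ℕ→ℚ-* ((suc i C b) ℕ.* (b C a)) (suc i ∸ a)))) ⟩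
  recip (suc i) ℚ.* ℕ→ℚ ((suc i C b) ℕ.* (b C a) ℕ.* (suc i ∸ a))
    ≡⟨ ≡.cong (λ k → recip (suc i) ℚ.* ℕ→ℚ k) (C-identity-∸ a≤b b≤i) ⟨
  recip (suc i) ℚ.* ℕ→ℚ (suc i ℕ.* w)
    ≡⟨ ≡.cong (recip (suc i) ℚ.*_) (ℕ→ℚ-* (suc i) w) ⟩
  recip (suc i) ℚ.* (ℕ→ℚ (suc i) ℚ.* ℕ→ℚ w)
    ≡⟨ ℚₚ.*-assoc (recip (suc i)) (ℕ→ℚ (suc i)) (ℕ→ℚ w) ⟨
  recip (suc i) ℚ.* ℕ→ℚ (suc i) ℚ.* ℕ→ℚ w
    ≡⟨ ≡.cong (ℚ._* ℕ→ℚ w) (recip-inverse i) ⟩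
  1ℚ ℚ.* ℕ→ℚ w
    ≡⟨ ℚₚ.*-identityˡ (ℕ→ℚ w) ⟩
  ℕ→ℚ w ∎
  where
  open ≡.≡-Reasoning
  w = (i C a) ℕ.* (suc (i ∸ a) C (b ∸ a))

-- Concrete q-integers and rational power series

module _ {c ℓ} (R : CommutativeRing c ℓ) where
  open CommutativeRing R hiding (zero)
  open FiniteSums R
  open Algebra.Properties.Semiring.Exp semiring using (_^_; ^-homo-*)
  open import Relation.Binary.Reasoning.Setoid setoid
  open SemiringSolver commutativeSemiring using (solve; _:=_; _:+_; _:*_; con)

  qIntegers : ∀ {L} q → q ^ L ≈ 0# → (v : ℕ → Carrier) → (∀ m → ∑ (suc m) (q ^_) * v m ≈ 1#) → QIntegers R L
  qIntegers q q^L≈0 v uv = record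
    { p = q ^_
    ; u = λ m → ∑ m (q ^_)
    ; v = v
    ; h = 1# + - q
    ; p-0 = refl
    ; p-+ = ^-homo-* q
    ; u-+ = u-+
    ; p+hu = p+hu
    ; uv = uv
    ; p-L = q^L≈0
    }
    where
    u-+ : ∀ m n → ∑ (m ℕ.+ n) (q ^_) ≈ ∑ m (q ^_) + q ^ m * ∑ n (q ^_)
    u-+ m zero    = trans (reflexive (≡.cong (λ k → ∑ k (q ^_)) (ℕₚ.+-identityʳ m)))
                          (sym (trans (+-congˡ (zeroʳ _)) (+-identityʳ _)))
    u-+ m (suc n) = begin
      ∑ (m ℕ.+ suc n) (q ^_)                              ≡⟨ ≡.cong (λ k → ∑ k (q ^_)) (ℕₚ.+-suc m n) ⟩
      ∑ (m ℕ.+ n) (q ^_) + q ^ (m ℕ.+ n)                  ≈⟨ +-cong (u-+ m n) (^-homo-* q m n) ⟩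
      ∑ m (q ^_) + q ^ m * ∑ n (q ^_) + q ^ m * q ^ n     ≈⟨ trans (+-assoc _ _ _) (+-congˡ (sym (distribˡ _ _ _))) ⟩
      ∑ m (q ^_) + q ^ m * ∑ (suc n) (q ^_)               ∎
    p+hu : ∀ m → q ^ m + (1# + - q) * ∑ m (q ^_) ≈ 1#
    p+hu zero    = trans (+-congˡ (zeroʳ _)) (+-identityʳ 1#)
    p+hu (suc m) = begin
      q * q ^ m + (1# + - q) * (∑ m (q ^_) + q ^ m)
        ≈⟨ solve 4 (λ q P q̄ S → q :* P :+ (con 1 :+ q̄) :* (S :+ P)
             := P :+ (con 1 :+ q̄) :* S :+ (q :+ q̄) :* P) refl q (q ^ m) (- q) (∑ m (q ^_)) ⟩
      q ^ m + (1# + - q) * ∑ m (q ^_) + (q + - q) * q ^ m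
        ≈⟨ +-cong (p+hu m) (trans (*-congʳ (-‿inverseʳ q)) (zeroˡ _)) ⟩
      1# + 0#
        ≈⟨ +-identityʳ 1# ⟩
      1# ∎

ℚ-ring : CommutativeRing _ _
ℚ-ring = ℚₚ.+-*-commutativeRing

open FiniteSums ℚ-ring using () renaming
  (∑ to ∑ℚ; ∑-cong to ∑ℚ-cong; ∑-cong< to ∑ℚ-cong<; ∑-0 to ∑ℚ-0; ∑-head to ∑ℚ-head)

sumTo≡∑ : ∀ n f → sumTo n f ≡ ∑ℚ n f
sumTo≡∑ zero    f = ≡.refl
sumTo≡∑ (suc n) f = ≡.cong (ℚ._+ f n) (sumTo≡∑ n f)

⊛≡∑ : ∀ f g N → (f ⊛ g) N ≡ ∑ℚ (suc N) (λ i → f i ℚ.* g (N ∸ i))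
⊛≡∑ f g N = sumTo≡∑ (suc N) _

⊗≡∑ : ∀ F G i j → (F ⊗ G) i j ≡ ∑ℚ (suc i) (λ a → ∑ℚ (suc j) (λ b → F a b ℚ.* G (i ∸ a) (j ∸ b)))
⊗≡∑ F G i j = ≡.trans (sumTo≡∑ (suc i) _) (∑ℚ-cong (suc i) (λ a → sumTo≡∑ (suc j) _))

-- The function `h` is general for the sake of the induction: removing the first element of `upTo`
-- leaves an `applyUpTo` of a shifted function.
sumℚ-invList : ∀ f (g : ℕ → ℚ) (h : ℕ → ℕ) n → sumℚ (zipWith ℚ._*_ (map g (applyUpTo h (suc n))) (invList f n)) ≡
               ∑ℚ (suc n) (λ i → g (h i) ℚ.* invUnit f (n ∸ i))
sumℚ-invList f g h zero    = ℚₚ.+-comm (g (h 0) ℚ.* 1ℚ) 0ℚ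
sumℚ-invList f g h (suc n) = ≡.trans
  (≡.cong (g (h 0) ℚ.* invUnit f (suc n) ℚ.+_) (sumℚ-invList f g (λ i → h (suc i)) n))
  (≡.sym (∑ℚ-head (suc n) (λ i → g (h i) ℚ.* invUnit f (suc n ∸ i))))

⊛-invUnit : ∀ f → f 0 ≡ 1ℚ → ∀ N → (f ⊛ invUnit f) N ≡ one₁ N
⊛-invUnit f f0 zero    = ≡.trans (ℚₚ.+-identityˡ _) (≡.trans (≡.cong (ℚ._* 1ℚ) f0) (ℚₚ.*-identityˡ 1ℚ))
⊛-invUnit f f0 (suc n) = begin
  (f ⊛ invUnit f) (suc n)                              ≡⟨ ⊛≡∑ f (invUnit f) (suc n) ⟩
  ∑ℚ (suc (suc n)) (λ i → f i ℚ.* invUnit f (suc n ∸ i)) ≡⟨ ∑ℚ-head (suc n) _ ⟩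
  f 0 ℚ.* invUnit f (suc n) ℚ.+ s                      ≡⟨ ≡.cong₂ (λ x y → x ℚ.* (ℚ.- y) ℚ.+ s) f0 (sumℚ-invList f (λ i → f (suc i)) (λ i → i) n) ⟩
  1ℚ ℚ.* (ℚ.- s) ℚ.+ s                                 ≡⟨ ≡.cong (ℚ._+ s) (ℚₚ.*-identityˡ (ℚ.- s)) ⟩
  ℚ.- s ℚ.+ s                                          ≡⟨ ℚₚ.+-inverseˡ s ⟩
  0ℚ                                                   ∎
  where
  open ≡.≡-Reasoning
  s = ∑ℚ (suc n) (λ i → f (suc i) ℚ.* invUnit f (n ∸ i))

shiftQ-suc : ∀ e f N → shiftQ (suc e) f (suc N) ≡ shiftQ e f N
shiftQ-suc zero    f N = ≡.refl
shiftQ-suc (suc e) f N = ≡.refl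

shiftQ-vanishes : ∀ e f {N} → N < e → shiftQ e f N ≡ 0ℚ
shiftQ-vanishes (suc e) f {zero}  N<e       = ≡.refl
shiftQ-vanishes (suc e) f {suc N} (s≤s N<e) = ≡.trans (shiftQ-suc e f N) (shiftQ-vanishes e f N<e)

shiftQ-⊛-vanishes : ∀ e f g {N} → N < e → (shiftQ e f ⊛ g) N ≡ 0ℚ
shiftQ-⊛-vanishes e f g {N} N<e = ≡.trans (⊛≡∑ (shiftQ e f) g N) (∑ℚ-0 (suc N) λ { i (s≤s i≤N) →
  ≡.trans (≡.cong (ℚ._* g (N ∸ i)) (shiftQ-vanishes e f (ℕₚ.≤-<-trans i≤N N<e))) (ℚₚ.*-zeroˡ (g (N ∸ i))) })

-- A largest variable m > N contributes only from q^((p-1)m) on, and (p - 1)m ≥ m > N. This is where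
-- admissibility enters.
zsum-truncate : ∀ {p} ps {N B} → 2 ≤ p → N ≤ B → zsum (p ∷ ps) (suc B) N ≡ zsum (p ∷ ps) (suc N) N
zsum-truncate {p} ps {N} {B} 2≤p N≤B = ≡.trans
  (≡.cong (λ B → zsum (p ∷ ps) (suc B) N) (≡.sym (ℕₚ.m∸n+n≡m N≤B))) (go (B ∸ N))
  where
  go : ∀ d → zsum (p ∷ ps) (suc (d ℕ.+ N)) N ≡ zsum (p ∷ ps) (suc N) N
  go zero    = ≡.refl
  go (suc d) = ≡.trans (≡.cong₂ ℚ._+_ (go d) (shiftQ-⊛-vanishes ((p ∸ 1) ℕ.* m) (pow₁ (invUnit (qInt m)) p) (zsum ps m) N<)) (ℚₚ.+-identityʳ _)
    where
    m = suc (d ℕ.+ N)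
    N< : N < (p ∸ 1) ℕ.* m
    N< = ℕₚ.<-≤-trans (s≤s (ℕₚ.m≤n+m N d)) (ℕₚ.m≤n*m m (p ∸ 1) {{ℕ.>-nonZero (ℕₚ.∸-monoˡ-≤ 1 2≤p)}})

-- Interpretation of series in q and t in the truncated ring

module Bigraded (L K : ℕ) where
  open NestedSeries ℚ-ring K L
  open CommutativeRing Y.seriesRing hiding (zero)
  open FiniteSums Y.seriesRing
  open ListSums Y.seriesRing
  open Algebra.Properties.Semiring.Exp semiring using (_^_; ^-assocʳ)
  open import Relation.Binary.Reasoning.Setoid setoid

  A : CommutativeRing _ _
  A = Y.seriesRing

  ⟪_⟫ : Series₂ → Carrier
  ⟪ F ⟫ = series₂ F

  coeff-⟪⟫ : ∀ F i j → coeff₂ ⟪ F ⟫ i j ≡ F i j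
  coeff-⟪⟫ = coeff₂-series₂

  ⟪⟫-cong : ∀ {F G} → (∀ i j → i < L → F i j ≡ G i j) → ⟪ F ⟫ ≈ ⟪ G ⟫
  ⟪⟫-cong {F} {G} F≡G = ≈-from-coeff₂ λ i j i<L _ →
    ≡.trans (coeff-⟪⟫ F i j) (≡.trans (F≡G i j i<L) (≡.sym (coeff-⟪⟫ G i j)))

  ⟪⟫-⊕ : ∀ F G → ⟪ F ⊕ G ⟫ ≈ ⟪ F ⟫ + ⟪ G ⟫
  ⟪⟫-⊕ F G = ≈-from-coeff₂ λ i j _ _ → ≡.trans (coeff-⟪⟫ (F ⊕ G) i j)
    (≡.sym (≡.trans (coeff₂-+ ⟪ F ⟫ ⟪ G ⟫ i j) (≡.cong₂ ℚ._+_ (coeff-⟪⟫ F i j) (coeff-⟪⟫ G i j))))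

  ⟪⟫-zero₂ : ⟪ zero₂ ⟫ ≈ 0#
  ⟪⟫-zero₂ = ≈-from-coeff₂ λ i j _ _ → ≡.trans (coeff-⟪⟫ zero₂ i j) (≡.sym (coeff₂-0 i j))

  ⟪⟫-one₂ : ⟪ one₂ ⟫ ≈ 1#
  ⟪⟫-one₂ = ≈-from-coeff₂ λ i j _ _ → ≡.trans (coeff-⟪⟫ one₂ i j) (≡.sym (eq i j))
    where
    eq : ∀ i j → coeff₂ 1# i j ≡ one₂ i j
    eq zero    zero    = coeff₂-1
    eq zero    (suc j) = coeff₂-1-x j
    eq (suc i) j       = coeff₂-1-y i j

  ⟪⟫-neg₂ : ∀ F → ⟪ neg₂ F ⟫ ≈ - ⟪ F ⟫
  ⟪⟫-neg₂ F = ≈-from-coeff₂ λ i j _ _ → ≡.trans (coeff-⟪⟫ (neg₂ F) i j)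
    (≡.sym (≡.trans (coeff₂-neg ⟪ F ⟫ i j) (≡.cong ℚ.-_ (coeff-⟪⟫ F i j))))

  ⟪⟫-⊗ : ∀ F G → ⟪ F ⊗ G ⟫ ≈ ⟪ F ⟫ * ⟪ G ⟫
  ⟪⟫-⊗ F G = ≈-from-coeff₂ λ i j _ _ → ≡.trans (coeff-⟪⟫ (F ⊗ G) i j)
    (≡.trans (⊗≡∑ F G i j) (≡.sym (≡.trans (coeff₂-* ⟪ F ⟫ ⟪ G ⟫ i j)
      (∑ℚ-cong (suc i) (λ a → ∑ℚ-cong (suc j) (λ b → ≡.cong₂ ℚ._*_ (coeff-⟪⟫ F a b) (coeff-⟪⟫ G (i ∸ a) (j ∸ b))))))))

  ⟪⟫-pow₂ : ∀ {F x} → ⟪ F ⟫ ≈ x → ∀ n → ⟪ pow₂ F n ⟫ ≈ x ^ n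
  ⟪⟫-pow₂ F≈x zero    = ⟪⟫-one₂
  ⟪⟫-pow₂ F≈x (suc n) = trans (⟪⟫-⊗ _ _) (*-cong F≈x (⟪⟫-pow₂ F≈x n))

  ⟪⟫-sum₂ : ∀ {b} {B : Set b} (f : B → Series₂) xs → ⟪ sum₂ (map f xs) ⟫ ≈ ∑ₗ xs (λ x → ⟪ f x ⟫)
  ⟪⟫-sum₂ f []       = ⟪⟫-zero₂
  ⟪⟫-sum₂ f (x ∷ xs) = trans (⟪⟫-⊕ (f x) _) (+-congˡ (⟪⟫-sum₂ f xs))

  ⟪⟫-sumTo₂ : ∀ n F → ⟪ sumTo₂ n F ⟫ ≈ ∑ n (λ i → ⟪ F i ⟫)
  ⟪⟫-sumTo₂ zero    F = ⟪⟫-zero₂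
  ⟪⟫-sumTo₂ (suc n) F = trans (⟪⟫-⊕ _ (F n)) (+-congʳ (⟪⟫-sumTo₂ n F))

  scalar : ℚ → Carrier
  scalar c = Y.const (X.const c)

  ⟪⟫-scale : ∀ c F → ⟪ scale c F ⟫ ≈ scalar c * ⟪ F ⟫
  ⟪⟫-scale c F = ≈-from-coeff₂ λ i j _ j<K → ≡.trans (coeff-⟪⟫ (scale c F) i j) (≡.sym (≡.trans
    (X.coeff-cong j<K (Y.coeff-const-* (X.const c) ⟪ F ⟫ i))
    (≡.trans (X.coeff-const-* c _ j) (≡.cong (c ℚ.*_) (coeff-⟪⟫ F i j)))))

  scalar-* : ∀ c d → scalar (c ℚ.* d) ≈ scalar c * scalar d
  scalar-* c d = trans (Y.const-cong (X.const-*-homo c d)) (Y.const-*-homo (X.const c) (X.const d))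

  open import Algebra.Properties.Semiring.Mult semiring using () renaming (_×_ to _·_)

  scalar-ℕ→ℚ : ∀ n x → scalar (ℕ→ℚ n) * x ≈ n · x
  scalar-ℕ→ℚ zero    x = trans (*-congʳ (trans (Y.const-cong X.const-0-homo) Y.const-0-homo)) (zeroˡ x)
  scalar-ℕ→ℚ (suc n) x = begin
    scalar (ℕ→ℚ (suc n)) * x                   ≡⟨ ≡.cong (λ c → scalar c * x) (ℕ→ℚ-suc n) ⟩
    scalar (1ℚ ℚ.+ ℕ→ℚ n) * x                  ≈⟨ *-congʳ (trans (Y.const-cong (X.const-+-homo 1ℚ (ℕ→ℚ n)))
                                                    (Y.const-+-homo (X.const 1ℚ) (X.const (ℕ→ℚ n)))) ⟩
    (scalar 1ℚ + scalar (ℕ→ℚ n)) * x           ≈⟨ distribʳ x _ _ ⟩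
    scalar 1ℚ * x + scalar (ℕ→ℚ n) * x         ≈⟨ +-cong (trans (*-congʳ (trans (Y.const-cong X.const-1-homo) Y.const-1-homo)) (*-identityˡ x))
                                                         (scalar-ℕ→ℚ n x) ⟩
    x + n · x                                  ∎

  q t t′ : Carrier
  q = Y.X
  t = Y.const X.X
  t′ = 1# + - t

  ⟪⟫-qVar : ⟪ qVar ⟫ ≈ q
  ⟪⟫-qVar = trans (≈-from-coeff₂ λ i j i<L j<K → ≡.trans (coeff-⟪⟫ qVar i j) (≡.sym (eq i j j<K))) (*-identityʳ q)
    where
    eq : ∀ i j → j < K → coeff₂ (q * 1#) i j ≡ qVar i j
    eq zero          j       j<K = coeff₂-y-zero 1# j<K
    eq (suc zero)    zero    j<K = ≡.trans (coeff₂-y-suc 1# 0 j<K) coeff₂-1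
    eq (suc zero)    (suc j) j<K = ≡.trans (coeff₂-y-suc 1# 0 j<K) (coeff₂-1-x j)
    eq (suc (suc i)) j       j<K = ≡.trans (coeff₂-y-suc 1# (suc i) j<K) (coeff₂-1-y i j)

  ⟪⟫-tVar : ⟪ tVar ⟫ ≈ t
  ⟪⟫-tVar = trans (≈-from-coeff₂ λ i j i<L j<K → ≡.trans (coeff-⟪⟫ tVar i j) (≡.sym (≡.trans
    (X.coeff-cong j<K (Y.coeff-const-* X.X 1# i)) (≡.trans (X.coeff-X-* (Y.coeff 1# i) j) (eq i j))))) (*-identityʳ t)
    where
    eq : ∀ i j → X.shift (coeff₂ 1# i) j ≡ tVar i j
    eq zero    zero          = ≡.refl
    eq zero    (suc zero)    = coeff₂-1
    eq zero    (suc (suc j)) = coeff₂-1-x j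
    eq (suc i) zero          = ≡.refl
    eq (suc i) (suc j)       = coeff₂-1-y i j

  ⟪⟫-oneMinus : ∀ {F x} → ⟪ F ⟫ ≈ x → ⟪ one₂ ⊕ neg₂ F ⟫ ≈ 1# + - x
  ⟪⟫-oneMinus {F} F≈x = trans (⟪⟫-⊕ one₂ (neg₂ F)) (+-cong ⟪⟫-one₂ (trans (⟪⟫-neg₂ F) (-‿cong F≈x)))

  lift : Series → Carrier
  lift f = ⟪ liftQ f ⟫

  lift-cong : ∀ {f g} → (∀ i → i < L → f i ≡ g i) → lift f ≈ lift g
  lift-cong f≡g = ⟪⟫-cong λ { i zero i<L → f≡g i i<L ; i (suc j) _ → ≡.refl }

  lift-0 : lift (λ _ → 0ℚ) ≈ 0#
  lift-0 = trans (⟪⟫-cong λ { i zero _ → ≡.refl ; i (suc j) _ → ≡.refl }) ⟪⟫-zero₂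

  lift-1 : lift one₁ ≈ 1#
  lift-1 = trans (⟪⟫-cong λ { zero zero _ → ≡.refl ; zero (suc j) _ → ≡.refl ; (suc i) zero _ → ≡.refl ; (suc i) (suc j) _ → ≡.refl }) ⟪⟫-one₂

  lift-+ : ∀ f g → lift (λ i → f i ℚ.+ g i) ≈ lift f + lift g
  lift-+ f g = trans (⟪⟫-cong λ { i zero _ → ≡.refl ; i (suc j) _ → ≡.refl }) (⟪⟫-⊕ (liftQ f) (liftQ g))

  lift-⊛ : ∀ f g → lift (f ⊛ g) ≈ lift f * lift g
  lift-⊛ f g = trans (⟪⟫-cong λ i j _ → eq i j) (⟪⟫-⊗ (liftQ f) (liftQ g))
    where
    eq : ∀ i j → liftQ (f ⊛ g) i j ≡ (liftQ f ⊗ liftQ g) i j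
    eq i zero    = ≡.trans (⊛≡∑ f g i) (≡.sym (≡.trans (⊗≡∑ (liftQ f) (liftQ g) i 0)
      (∑ℚ-cong (suc i) (λ a → ℚₚ.+-identityˡ _))))
    eq i (suc j) = ≡.sym (≡.trans (⊗≡∑ (liftQ f) (liftQ g) i (suc j)) (∑ℚ-0 (suc i) (λ a _ → ∑ℚ-0 (suc (suc j)) (λ b _ → vanish a b))))
      where
      vanish : ∀ a b → liftQ f a b ℚ.* liftQ g (i ∸ a) (suc j ∸ b) ≡ 0ℚ
      vanish a zero    = ℚₚ.*-zeroʳ (f a)
      vanish a (suc b) = ℚₚ.*-zeroˡ (liftQ g (i ∸ a) (j ∸ b))

  lift-pow₁ : ∀ f n → lift (pow₁ f n) ≈ lift f ^ n
  lift-pow₁ f zero    = lift-1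
  lift-pow₁ f (suc n) = trans (lift-⊛ f (pow₁ f n)) (*-congˡ (lift-pow₁ f n))

  q*lift : ∀ f g → g 0 ≡ 0ℚ → (∀ i → g (suc i) ≡ f i) → lift g ≈ q * lift f
  q*lift f g g0 gs = ≈-from-coeff₂ λ i j _ j<K → ≡.trans (coeff-⟪⟫ (liftQ g) i j) (≡.sym (eq i j j<K))
    where
    eq : ∀ i j → j < K → coeff₂ (q * lift f) i j ≡ liftQ g i j
    eq zero    zero    j<K = ≡.trans (coeff₂-y-zero (lift f) j<K) (≡.sym g0)
    eq zero    (suc j) j<K = coeff₂-y-zero (lift f) j<K
    eq (suc i) zero    j<K = ≡.trans (coeff₂-y-suc (lift f) i j<K) (≡.trans (coeff-⟪⟫ (liftQ f) i 0) (≡.sym (gs i)))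
    eq (suc i) (suc j) j<K = ≡.trans (coeff₂-y-suc (lift f) i j<K) (coeff-⟪⟫ (liftQ f) i (suc j))

  lift-shiftQ : ∀ e f → lift (shiftQ e f) ≈ q ^ e * lift f
  lift-shiftQ zero    f = trans (lift-cong (λ i _ → ≡.refl)) (sym (*-identityˡ _))
  lift-shiftQ (suc e) f = trans (q*lift (shiftQ e f) (shiftQ (suc e) f) ≡.refl (shiftQ-suc e f))
    (trans (*-congˡ (lift-shiftQ e f)) (sym (*-assoc _ _ _)))

  lift-qInt : ∀ m → lift (qInt m) ≈ ∑ m (q ^_)
  lift-qInt zero    = lift-0
  lift-qInt (suc m) = begin
    lift (qInt (suc m))                    ≈⟨ lift-cong (λ { zero _ → ≡.sym (ℚₚ.+-identityʳ 1ℚ) ; (suc i) _ → ≡.sym (ℚₚ.+-identityˡ _) }) ⟩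
    lift (λ i → one₁ i ℚ.+ shifted i)      ≈⟨ lift-+ one₁ shifted ⟩
    lift one₁ + lift shifted               ≈⟨ +-cong lift-1 (q*lift (qInt m) shifted ≡.refl (λ _ → ≡.refl)) ⟩
    1# + q * lift (qInt m)                 ≈⟨ +-congˡ (trans (*-congˡ (lift-qInt m)) (*-∑ m q (q ^_))) ⟩
    1# + ∑ m (λ i → q ^ suc i)             ≈⟨ ∑-head m (q ^_) ⟨
    ∑ (suc m) (q ^_)                       ∎
    where
    shifted : Series
    shifted zero    = 0ℚ
    shifted (suc i) = qInt m i

  q^L≈0 : q ^ L ≈ 0#
  q^L≈0 = begin
    q ^ L                    ≈⟨ trans (*-congˡ lift-1) (*-identityʳ _) ⟨
    q ^ L * lift one₁        ≈⟨ lift-shiftQ L one₁ ⟨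
    lift (shiftQ L one₁)     ≈⟨ lift-cong (λ i → shiftQ-vanishes L one₁) ⟩
    lift (λ _ → 0ℚ)          ≈⟨ lift-0 ⟩
    0#                       ∎

  Q : QIntegers A L
  Q = qIntegers A q q^L≈0 (λ m → lift (invUnit (qInt (suc m)))) λ m →
    trans (*-congʳ (sym (lift-qInt (suc m)))) (trans (sym (lift-⊛ (qInt (suc m)) (invUnit (qInt (suc m)))))
      (trans (lift-cong (λ i _ → ⊛-invUnit (qInt (suc m)) ≡.refl i)) lift-1))

  t+t′ : t + t′ ≈ 1#
  t+t′ = begin
    t + (1# + - t)     ≈⟨ +-congˡ (+-comm 1# (- t)) ⟩
    t + (- t + 1#)     ≈⟨ +-assoc _ _ _ ⟨
    t + - t + 1#       ≈⟨ trans (+-congʳ (-‿inverseʳ t)) (+-identityˡ 1#) ⟩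
    1#                 ∎

  open QIntegers Q using (h)
  open Interpolation A L Q t

  lift-zTerm : ∀ p m → lift (zTerm p (suc m)) ≈ zt p m
  lift-zTerm p m = trans (lift-shiftQ ((p ∸ 1) ℕ.* suc m) (pow₁ (invUnit (qInt (suc m))) p))
    (*-cong (trans (reflexive (≡.cong (q ^_) (ℕₚ.*-comm (p ∸ 1) (suc m)))) (sym (^-assocʳ q (suc m) (p ∸ 1))))
            (lift-pow₁ (invUnit (qInt (suc m))) p))

  -- The bound is offset by one because `zsum` has a dummy term at variable 0, whereas the variable
  -- of `ζ` is shifted down.
  lift-zsum : ∀ ps B → lift (zsum ps (suc B)) ≈ ζ ps B
  lift-zsum []       B       = trans (lift-cong (λ _ _ → ≡.refl)) lift-1
  lift-zsum (p ∷ ps) zero    = trans (lift-cong (λ _ _ → ≡.refl)) lift-0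
  lift-zsum (p ∷ ps) (suc B) = trans (lift-cong (λ _ _ → ≡.refl))
    (trans (lift-+ (zsum (p ∷ ps) (suc B)) (zTerm p (suc B) ⊛ zsum ps (suc B)))
      (+-cong (lift-zsum (p ∷ ps) B) (trans (lift-⊛ (zTerm p (suc B)) (zsum ps (suc B)))
        (*-cong (lift-zTerm p B) (lift-zsum ps B)))))

  -- In `zetaQ` the bound varies with the coefficient. Modulo q^L one bound serves all coefficients,
  -- and the series becomes a finite sum in the ring.
  lift-zetaQ : ∀ {p} ps → 2 ≤ p → lift (zetaQ (p ∷ ps)) ≈ ζ (p ∷ ps) L
  lift-zetaQ {p} ps 2≤p = trans (lift-cong (λ i i<L → ≡.sym (zsum-truncate ps 2≤p (ℕₚ.<⇒≤ i<L)))) (lift-zsum (p ∷ ps) L)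

Admissible : List ℕ → Set
Admissible ks = ∃₂ λ a ks′ → ks ≡ a ∷ ks′ × 2 ≤ a × All (1 ≤_) ks′

admissibleIndices-Admissible : ∀ w n → All Admissible (admissibleIndices w n)
admissibleIndices-Admissible w n = filtered (indices-positive w n)
  where
  filtered : ∀ {xs} → All (All (1 ≤_)) xs → All Admissible (filterᵇ isAdmissible xs)
  filtered [] = []
  filtered {[] ∷ _}             (_ ∷ ps)         = filtered ps
  filtered {(zero ∷ _) ∷ _}     (_ ∷ ps)         = filtered ps
  filtered {(suc zero ∷ _) ∷ _} (_ ∷ ps)         = filtered ps
  filtered {(suc (suc a) ∷ ks) ∷ _} ((_ ∷ p) ∷ ps) = (suc (suc a) , ks , ≡.refl , s≤s (s≤s z≤n) , p) ∷ filtered ps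

-- The sum formula

module BigradedSumFormula (L K : ℕ) where
  open Bigraded L K
  open CommutativeRing A hiding (zero)
  open FiniteSums A
  open ListSums A
  open QIntegers Q using (h)
  open Interpolation A L Q t
  open Algebra.Properties.Semiring.Exp semiring using (_^_)
  open import Algebra.Properties.Semiring.Mult semiring using (×-congʳ; ×-assoc-*) renaming (_×_ to _·_)
  open import Relation.Binary.Reasoning.Setoid setoid
  open SemiringSolver commutativeSemiring using (solve; _:=_; _:*_)

  ⟪⟫-oneMinusQ : ⟪ oneMinusQ ⟫ ≈ h
  ⟪⟫-oneMinusQ = ⟪⟫-oneMinus ⟪⟫-qVar

  -- The first entry of a filling is at least a ≥ 2, so its ζ_q is a finite sum modulo q^L, whatever
  -- the later entries are.
  ⟪⟫-term : ∀ w d {a ks p} → 2 ≤ a → Filling a ks p →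
    ⟪ pow₂ oneMinusQ (w ∸ wt p) ⊗ liftQ (zetaQ p) ⊗ pow₂ tVar (d ∸ dep p) ⟫ ≈ ∑ L (λ m → term w d p (ζtop p m))
  ⟪⟫-term w d {p = p} 2≤a (b , ps , ≡.refl , a≤b , _) = begin
    ⟪ pow₂ oneMinusQ (w ∸ wt p) ⊗ liftQ (zetaQ p) ⊗ pow₂ tVar (d ∸ dep p) ⟫
      ≈⟨ trans (⟪⟫-⊗ _ _) (*-congʳ (⟪⟫-⊗ _ _)) ⟩
    ⟪ pow₂ oneMinusQ (w ∸ wt p) ⟫ * lift (zetaQ p) * ⟪ pow₂ tVar (d ∸ dep p) ⟫
      ≈⟨ *-cong (*-cong (⟪⟫-pow₂ ⟪⟫-oneMinusQ (w ∸ wt p)) (lift-zetaQ ps (ℕₚ.≤-trans 2≤a a≤b))) (⟪⟫-pow₂ ⟪⟫-tVar (d ∸ dep p)) ⟩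
    term w d p (∑ L (ζtop p))
      ≈⟨ term-∑ w d p L (ζtop p) ⟩
    ∑ L (λ m → term w d p (ζtop p m)) ∎

  ⟪⟫-zetaTQ : ∀ {ks} → Admissible ks → ⟪ zetaTQ ks ⟫ ≈ ∑ L (star ks)
  ⟪⟫-zetaTQ (a , ks , ≡.refl , 2≤a , pos) = begin
    ⟪ zetaTQ (a ∷ ks) ⟫
      ≈⟨ ⟪⟫-sum₂ _ (fillFrom a ks) ⟩
    ∑ₗ (fillFrom a ks) _
      ≈⟨ ∑ₗ-congAll (fillFrom-Filling a pos) (⟪⟫-term (a ℕ.+ wt ks) (suc (dep ks)) {ks = ks} 2≤a) ⟩
    ∑ₗ (fillFrom a ks) (λ p → ∑ L (λ m → term (a ℕ.+ wt ks) (suc (dep ks)) p (ζtop p m)))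
      ≈⟨ ∑ₗ-∑ (fillFrom a ks) L _ ⟩
    ∑ L (λ m → ∑ₗ (fillFrom a ks) (λ p → term (a ℕ.+ wt ks) (suc (dep ks)) p (ζtop p m)))
      ≈⟨ ∑-cong L (λ m → ∑-fillFrom a ks m (ℕₚ.<⇒≤ 2≤a) pos) ⟩
    ∑ L (star (a ∷ ks)) ∎

  ⟪⟫-lhs : ∀ w n → ⟪ sum₂ (map zetaTQ (admissibleIndices w n)) ⟫ ≈
           ∑ L (λ m → ∑ₗ (admissibleIndices w n) (λ ks → star ks m))
  ⟪⟫-lhs w n = begin
    ⟪ sum₂ (map zetaTQ (admissibleIndices w n)) ⟫             ≈⟨ ⟪⟫-sum₂ zetaTQ (admissibleIndices w n) ⟩
    ∑ₗ (admissibleIndices w n) (λ ks → ⟪ zetaTQ ks ⟫)         ≈⟨ ∑ₗ-congAll (admissibleIndices-Admissible w n) ⟪⟫-zetaTQ ⟩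
    ∑ₗ (admissibleIndices w n) (λ ks → ∑ L (star ks))         ≈⟨ ∑ₗ-∑ (admissibleIndices w n) L star ⟩
    ∑ L (λ m → ∑ₗ (admissibleIndices w n) (λ ks → star ks m)) ∎

  module _ {i j : ℕ} (j≤i : j ≤ i) where
    -- The smallest bounds in x and y that still retain weight i + 2 and depth j + 1.
    open SumFormula A L Q t t′ t+t′ (suc (suc (suc i))) (suc (suc j)) using (∑-admissibleSum; module C)

    -- The multiplicity supplied by `κ-expand`, not the weight of an index.
    weight : ℕ → ℕ → ℕ
    weight b a = (i C a) ℕ.* (suc (i ∸ a) C (b ∸ a))

    summand : ℕ → ℕ → Carrier
    summand b a = weight b a · (t ^ b * t′ ^ (j ∸ b) * h ^ a * ζ ((suc (suc i) ∸ a) ∷ []) L)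

    ∑-κ : ∀ {b} → b ≤ i → ∑ L (λ m → C.κ m i b * (t ^ b * t′ ^ (j ∸ b))) ≈ ∑ (suc b) (summand b)
    ∑-κ {b} b≤i = begin
      ∑ L (λ m → C.κ m i b * x)
        ≈⟨ ∑-cong L (λ m → *-congʳ (C.κ-expand m b≤i)) ⟩
      ∑ L (λ m → ∑ (suc b) (λ a → weight b a · (h ^ a * zt (suc (suc (i ∸ a))) m)) * x)
        ≈⟨ trans (∑-cong L (λ m → ∑-* (suc b) _ x)) (∑-swap L (suc b) _) ⟩
      ∑ (suc b) (λ a → ∑ L (λ m → weight b a · (h ^ a * zt (suc (suc (i ∸ a))) m) * x))
        ≈⟨ ∑-cong< (suc b) (λ { a (s≤s a≤b) → collect a (ℕₚ.≤-trans a≤b b≤i) }) ⟩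
      ∑ (suc b) (summand b) ∎
      where
      x = t ^ b * t′ ^ (j ∸ b)
      ·-∑ : ∀ n M f → n · ∑ M f ≈ ∑ M (λ m → n · f m)
      ·-∑ n M f = trans (×-congʳ n (sym (*-identityˡ _))) (trans (sym (×-assoc-* n 1# _)) (trans (*-∑ M _ f)
        (∑-cong M (λ m → trans (×-assoc-* n 1# (f m)) (×-congʳ n (*-identityˡ (f m)))))))
      collect : ∀ a → a ≤ i → ∑ L (λ m → weight b a · (h ^ a * zt (suc (suc (i ∸ a))) m) * x) ≈ summand b a
      collect a a≤i = begin
        ∑ L (λ m → weight b a · (h ^ a * zt k m) * x)
          ≈⟨ ∑-cong L (λ m → trans (×-assoc-* (weight b a) _ x) (×-congʳ (weight b a)
               (trans (solve 3 (λ h z x → h :* z :* x := x :* h :* z) refl (h ^ a) (zt k m) x)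
                      (*-congˡ (sym (*-identityʳ (zt k m))))))) ⟩
        ∑ L (λ m → weight b a · (x * h ^ a * (zt k m * 1#)))
          ≈⟨ trans (sym (·-∑ (weight b a) L _)) (×-congʳ (weight b a) (sym (*-∑ L (x * h ^ a) _))) ⟩
        weight b a · (x * h ^ a * ζ (k ∷ []) L)
          ≡⟨ ≡.cong (λ k → weight b a · (x * h ^ a * ζ (k ∷ []) L)) (≡.sym (ℕₚ.+-∸-assoc 2 a≤i)) ⟩
        summand b a ∎
        where k = suc (suc (i ∸ a))

    ∑-H : ∑ L (λ m → C.H m i j) ≈ ∑ (suc j) (λ b → ∑ (suc b) (summand b))
    ∑-H = trans (∑-swap L (suc j) _)
      (∑-cong< (suc j) (λ { b (s≤s b≤j) → ∑-κ (ℕₚ.≤-trans b≤j j≤i) }))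

    coefficient : ℕ → ℕ → ℚ
    coefficient b a = ℕ→ℚ (suc i C b) ℚ.* ℕ→ℚ (b C a) ℚ.* ℕ→ℚ (suc i ∸ a)

    monomial : ℕ → ℕ → Series₂
    monomial b a = pow₂ tVar b ⊗ pow₂ oneMinusT (j ∸ b) ⊗ pow₂ oneMinusQ a ⊗ liftQ (zetaQ ((suc (suc i) ∸ a) ∷ []))

    ⟪⟫-summand : ∀ {b a} → a ≤ b → b ≤ i → scalar (recip (suc i)) * ⟪ scale (coefficient b a) (monomial b a) ⟫ ≈ summand b a
    ⟪⟫-summand {b} {a} a≤b b≤i = begin
      scalar (recip (suc i)) * ⟪ scale (coefficient b a) (monomial b a) ⟫
        ≈⟨ trans (*-congˡ (⟪⟫-scale (coefficient b a) (monomial b a))) (sym (*-assoc _ _ _)) ⟩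
      scalar (recip (suc i)) * scalar (coefficient b a) * ⟪ monomial b a ⟫
        ≈⟨ *-congʳ (sym (scalar-* (recip (suc i)) (coefficient b a))) ⟩
      scalar (recip (suc i) ℚ.* coefficient b a) * ⟪ monomial b a ⟫
        ≡⟨ ≡.cong (λ c → scalar c * ⟪ monomial b a ⟫) (scalar-identity a≤b b≤i) ⟩
      scalar (ℕ→ℚ (weight b a)) * ⟪ monomial b a ⟫
        ≈⟨ scalar-ℕ→ℚ (weight b a) ⟪ monomial b a ⟫ ⟩
      weight b a · ⟪ monomial b a ⟫
        ≈⟨ ×-congʳ (weight b a) (trans (⟪⟫-⊗ _ _) (*-cong (trans (⟪⟫-⊗ _ _) (*-cong (trans (⟪⟫-⊗ _ _)
             (*-cong (⟪⟫-pow₂ ⟪⟫-tVar b) (⟪⟫-pow₂ (⟪⟫-oneMinus ⟪⟫-tVar) (j ∸ b))))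
             (⟪⟫-pow₂ ⟪⟫-oneMinusQ a))) (lift-zetaQ [] 2≤))) ⟩
      summand b a ∎
      where
      2≤ : 2 ≤ suc (suc i) ∸ a
      2≤ = ≡.subst (2 ≤_) (≡.sym (ℕₚ.+-∸-assoc 2 (ℕₚ.≤-trans a≤b b≤i))) (s≤s (s≤s z≤n))

    ⟪⟫-rhs : ⟪ scale (recip (suc i)) (sumTo₂ (suc j) (λ b → sumTo₂ (suc b) (λ a → scale (coefficient b a) (monomial b a)))) ⟫ ≈
             ∑ (suc j) (λ b → ∑ (suc b) (summand b))
    ⟪⟫-rhs = begin
      ⟪ scale (recip (suc i)) (sumTo₂ (suc j) (λ b → sumTo₂ (suc b) (F b))) ⟫
        ≈⟨ trans (⟪⟫-scale (recip (suc i)) _) (*-congˡ (⟪⟫-sumTo₂ (suc j) _)) ⟩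
      r * ∑ (suc j) (λ b → ⟪ sumTo₂ (suc b) (F b) ⟫)
        ≈⟨ *-∑ (suc j) r _ ⟩
      ∑ (suc j) (λ b → r * ⟪ sumTo₂ (suc b) (F b) ⟫)
        ≈⟨ ∑-cong< (suc j) (λ { b (s≤s b≤j) → trans (*-congˡ (⟪⟫-sumTo₂ (suc b) (F b))) (trans (*-∑ (suc b) r _)
             (∑-cong< (suc b) (λ { a (s≤s a≤b) → ⟪⟫-summand a≤b (ℕₚ.≤-trans b≤j j≤i) }))) }) ⟩
      ∑ (suc j) (λ b → ∑ (suc b) (summand b)) ∎
      where
      r = scalar (recip (suc i))
      F : ℕ → ℕ → Series₂
      F b a = scale (coefficient b a) (monomial b a)

    sumFormula : ⟪ sum₂ (map zetaTQ (admissibleIndices (suc (suc i)) (suc j))) ⟫ ≈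
      ⟪ scale (recip (suc i)) (sumTo₂ (suc j) (λ b → sumTo₂ (suc b) (λ a → scale (coefficient b a) (monomial b a)))) ⟫
    sumFormula = trans (⟪⟫-lhs (suc (suc i)) (suc j))
      (trans (∑-admissibleSum j≤i ℕₚ.≤-refl ℕₚ.≤-refl) (trans ∑-H (sym ⟪⟫-rhs)))

open import Data.Rational using (_*_)

theorem2p2 : (k n : ℕ) → 1 ≤ n → n < k → (i j : ℕ) →
    sum₂ (map zetaTQ (admissibleIndices k n)) i j
    ≡ scale (recip (k ∸ 1))
    (sumTo₂ n (λ b → sumTo₂ (suc b) (λ a →
    scale (ℕ→ℚ ((k ∸ 1) C b) * ℕ→ℚ (b C a) * ℕ→ℚ (k ∸ 1 ∸ a))
    (pow₂ tVar b ⊗ pow₂ oneMinusT (n ∸ 1 ∸ b)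
    ⊗ pow₂ oneMinusQ a ⊗ liftQ (zetaQ ((k ∸ a) ∷ [])))))) i j
theorem2p2 (suc (suc k)) (suc n) _ (s≤s (s≤s n≤k)) i j =
  -- Equality in the truncated ring controls only coefficients below its bounds, so the ring is
  -- chosen for the coefficient at hand: modulo q^(i+1) and t^(j+1).
  ≡.trans (≡.sym (coeff-⟪⟫ lhs i j))
    (≡.trans (coeff₂-cong ℕₚ.≤-refl ℕₚ.≤-refl (sumFormula n≤k)) (coeff-⟪⟫ rhs i j))
  where
  open NestedSeries ℚ-ring (suc j) (suc i) using (coeff₂-cong)
  open Bigraded (suc i) (suc j) using (coeff-⟪⟫)
  open BigradedSumFormula (suc i) (suc j) using (sumFormula)
  lhs rhs : Series₂
  lhs = sum₂ (map zetaTQ (admissibleIndices (suc (suc k)) (suc n)))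
  rhs = scale (recip (suc k)) (sumTo₂ (suc n) (λ b → sumTo₂ (suc b) (λ a →
    scale (ℕ→ℚ (suc k C b) * ℕ→ℚ (b C a) * ℕ→ℚ (suc k ∸ a))
      (pow₂ tVar b ⊗ pow₂ oneMinusT (n ∸ b) ⊗ pow₂ oneMinusQ a ⊗ liftQ (zetaQ ((suc (suc k) ∸ a) ∷ []))))))
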